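{- For every integer $k\geqslant2$, the ghost measure of the $k$-Zaremba sequence $z_k$ exists and is singular continuous, i.e. it has no atoms and is singular with respect to Lebesgue measure (its distribution function is continuous with derivative $0$ Lebesgue-almost everywhere).
   Context: For $k\geqslant2$ let ${\bf B}_i=\begin{pmatrix}i+1&1\\1&0\end{pmatrix}$ for $i=0,\dots,k-1$. The $k$-Zaremba sequence is $z_k(m)=(1\ 0)\,{\bf B}_{i_s}\cdots{\bf B}_{i_1}{\bf B}_{i_0}\,e_1$ for $m\geqslant1$ with base-$k$ expansion $i_s\cdots i_1i_0$, where $e_1=(1,0)^T$; it is a $k$-regular sequence with digit matrices ${\bf B}_0,\dots,{\bf B}_{k-1}$. For a sequence $f$, let $\Sigma(n)=\sum_{m=k^n}^{k^{n+1}-1}f(m)$ and $\mu_n=\frac1{\Sigma(n)}\sum_{m=0}^{k^{n+1}-k^n-1}f(k^n+m)\,\delta_{m/(k^n(k-1))}$ (probability measures on $\mathbb T=[0,1)$); the ghost measure of $f$ is the weak limit of $(\mu_n)$. -}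

module Defs where

open import Data.Nat.Base as ℕ using (ℕ; zero; suc; NonZero; NonTrivial; z≤n; s≤s)
import Data.Nat.Properties as ℕₚ
open import Data.Integer.Base as ℤ using (ℤ; +_)
open import Data.Rational.Base as ℚ using (ℚ; 0ℚ; 1ℚ; ½)
import Data.Rational.Properties as ℚₚ
open import Data.Rational.Solver using (module +-*-Solver)
open import Data.List.Base using (List; []; _∷_; applyUpTo; foldl; foldr)
open import Data.Nat.ListAction using (sum)
open import Data.Vec.Base as Vec using (Vec; []; _∷_)
open import Data.Product.Base using (Σ-syntax; ∃; ∃-syntax; _×_; _,_; proj₁; proj₂)
open import Data.Sum.Base using (inj₁; inj₂)
open import Relation.Nullary.Negation.Core using (¬_)
open import Relation.Binary.PropositionalEquality.Core
  using (_≡_; refl; sym; trans; cong; subst)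

open ℚₚ.≤-Reasoning
open +-*-Solver using (solve; _:=_; _:+_; _:*_; _:-_; :-_)

½ε+½ε≡ε : ∀ ε → ½ ℚ.* ε ℚ.+ ½ ℚ.* ε ≡ ε
½ε+½ε≡ε ε = trans (sym (ℚₚ.*-distribʳ-+ ε ½ ½)) (ℚₚ.*-identityˡ ε)

0<½ε : ∀ {ε} → 0ℚ ℚ.< ε → 0ℚ ℚ.< ½ ℚ.* ε
0<½ε {ε} 0<ε = subst (ℚ._< ½ ℚ.* ε) (ℚₚ.*-zeroʳ ½) (ℚₚ.*-monoʳ-<-pos ½ 0<ε)

∣p-q∣≡∣q-p∣ : ∀ p q → ℚ.∣ p ℚ.- q ∣ ≡ ℚ.∣ q ℚ.- p ∣
∣p-q∣≡∣q-p∣ p q = trans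
  (cong ℚ.∣_∣ (solve 2 (λ a b → a :- b := :- (b :- a)) refl p q))
  (ℚₚ.∣-p∣≡∣p∣ (q ℚ.- p))

∣p∣≤∣p-q∣+∣q∣ : ∀ p q → ℚ.∣ p ∣ ℚ.≤ ℚ.∣ p ℚ.- q ∣ ℚ.+ ℚ.∣ q ∣
∣p∣≤∣p-q∣+∣q∣ p q = begin
  ℚ.∣ p ∣                      ≡⟨ cong ℚ.∣_∣ (solve 2 (λ a b → a := (a :- b) :+ b) refl p q) ⟩
  ℚ.∣ (p ℚ.- q) ℚ.+ q ∣        ≤⟨ ℚₚ.∣p+q∣≤∣p∣+∣q∣ (p ℚ.- q) q ⟩
  ℚ.∣ p ℚ.- q ∣ ℚ.+ ℚ.∣ q ∣    ∎

∣p∣-∣q∣≤∣p-q∣ : ∀ p q → ℚ.∣ p ∣ ℚ.- ℚ.∣ q ∣ ℚ.≤ ℚ.∣ p ℚ.- q ∣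
∣p∣-∣q∣≤∣p-q∣ p q = begin
  ℚ.∣ p ∣ ℚ.- ℚ.∣ q ∣                        ≤⟨ ℚₚ.+-monoˡ-≤ (ℚ.- ℚ.∣ q ∣) (∣p∣≤∣p-q∣+∣q∣ p q) ⟩
  (ℚ.∣ p ℚ.- q ∣ ℚ.+ ℚ.∣ q ∣) ℚ.- ℚ.∣ q ∣    ≡⟨ solve 2 (λ a b → (a :+ b) :- b := a) refl ℚ.∣ p ℚ.- q ∣ ℚ.∣ q ∣ ⟩
  ℚ.∣ p ℚ.- q ∣                              ∎

∣∣p∣-∣q∣∣≤∣p-q∣ : ∀ p q → ℚ.∣ ℚ.∣ p ∣ ℚ.- ℚ.∣ q ∣ ∣ ℚ.≤ ℚ.∣ p ℚ.- q ∣
∣∣p∣-∣q∣∣≤∣p-q∣ p q with ℚₚ.∣p∣≡p∨∣p∣≡-p (ℚ.∣ p ∣ ℚ.- ℚ.∣ q ∣)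
... | inj₁ eq = begin
  ℚ.∣ ℚ.∣ p ∣ ℚ.- ℚ.∣ q ∣ ∣    ≡⟨ eq ⟩
  ℚ.∣ p ∣ ℚ.- ℚ.∣ q ∣          ≤⟨ ∣p∣-∣q∣≤∣p-q∣ p q ⟩
  ℚ.∣ p ℚ.- q ∣                ∎
... | inj₂ eq = begin
  ℚ.∣ ℚ.∣ p ∣ ℚ.- ℚ.∣ q ∣ ∣    ≡⟨ eq ⟩
  ℚ.- (ℚ.∣ p ∣ ℚ.- ℚ.∣ q ∣)    ≡⟨ solve 2 (λ a b → :- (a :- b) := b :- a) refl ℚ.∣ p ∣ ℚ.∣ q ∣ ⟩
  ℚ.∣ q ∣ ℚ.- ℚ.∣ p ∣          ≤⟨ ∣p∣-∣q∣≤∣p-q∣ q p ⟩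
  ℚ.∣ q ℚ.- p ∣                ≡⟨ ∣p-q∣≡∣q-p∣ q p ⟩
  ℚ.∣ p ℚ.- q ∣                ∎

+-‿interchange : ∀ a b c d → (a ℚ.+ b) ℚ.- (c ℚ.+ d) ≡ (a ℚ.- c) ℚ.+ (b ℚ.- d)
+-‿interchange = solve 4 (λ a b c d → (a :+ b) :- (c :+ d) := (a :- c) :+ (b :- d)) refl

neg-diff : ∀ a b → (ℚ.- a) ℚ.- (ℚ.- b) ≡ b ℚ.- a
neg-diff = solve 2 (λ a b → (:- a) :- (:- b) := b :- a) refl

*-diff : ∀ a b c d → a ℚ.* b ℚ.- c ℚ.* d ≡ a ℚ.* (b ℚ.- d) ℚ.+ d ℚ.* (a ℚ.- c)
*-diff = solve 4 (λ a b c d → a :* b :- c :* d := a :* (b :- d) :+ d :* (a :- c)) refl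

∣pq∣≤ : ∀ p q r δ → ℚ.Positive r → ℚ.∣ p ∣ ℚ.≤ r → ℚ.∣ q ∣ ℚ.≤ δ →
        ℚ.∣ p ℚ.* q ∣ ℚ.≤ r ℚ.* δ
∣pq∣≤ p q r δ r>0 p≤r q≤δ = begin
  ℚ.∣ p ℚ.* q ∣          ≡⟨ ℚₚ.∣p*q∣≡∣p∣*∣q∣ p q ⟩
  ℚ.∣ p ∣ ℚ.* ℚ.∣ q ∣    ≤⟨ ℚₚ.*-monoʳ-≤-nonNeg ℚ.∣ q ∣ {{ℚₚ.∣-∣-nonNeg q}} p≤r ⟩
  r ℚ.* ℚ.∣ q ∣          ≤⟨ ℚₚ.*-monoˡ-≤-nonNeg r {{ℚₚ.pos⇒nonNeg r {{r>0}}}} q≤δ ⟩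
  r ℚ.* δ                ∎

∣ab-cd∣≤ : ∀ a b c d B C δ → ℚ.Positive B → ℚ.Positive C →
  ℚ.∣ a ∣ ℚ.≤ B → ℚ.∣ b ℚ.- d ∣ ℚ.≤ δ → ℚ.∣ d ∣ ℚ.≤ C → ℚ.∣ a ℚ.- c ∣ ℚ.≤ δ →
  ℚ.∣ a ℚ.* b ℚ.- c ℚ.* d ∣ ℚ.≤ B ℚ.* δ ℚ.+ C ℚ.* δ
∣ab-cd∣≤ a b c d B C δ B>0 C>0 a≤B b-d≤δ d≤C a-c≤δ = begin
  ℚ.∣ a ℚ.* b ℚ.- c ℚ.* d ∣
    ≡⟨ cong ℚ.∣_∣ (*-diff a b c d) ⟩
  ℚ.∣ a ℚ.* (b ℚ.- d) ℚ.+ d ℚ.* (a ℚ.- c) ∣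
    ≤⟨ ℚₚ.∣p+q∣≤∣p∣+∣q∣ (a ℚ.* (b ℚ.- d)) (d ℚ.* (a ℚ.- c)) ⟩
  ℚ.∣ a ℚ.* (b ℚ.- d) ∣ ℚ.+ ℚ.∣ d ℚ.* (a ℚ.- c) ∣
    ≤⟨ ℚₚ.+-mono-≤ (∣pq∣≤ a (b ℚ.- d) B δ B>0 a≤B b-d≤δ) (∣pq∣≤ d (a ℚ.- c) C δ C>0 d≤C a-c≤δ) ⟩
  B ℚ.* δ ℚ.+ C ℚ.* δ ∎

split-tolerance : ∀ b c → ℚ.Positive b → ℚ.Positive c → ∀ ε → 0ℚ ℚ.< ε →
  ∃[ δ ] (0ℚ ℚ.< δ × b ℚ.* δ ℚ.+ c ℚ.* δ ≡ ε)
split-tolerance b c b>0 c>0 ε 0<ε = r ℚ.* ε , 0<rε , eq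
  where
  s>0 : ℚ.Positive (b ℚ.+ c)
  s>0 = ℚₚ.pos+pos⇒pos b {{b>0}} c {{c>0}}
  s≢0 : ℚ.NonZero (b ℚ.+ c)
  s≢0 = ℚₚ.pos⇒nonZero (b ℚ.+ c) {{s>0}}
  r : ℚ
  r = (ℚ.1/ (b ℚ.+ c)) {{s≢0}}
  r>0 : ℚ.Positive r
  r>0 = ℚₚ.1/pos⇒pos (b ℚ.+ c) {{s>0}}
  0<rε : 0ℚ ℚ.< r ℚ.* ε
  0<rε = subst (ℚ._< r ℚ.* ε) (ℚₚ.*-zeroʳ r) (ℚₚ.*-monoʳ-<-pos r {{r>0}} 0<ε)
  eq : b ℚ.* (r ℚ.* ε) ℚ.+ c ℚ.* (r ℚ.* ε) ≡ ε
  eq = begin-equality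
    b ℚ.* (r ℚ.* ε) ℚ.+ c ℚ.* (r ℚ.* ε)    ≡⟨ ℚₚ.*-distribʳ-+ (r ℚ.* ε) b c ⟨
    (b ℚ.+ c) ℚ.* (r ℚ.* ε)                ≡⟨ ℚₚ.*-assoc (b ℚ.+ c) r ε ⟨
    ((b ℚ.+ c) ℚ.* r) ℚ.* ε                ≡⟨ cong (ℚ._* ε) (ℚₚ.*-inverseʳ (b ℚ.+ c) {{s≢0}}) ⟩
    1ℚ ℚ.* ε                               ≡⟨ ℚₚ.*-identityˡ ε ⟩
    ε                                      ∎

-- Real numbers are Cauchy sequences of rationals, with _≃_ as equality.

IsCauchy : (ℕ → ℚ) → Set
IsCauchy x = ∀ ε → 0ℚ ℚ.< ε →
  ∃[ N ] (∀ m n → N ℕ.≤ m → N ℕ.≤ n → ℚ.∣ x m ℚ.- x n ∣ ℚ.≤ ε)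

record ℝ : Set where
  constructor mkℝ
  field
    approx : ℕ → ℚ
    cauchy : IsCauchy approx

open ℝ public

infix  4 _≃_ _≤_ _<_
infix  8 -_
infixl 7 _*_
infixl 6 _+_ _-_

_≃_ _≤_ _<_ : ℝ → ℝ → Set
x ≃ y = ∀ ε → 0ℚ ℚ.< ε →
  ∃[ N ] (∀ n → N ℕ.≤ n → ℚ.∣ approx x n ℚ.- approx y n ∣ ℚ.≤ ε)
x ≤ y = ∀ ε → 0ℚ ℚ.< ε →
  ∃[ N ] (∀ n → N ℕ.≤ n → approx x n ℚ.≤ approx y n ℚ.+ ε)
x < y = ∃[ ε ] (0ℚ ℚ.< ε ×
  ∃[ N ] (∀ n → N ℕ.≤ n → approx x n ℚ.+ ε ℚ.≤ approx y n))

EventuallyBounded : (ℕ → ℚ) → Set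
EventuallyBounded u =
  ∃[ B ] (ℚ.Positive B × ∃[ N ] (∀ n → N ℕ.≤ n → ℚ.∣ u n ∣ ℚ.≤ B))

-- Abstract, so that normalising an expression of type ℝ does not unfold
-- the moduli of convergence.

abstract

  cauchy-const : ∀ q → IsCauchy (λ _ → q)
  cauchy-const q ε 0<ε = 0 , λ _ _ _ _ → begin
    ℚ.∣ q ℚ.- q ∣    ≡⟨ cong ℚ.∣_∣ (ℚₚ.+-inverseʳ q) ⟩
    0ℚ               ≤⟨ ℚₚ.<⇒≤ 0<ε ⟩
    ε                ∎

  cauchy-+ : ∀ u v → IsCauchy u → IsCauchy v → IsCauchy (λ n → u n ℚ.+ v n)
  cauchy-+ u v cu cv ε 0<ε =
    let (M , hM) = cu (½ ℚ.* ε) (0<½ε 0<ε)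
        (N , hN) = cv (½ ℚ.* ε) (0<½ε 0<ε)
    in M ℕ.⊔ N , λ m n ≤m ≤n → begin
      ℚ.∣ (u m ℚ.+ v m) ℚ.- (u n ℚ.+ v n) ∣
        ≡⟨ cong ℚ.∣_∣ (+-‿interchange (u m) (v m) (u n) (v n)) ⟩
      ℚ.∣ (u m ℚ.- u n) ℚ.+ (v m ℚ.- v n) ∣
        ≤⟨ ℚₚ.∣p+q∣≤∣p∣+∣q∣ (u m ℚ.- u n) (v m ℚ.- v n) ⟩
      ℚ.∣ u m ℚ.- u n ∣ ℚ.+ ℚ.∣ v m ℚ.- v n ∣
        ≤⟨ ℚₚ.+-mono-≤
             (hM m n (ℕₚ.m⊔n≤o⇒m≤o M N ≤m) (ℕₚ.m⊔n≤o⇒m≤o M N ≤n))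
             (hN m n (ℕₚ.m⊔n≤o⇒n≤o M N ≤m) (ℕₚ.m⊔n≤o⇒n≤o M N ≤n)) ⟩
      ½ ℚ.* ε ℚ.+ ½ ℚ.* ε
        ≡⟨ ½ε+½ε≡ε ε ⟩
      ε ∎

  cauchy-neg : ∀ u → IsCauchy u → IsCauchy (λ n → ℚ.- u n)
  cauchy-neg u cu ε 0<ε =
    let (N , hN) = cu ε 0<ε
    in N , λ m n ≤m ≤n → begin
      ℚ.∣ ℚ.- u m ℚ.- ℚ.- u n ∣    ≡⟨ cong ℚ.∣_∣ (neg-diff (u m) (u n)) ⟩
      ℚ.∣ u n ℚ.- u m ∣            ≤⟨ hN n m ≤n ≤m ⟩
      ε                            ∎

  cauchy-abs : ∀ u → IsCauchy u → IsCauchy (λ n → ℚ.∣ u n ∣)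
  cauchy-abs u cu ε 0<ε =
    let (N , hN) = cu ε 0<ε
    in N , λ m n ≤m ≤n → ℚₚ.≤-trans (∣∣p∣-∣q∣∣≤∣p-q∣ (u m) (u n)) (hN m n ≤m ≤n)

  cauchy⇒bounded : ∀ u → IsCauchy u → EventuallyBounded u
  cauchy⇒bounded u cu =
    let (N , hN) = cu 1ℚ (ℚₚ.positive⁻¹ 1ℚ)
        b        = ℚ.∣ u N ∣
    in 1ℚ ℚ.+ b , ℚₚ.pos+nonNeg⇒pos 1ℚ b {{ℚₚ.∣-∣-nonNeg (u N)}} , N , λ n N≤n → begin
      ℚ.∣ u n ∣                  ≤⟨ ∣p∣≤∣p-q∣+∣q∣ (u n) (u N) ⟩
      ℚ.∣ u n ℚ.- u N ∣ ℚ.+ b    ≤⟨ ℚₚ.+-monoˡ-≤ b (hN n N N≤n ℕₚ.≤-refl) ⟩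
      1ℚ ℚ.+ b                   ∎

  module _ (a b c d : ℕ) {o : ℕ} (h : (a ℕ.⊔ b) ℕ.⊔ (c ℕ.⊔ d) ℕ.≤ o) where
    ⊔₄-bounds : a ℕ.≤ o × b ℕ.≤ o × c ℕ.≤ o × d ℕ.≤ o
    ⊔₄-bounds =
      let a⊔b≤o = ℕₚ.m⊔n≤o⇒m≤o (a ℕ.⊔ b) (c ℕ.⊔ d) h
          c⊔d≤o = ℕₚ.m⊔n≤o⇒n≤o (a ℕ.⊔ b) (c ℕ.⊔ d) h
      in ℕₚ.m⊔n≤o⇒m≤o a b a⊔b≤o , ℕₚ.m⊔n≤o⇒n≤o a b a⊔b≤o
       , ℕₚ.m⊔n≤o⇒m≤o c d c⊔d≤o , ℕₚ.m⊔n≤o⇒n≤o c d c⊔d≤o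

  bounded-cauchy-* : ∀ u v → EventuallyBounded u → EventuallyBounded v →
                     IsCauchy u → IsCauchy v → IsCauchy (λ n → u n ℚ.* v n)
  bounded-cauchy-* u v (B , B>0 , K , hK) (C , C>0 , L , hL) cu cv ε 0<ε =
    step (split-tolerance B C B>0 C>0 ε 0<ε)
    where
    Goal : Set
    Goal = ∃[ N ] (∀ m n → N ℕ.≤ m → N ℕ.≤ n → ℚ.∣ u m ℚ.* v m ℚ.- u n ℚ.* v n ∣ ℚ.≤ ε)

    Close : (ℕ → ℚ) → ℚ → Set
    Close w δ = ∃[ N ] (∀ m n → N ℕ.≤ m → N ℕ.≤ n → ℚ.∣ w m ℚ.- w n ∣ ℚ.≤ δ)

    combine : ∀ δ → B ℚ.* δ ℚ.+ C ℚ.* δ ≡ ε → Close u δ → Close v δ → Goal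
    combine δ ≡ε (M , hM) (M′ , hM′) = (K ℕ.⊔ L) ℕ.⊔ (M ℕ.⊔ M′) , λ m n ≤m ≤n →
      let (K≤m , _ , M≤m , M′≤m) = ⊔₄-bounds K L M M′ ≤m
          (_ , L≤n , M≤n , M′≤n) = ⊔₄-bounds K L M M′ ≤n
      in ℚₚ.≤-trans
           (∣ab-cd∣≤ (u m) (v m) (u n) (v n) B C δ B>0 C>0
             (hK m K≤m) (hM′ m n M′≤m M′≤n) (hL n L≤n) (hM m n M≤m M≤n))
           (ℚₚ.≤-reflexive ≡ε)

    step : ∃[ δ ] (0ℚ ℚ.< δ × B ℚ.* δ ℚ.+ C ℚ.* δ ≡ ε) → Goal
    step (δ , 0<δ , ≡ε) = combine δ ≡ε (cu δ 0<δ) (cv δ 0<δ)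

  cauchy-* : ∀ u v → IsCauchy u → IsCauchy v → IsCauchy (λ n → u n ℚ.* v n)
  cauchy-* u v cu cv =
    bounded-cauchy-* u v (cauchy⇒bounded u cu) (cauchy⇒bounded v cv) cu cv

fromℚ : ℚ → ℝ
fromℚ q = mkℝ (λ _ → q) (cauchy-const q)

fromℤ : ℤ → ℝ
fromℤ i = fromℚ (i ℚ./ 1)

fromℕ : ℕ → ℝ
fromℕ n = fromℤ (+ n)

0ℝ 1ℝ : ℝ
0ℝ = fromℚ 0ℚ
1ℝ = fromℚ 1ℚ

_+_ : ℝ → ℝ → ℝ
x + y = mkℝ (λ n → approx x n ℚ.+ approx y n)
            (cauchy-+ (approx x) (approx y) (cauchy x) (cauchy y))

-_ : ℝ → ℝ
- x = mkℝ (λ n → ℚ.- approx x n) (cauchy-neg (approx x) (cauchy x))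

_-_ : ℝ → ℝ → ℝ
x - y = x + (- y)

_*_ : ℝ → ℝ → ℝ
x * y = mkℝ (λ n → approx x n ℚ.* approx y n)
            (cauchy-* (approx x) (approx y) (cauchy x) (cauchy y))

∣_∣ : ℝ → ℝ
∣ x ∣ = mkℝ (λ n → ℚ.∣ approx x n ∣) (cauchy-abs (approx x) (cauchy x))

∑[_]_ : ℕ → (ℕ → ℝ) → ℝ
∑[ n ] a = foldr _+_ 0ℝ (applyUpTo a n)

InUnit : ℝ → Set
InUnit x = 0ℝ ≤ x × x < 1ℝ

-- The circle 𝕋 = [0,1) is treated as ℝ/ℤ: a point of 𝕋 is given by any real
-- representing it.  A predicate A : ℝ → Set stands for the set of points
-- having a representative in A.

infix 4 _≈𝕋_ _∈_

_≈𝕋_ : ℝ → ℝ → Set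
x ≈𝕋 y = ∃[ j ] x ≃ y + fromℤ j

-- The image in 𝕋 of the open interval (lower , upper).

record Arc : Set where
  field
    lower upper : ℝ
    lower≤upper : lower ≤ upper

open Arc public

_∈_ : ℝ → Arc → Set
x ∈ I = ∃[ j ] (lower I < x + fromℤ j × x + fromℤ j < upper I)

-- Continuous functions on 𝕋.  Since 𝕋 is compact, continuity is uniform;
-- the uniform modulus is the usual constructive form of the notion, and it
-- makes every member of C⟨𝕋⟩ respect _≃_.

record C⟨𝕋⟩ : Set where
  field
    apply    : ℝ → ℝ
    periodic : ∀ x → apply (x + 1ℝ) ≃ apply x
    uniformlyContinuous :
      ∀ ε → 0ℚ ℚ.< ε → ∃[ δ ] (0ℚ ℚ.< δ ×
        (∀ x y → ∣ x - y ∣ ≤ fromℚ δ → ∣ apply x - apply y ∣ ≤ fromℚ ε))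

open C⟨𝕋⟩ public

-- As in the Riesz representation theorem, a Borel probability measure on
-- the compact space 𝕋 is a normalised positive linear functional on C⟨𝕋⟩.
-- Linearity is stated for any h equal to f + g (or c · f) pointwise, so that
-- it also says that ∫ depends only on the values of its argument.

record ProbabilityMeasure : Set where
  field
    ∫ : C⟨𝕋⟩ → ℝ
    additive    : ∀ f g h → (∀ x → apply h x ≃ apply f x + apply g x) → ∫ h ≃ ∫ f + ∫ g
    homogeneous : ∀ c f h → (∀ x → apply h x ≃ c * apply f x) → ∫ h ≃ c * ∫ f
    positive    : ∀ f → (∀ x → 0ℝ ≤ apply f x) → 0ℝ ≤ ∫ f
    normalised  : ∀ f → (∀ x → apply f x ≃ 1ℝ) → ∫ f ≃ 1ℝ

open ProbabilityMeasure public

-- μ(I) ≤ c, where μ(I) = sup { ∫ g dμ : g ∈ C⟨𝕋⟩, 0 ≤ g ≤ 1_I }.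

ArcMeasure≤ : ProbabilityMeasure → Arc → ℝ → Set
ArcMeasure≤ μ I c = ∀ g →
  (∀ x → 0ℝ ≤ apply g x) → (∀ x → apply g x ≤ 1ℝ) →
  (∀ x → ¬ (x ∈ I) → apply g x ≤ 0ℝ) →
  ∫ μ g ≤ c

Length≤ : Arc → ℝ → Set
Length≤ I c = upper I - lower I ≤ c

-- Sets of outer measure zero: for every ε > 0 there is a countable cover by
-- arcs I i, of measure at most w i, with the w i summing to at most ε.
-- Covering is double-negated: this is classically the same as covering, and
-- it does not ask for the index i to be computed from x.

Null : (Arc → ℝ → Set) → (ℝ → Set) → Set
Null Measure≤ A = ∀ ε → 0ℚ ℚ.< ε →
  Σ[ I ∈ (ℕ → Arc) ] Σ[ w ∈ (ℕ → ℝ) ]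
    (∀ i → Measure≤ (I i) (w i)) ×
    (∀ n → ∑[ n ] w ≤ fromℚ ε) ×
    (∀ x → A x → ¬ ¬ (∃[ i ] x ∈ I i))

NullFor : ProbabilityMeasure → (ℝ → Set) → Set
NullFor μ = Null (ArcMeasure≤ μ)

LebesgueNull : (ℝ → Set) → Set
LebesgueNull = Null Length≤

NoAtoms : ProbabilityMeasure → Set
NoAtoms μ = ∀ x → NullFor μ (_≈𝕋 x)

-- Being contained in a Borel null set, a null A may be taken Borel.

SingularToLebesgue : ProbabilityMeasure → Set₁
SingularToLebesgue μ =
  Σ[ A ∈ (ℝ → Set) ] (LebesgueNull A × NullFor μ (λ x → ¬ A x))

SingularContinuous : ProbabilityMeasure → Set₁
SingularContinuous μ = NoAtoms μ × SingularToLebesgue μ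

-- 1_[0,x] ≤ g

Majorises : C⟨𝕋⟩ → ℝ → Set
Majorises g x =
  (∀ y → 0ℝ ≤ apply g y) × (∀ y → 0ℝ ≤ y → y ≤ x → 1ℝ ≤ apply g y)

-- F x = μ([0,x]) = inf { ∫ g dμ : 1_[0,x] ≤ g } for 0 ≤ x < 1; the values of
-- F outside [0,1) are irrelevant.

IsDistributionFunction : ProbabilityMeasure → (ℝ → ℝ) → Set
IsDistributionFunction μ F = ∀ x → InUnit x →
  (∀ g → Majorises g x → F x ≤ ∫ μ g) ×
  (∀ c → (∀ g → Majorises g x → c ≤ ∫ μ g) → c ≤ F x)

ContinuousOnUnit : (ℝ → ℝ) → Set
ContinuousOnUnit F = ∀ x → InUnit x →
  ∀ ε → 0ℚ ℚ.< ε → ∃[ δ ] (0ℚ ℚ.< δ ×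
    (∀ y → InUnit y → ∣ y - x ∣ ≤ fromℚ δ → ∣ F y - F x ∣ ≤ fromℚ ε))

HasDerivative : (ℝ → ℝ) → ℝ → ℝ → Set
HasDerivative F x d =
  ∀ ε → 0ℚ ℚ.< ε → ∃[ δ ] (0ℚ ℚ.< δ ×
    (∀ y → InUnit y → ∣ y - x ∣ ≤ fromℚ δ →
      ∣ (F y - F x) - d * (y - x) ∣ ≤ fromℚ ε * ∣ y - x ∣))

AlmostEverywhere : (ℝ → Set) → Set
AlmostEverywhere P = LebesgueNull (λ x → InUnit x × ¬ P x)

blockLength : ℕ → ℕ → ℕ
blockLength k n = k ℕ.^ suc n ℕ.∸ k ℕ.^ n

blockSum : ℕ → (ℕ → ℕ) → ℕ → ℕ
blockSum k f n = sum (applyUpTo (λ m → f (k ℕ.^ n ℕ.+ m)) (blockLength k n))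

gridSize : ℕ → ℕ → ℕ
gridSize k n = k ℕ.^ n ℕ.* (k ℕ.∸ 1)

gridSize≢0 : ∀ k .{{_ : NonTrivial k}} n → NonZero (gridSize k n)
gridSize≢0 k@(suc (suc j)) n =
  ℕₚ.m*n≢0 (k ℕ.^ n) (suc j) {{ℕₚ.m^n≢0 k n}}

gridPoint : ∀ k .{{_ : NonTrivial k}} → ℕ → ℕ → ℚ
gridPoint k n m = ((+ m) ℚ./ gridSize k n) {{gridSize≢0 k n}}

-- ∫ g dμₙ

empirical∫ : ∀ k .{{_ : NonTrivial k}} (f : ℕ → ℕ) n .{{_ : NonZero (blockSum k f n)}} →
             C⟨𝕋⟩ → ℝ
empirical∫ k f n g =
  fromℚ ((+ 1) ℚ./ blockSum k f n) *
  ∑[ blockLength k n ]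
    (λ m → fromℕ (f (k ℕ.^ n ℕ.+ m)) * apply g (fromℚ (gridPoint k n m)))

IsWeakLimit : (ℕ → C⟨𝕋⟩ → ℝ) → ProbabilityMeasure → Set
IsWeakLimit ν μ = ∀ g ε → 0ℚ ℚ.< ε →
  ∃[ N ] (∀ n → N ℕ.≤ n → ∣ ν n g - ∫ μ g ∣ ≤ fromℚ ε)

IsGhostMeasure : ∀ k .{{_ : NonTrivial k}} (f : ℕ → ℕ) →
                 (∀ n → NonZero (blockSum k f n)) → ProbabilityMeasure → Set
IsGhostMeasure k f Σ≢0 = IsWeakLimit (λ n → empirical∫ k f n {{Σ≢0 n}})

-- The base-k expansion, least significant digit first and without leading
-- zeros (a leading zero would contribute a factor B 0).  The first argument
-- bounds the number of digits; m digits are enough for m.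

digitsUpTo : ℕ → ∀ k .{{_ : NonZero k}} → ℕ → List ℕ
digitsUpTo zero    k m         = []
digitsUpTo (suc l) k zero      = []
digitsUpTo (suc l) k m@(suc _) = m ℕ.% k ∷ digitsUpTo l k (m ℕ./ k)

digits : ∀ k .{{_ : NonTrivial k}} → ℕ → List ℕ
digits k m = digitsUpTo m k {{ℕ.nonTrivial⇒nonZero k}} m

infixr 7 _·_ _·ᵥ_

_·_ : ∀ {n} → Vec ℕ n → Vec ℕ n → ℕ
u · v = Vec.sum (Vec.zipWith ℕ._*_ u v)

_·ᵥ_ : ∀ {m n} → Vec (Vec ℕ n) m → Vec ℕ n → Vec ℕ m
M ·ᵥ v = Vec.map (_· v) M

B : ℕ → Vec (Vec ℕ 2) 2
B i = (i ℕ.+ 1 ∷ 1 ∷ [])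
    ∷ (1       ∷ 0 ∷ [])
    ∷ []

e₁ : Vec ℕ 2
e₁ = 1 ∷ 0 ∷ []

zaremba : ∀ k .{{_ : NonTrivial k}} → ℕ → ℕ
zaremba k m = e₁ · foldl (λ v i → B i ·ᵥ v) e₁ (digits k m)

0<zaremba : ∀ k .{{_ : NonTrivial k}} m → 0 ℕ.< zaremba k m
0<zaremba k m = positive-foldl (digits k m) 1 0 (s≤s z≤n)
  where
  positive-foldl : ∀ ds a b → 0 ℕ.< a →
    0 ℕ.< e₁ · foldl (λ v i → B i ·ᵥ v) (a ∷ b ∷ []) ds
  positive-foldl []       (suc a) b 0<a = s≤s z≤n
  positive-foldl (i ∷ ds) a@(suc _) b 0<a =
    positive-foldl ds ((i ℕ.+ 1) ℕ.* a ℕ.+ (1 ℕ.* b ℕ.+ 0)) (1 ℕ.* a ℕ.+ (0 ℕ.* b ℕ.+ 0))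
      (subst (λ j → 0 ℕ.< j ℕ.* a ℕ.+ (1 ℕ.* b ℕ.+ 0)) (ℕₚ.+-comm 1 i) (s≤s z≤n))

zaremba-blockSum≢0 : ∀ k .{{_ : NonTrivial k}} n → NonZero (blockSum k (zaremba k) n)
zaremba-blockSum≢0 k n = ℕ.>-nonZero
  (positive-sum (blockLength k n) (λ m → zaremba k (k ℕ.^ n ℕ.+ m))
    (ℕₚ.m<n⇒0<n∸m (ℕₚ.^-monoʳ-< k (ℕ.nonTrivial⇒n>1 k) (ℕₚ.n<1+n n)))
    (0<zaremba k (k ℕ.^ n ℕ.+ 0)))
  where
  positive-sum : ∀ l (a : ℕ → ℕ) → 0 ℕ.< l → 0 ℕ.< a 0 → 0 ℕ.< sum (applyUpTo a l)
  positive-sum (suc l) a _ 0<a₀ = ℕₚ.<-≤-trans 0<a₀ (ℕₚ.m≤m+n (a 0) _)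

{-# OPTIONS --safe #-}
module Submission where

-- Since z(ck+i) = (i+1) z(c) + z(⌊c/k⌋), the sum of z over the kᵐ integers with
-- leading part c is aₘ z(c) + bₘ z(⌊c/k⌋), where (aₘ , bₘ) is the first column of
-- the m-th power of B 0 + ⋯ + B (k-1).  So the mass which μₙ₊ₘ gives to a cell of
-- level n depends on m only through bₘ/aₘ, which converges geometrically by a
-- determinant computation, and it is at most (2/3)ⁿ.  Hence the weak limit exists
-- and has no atoms.
--
-- The i-th child of a cell has (1+xᵢ)/k times the mass of the cell, where Σ xᵢ = 0
-- and ∣x₀∣ ≥ 1/7.  With φ(x) = 1 + x/2 - x²/16 ≥ √(1+x), the square root of the
-- relative density of a cell is therefore at most a product of factors φ(xᵢ), and
-- the average of φ(xᵢ) over the children is at most 1 - 1/(784k).  By Markov's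
-- inequality there is d < 1 such that all but a fraction dⁿ of the cells of level n
-- are good, a good cell having mass at most 2d²ⁿ/kⁿ.  Both error terms are summable:
-- the points near bad cells of infinitely many levels form a Lebesgue null set which
-- carries the measure, and at a point away from the bad cells of all levels n ≥ J the
-- difference quotients of the distribution function tend to 0 at an explicit rate,
-- which makes the derivative exist constructively.

open import Defs
  hiding (positive; lower; upper; ½ε+½ε≡ε; 0<½ε; ∣p-q∣≡∣q-p∣; ∣p∣≤∣p-q∣+∣q∣; ∣p∣-∣q∣≤∣p-q∣; ∣∣p∣-∣q∣∣≤∣p-q∣; +-‿interchange; neg-diff; *-diff)
  renaming (_+_ to _+ᵣ_; _*_ to _*ᵣ_; -_ to -ᵣ_; _-_ to _-ᵣ_; ∣_∣ to ∣_∣ᵣ; _≤_ to _≤ᵣ_; _<_ to _<ᵣ_; _≃_ to _≃ᵣ_)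
open import Data.Nat.Base as ℕ using (ℕ; zero; suc; z≤n; s≤s; NonZero; NonTrivial)
import Data.Nat.Properties as ℕₚ
import Data.Nat.DivMod as ℕ
import Data.Nat.Coprimality as C
open import Data.Nat.Divisibility using (n∣m*n)
open import Data.Nat.ListAction using (sum)
import Data.Nat.Tactic.RingSolver as ℕ-Solver
open import Data.Integer.Base as ℤ using (ℤ)
import Data.Integer.Properties as ℤₚ
import Data.Integer.DivMod as ℤ
import Data.Integer.Tactic.RingSolver as ℤ-Solver
open import Data.Rational.Base hiding (_≃_; floor; ceiling; truncate; round; fracPart; NonZero)
open import Data.Rational.Properties
import Data.Rational.Unnormalised.Base as ℚᵘ
import Data.Rational.Unnormalised.Properties as ℚᵘₚ
open import Data.List.Base using (List; []; _∷_; applyUpTo; foldl)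
import Data.Vec.Base as Vec
open import Data.Product.Base using (∃-syntax; Σ-syntax; _×_; _,_; proj₁; proj₂)
open import Data.Sum.Base using (_⊎_; inj₁; inj₂)
open import Data.Empty using (⊥-elim)
open import Level using (0ℓ)
open import Relation.Nullary.Decidable.Core using (Dec; dec⇒maybe; yes; no)
open import Relation.Nullary.Negation.Core using (¬_)
open import Relation.Binary.PropositionalEquality.Core
open import Tactic.RingSolver using (solve; solve-∀)
open import Tactic.RingSolver.Core.AlmostCommutativeRing using (AlmostCommutativeRing; fromCommutativeRing)

-- The relative density of a cell is the average of the densities of its children, so first moments
-- carry no information; a concave function of the density detects that it fluctuates at every
-- level. A quadratic polynomial replaces the square root in order to stay inside ℚ, and 1/784 is
-- x²/16 at x = 1/7. No limiting mass of a cell is ever formed. `mass n m c` is the mass seen from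
-- level n + m, and the estimates are uniform in m, so they reach the ghost measure through the
-- empirical integrals. A real number cannot be assigned to a single cell, because its comparison
-- with an end point cannot be decided. Therefore `locate` places it well inside a window of three
-- consecutive cells, and continuity, atoms, good points and the distribution function are all
-- treated by such windows, at the price of constant factors. For the same reason the level matching
-- the distance of two points is found only approximately, by a descent through finitely many
-- levels.

ring : AlmostCommutativeRing 0ℓ 0ℓ
ring = fromCommutativeRing +-*-commutativeRing (λ x → dec⇒maybe (0ℚ ≟ x))

infixl 6 _⊞_
infixl 7 _⊠_

-- Ordered-field arithmetic in ℚ

p-q+q≡p : ∀ p q → p - q + q ≡ p
p-q+q≡p = solve-∀ ring

p+q-p≡q : ∀ p q → p + q - p ≡ q
p+q-p≡q = solve-∀ ring

p+q-q≡p : ∀ p q → p + q - q ≡ p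
p+q-q≡p = solve-∀ ring

-- Most inequalities below are proved in this form: the difference is rewritten as a visibly
-- nonnegative expression r, and the ring solver checks the identity.
by-diff : ∀ {p q r} → 0ℚ ≤ r → q - p ≡ r → p ≤ q
by-diff {p} {q} h e =
  subst₂ _≤_ (+-identityˡ p) (trans (cong (_+ p) (sym e)) (p-q+q≡p q p)) (+-monoˡ-≤ p h)

by-diff-< : ∀ {p q r} → 0ℚ < r → q - p ≡ r → p < q
by-diff-< {p} {q} h e =
  subst₂ _<_ (+-identityˡ p) (trans (cong (_+ p) (sym e)) (p-q+q≡p q p)) (+-monoˡ-< p h)

diff : ∀ {p q} → p ≤ q → 0ℚ ≤ q - p
diff {p} {q} h = subst (_≤ q - p) (+-inverseʳ p) (+-monoˡ-≤ (- p) h)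

diff-< : ∀ {p q} → p < q → 0ℚ < q - p
diff-< {p} {q} h = subst (_< q - p) (+-inverseʳ p) (+-monoˡ-< (- p) h)

_⊞_ : ∀ {p q} → 0ℚ ≤ p → 0ℚ ≤ q → 0ℚ ≤ p + q
_⊞_ = +-mono-≤

*-mono-≤ˡ : ∀ {r p q} → 0ℚ ≤ r → p ≤ q → r * p ≤ r * q
*-mono-≤ˡ {r} h = *-monoˡ-≤-nonNeg r {{nonNegative h}}

*-mono-≤ʳ : ∀ {r p q} → 0ℚ ≤ r → p ≤ q → p * r ≤ q * r
*-mono-≤ʳ {r} h = *-monoʳ-≤-nonNeg r {{nonNegative h}}

_⊠_ : ∀ {p q} → 0ℚ ≤ p → 0ℚ ≤ q → 0ℚ ≤ p * q
_⊠_ {p} {q} h k = subst (_≤ p * q) (*-zeroʳ p) (*-mono-≤ˡ h k)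

0<* : ∀ {p q} → 0ℚ < p → 0ℚ < q → 0ℚ < p * q
0<* {p} {q} h k = subst (_< p * q) (*-zeroʳ p) (*-monoʳ-<-pos p {{positive h}} k)

*-mono-≤ : ∀ {p q r s} → 0ℚ ≤ p → 0ℚ ≤ s → p ≤ q → r ≤ s → p * r ≤ q * s
*-mono-≤ 0≤p 0≤s p≤q r≤s = ≤-trans (*-mono-≤ˡ 0≤p r≤s) (*-mono-≤ʳ 0≤s p≤q)

*-cancel-≤ : ∀ {r p q} → 0ℚ < r → r * p ≤ r * q → p ≤ q
*-cancel-≤ {r} h = *-cancelˡ-≤-pos r {{positive h}}

0≤1 : 0ℚ ≤ 1ℚ
0≤1 = nonNegative⁻¹ 1ℚ

0<1 : 0ℚ < 1ℚ
0<1 = positive⁻¹ 1ℚ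

0<½ : 0ℚ < ½
0<½ = positive⁻¹ ½

0≤p² : ∀ p → 0ℚ ≤ p * p
0≤p² p with ≤-total 0ℚ p
... | inj₁ h = h ⊠ h
... | inj₂ h = subst (0ℚ ≤_) (eq p) (diff h ⊠ diff h)
  where
  eq : ∀ p → (0ℚ - p) * (0ℚ - p) ≡ p * p
  eq = solve-∀ ring

p≤∣p∣ : ∀ p → p ≤ ∣ p ∣
p≤∣p∣ p with ≤-total 0ℚ p
... | inj₁ h = ≤-reflexive (sym (0≤p⇒∣p∣≡p h))
... | inj₂ h = ≤-trans h (0≤∣p∣ p)

-p≤∣p∣ : ∀ p → - p ≤ ∣ p ∣
-p≤∣p∣ p = subst (- p ≤_) (∣-p∣≡∣p∣ p) (p≤∣p∣ (- p))

∣p∣≤ : ∀ {p q} → p ≤ q → - p ≤ q → ∣ p ∣ ≤ q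
∣p∣≤ {p} {q} h k with ∣p∣≡p∨∣p∣≡-p p
... | inj₁ e = subst (_≤ q) (sym e) h
... | inj₂ e = subst (_≤ q) (sym e) k

∣p-q∣-comm : ∀ p q → ∣ p - q ∣ ≡ ∣ q - p ∣
∣p-q∣-comm p q = trans (sym (∣-p∣≡∣p∣ (p - q))) (cong ∣_∣ (eq p q))
  where
  eq : ∀ p q → - (p - q) ≡ q - p
  eq = solve-∀ ring

∣-∣≤⇒≤ : ∀ {p q r} → ∣ p - q ∣ ≤ r → p ≤ q + r
∣-∣≤⇒≤ {p} {q} {r} h = by-diff (diff (≤-trans (p≤∣p∣ (p - q)) h)) (solve (p ∷ q ∷ r ∷ []) ring)

∣-∣≤⇒≥ : ∀ {p q r} → ∣ p - q ∣ ≤ r → q ≤ p + r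
∣-∣≤⇒≥ {p} {q} {r} h = ∣-∣≤⇒≤ (subst (_≤ r) (∣p-q∣-comm p q) h)

≤⇒∣-∣≤ : ∀ {p q r} → p ≤ q + r → q ≤ p + r → ∣ p - q ∣ ≤ r
≤⇒∣-∣≤ {p} {q} {r} h k = ∣p∣≤
  (by-diff (diff h) (solve (p ∷ q ∷ r ∷ []) ring))
  (by-diff (diff k) (solve (p ∷ q ∷ r ∷ []) ring))

∣-∣-triangle : ∀ p q r {s t} → ∣ p - q ∣ ≤ s → ∣ q - r ∣ ≤ t → ∣ p - r ∣ ≤ s + t
∣-∣-triangle p q r {s} {t} h k = ≤-trans (≤-reflexive (cong ∣_∣ (eq p q r)))
  (≤-trans (∣p+q∣≤∣p∣+∣q∣ (p - q) (q - r)) (+-mono-≤ h k))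
  where
  eq : ∀ p q r → p - r ≡ (p - q) + (q - r)
  eq = solve-∀ ring

-- The embeddings of ℤ and ℕ in ℚ

opaque
  ζ : ℤ → ℚ
  ζ i = i / 1

  ζ≡/1 : ∀ i → ζ i ≡ i / 1
  ζ≡/1 i = refl

  -- An explicit fraction with denominator 1, on which sums, products and order in ℚ compute to
  -- those of ℤ.
  ζ≡ : ∀ i → ζ i ≡ mkℚ i 0 (C.sym (C.1-coprimeTo ℤ.∣ i ∣))
  ζ≡ i = ↥p/↧p≡p (mkℚ i 0 (C.sym (C.1-coprimeTo ℤ.∣ i ∣)))

  ζ-+ : ∀ i j → ζ (i ℤ.+ j) ≡ ζ i + ζ j
  ζ-+ i j rewrite ζ≡ i | ζ≡ j =
    cong ζ (sym (cong₂ ℤ._+_ (ℤₚ.*-identityʳ i) (ℤₚ.*-identityʳ j)))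

  ζ-* : ∀ i j → ζ (i ℤ.* j) ≡ ζ i * ζ j
  ζ-* i j rewrite ζ≡ i | ζ≡ j = refl

  ζ-mono-≤ : ∀ {i j} → i ℤ.≤ j → ζ i ≤ ζ j
  ζ-mono-≤ {i} {j} h rewrite ζ≡ i | ζ≡ j =
    *≤* (subst₂ ℤ._≤_ (sym (ℤₚ.*-identityʳ i)) (sym (ℤₚ.*-identityʳ j)) h)

  ζ-cancel-< : ∀ {i j} → ζ i < ζ j → i ℤ.< j
  ζ-cancel-< {i} {j} h rewrite ζ≡ i | ζ≡ j =
    subst₂ ℤ._<_ (ℤₚ.*-identityʳ i) (ℤₚ.*-identityʳ j) (drop-*<* h)

ι : ℕ → ℚ
ι n = ζ (ℤ.+ n)

ι0 : ι 0 ≡ 0ℚ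
ι0 = ζ≡/1 (ℤ.+ 0)

ι1 : ι 1 ≡ 1ℚ
ι1 = ζ≡/1 (ℤ.+ 1)

ι-+ : ∀ m n → ι (m ℕ.+ n) ≡ ι m + ι n
ι-+ m n = ζ-+ (ℤ.+ m) (ℤ.+ n)

ι-suc : ∀ n → ι (suc n) ≡ 1ℚ + ι n
ι-suc n = trans (ι-+ 1 n) (cong (_+ ι n) ι1)

ι-* : ∀ m n → ι (m ℕ.* n) ≡ ι m * ι n
ι-* m n = trans (cong ζ (ℤₚ.pos-* m n)) (ζ-* (ℤ.+ m) (ℤ.+ n))

ι-mono : ∀ {m n} → m ℕ.≤ n → ι m ≤ ι n
ι-mono h = ζ-mono-≤ (ℤ.+≤+ h)

0≤ι : ∀ n → 0ℚ ≤ ι n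
0≤ι n = subst (_≤ ι n) ι0 (ι-mono z≤n)

1≤ι : ∀ {n} → 1 ℕ.≤ n → 1ℚ ≤ ι n
1≤ι {n} h = subst (_≤ ι n) ι1 (ι-mono h)

0<ι : ∀ {n} → 1 ℕ.≤ n → 0ℚ < ι n
0<ι h = <-≤-trans 0<1 (1≤ι h)

floor-bounds : ∀ q → ∃[ e ] (ζ e ≤ q × q < ζ e + 1ℚ)
floor-bounds q@(mkℚ n d-1 _) = e , lower , upper
  where
  d = suc d-1
  e = n ℤ./ℕ d
  lower : ζ e ≤ q
  lower rewrite ζ≡ e = *≤* (subst (e ℤ.* ℤ.+ d ℤ.≤_) (sym (ℤₚ.*-identityʳ n)) (ℤ.[n/ℕd]*d≤n n d))
  upper′ : q < ζ (ℤ.suc e)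
  upper′ rewrite ζ≡ (ℤ.suc e) = *<* (subst (ℤ._< ℤ.suc e ℤ.* ℤ.+ d) (sym (ℤₚ.*-identityʳ n)) (ℤ.n<s[n/ℕd]*d n d))
  upper : q < ζ e + 1ℚ
  upper = subst (q <_) (trans (ζ-+ (ℤ.+ 1) e) (trans (cong (_+ ζ e) ι1) (+-comm 1ℚ (ζ e)))) upper′

-- inv 0 = 0

opaque
  inv : ℚ → ℚ
  inv p with p ≟ 0ℚ
  ... | yes _   = 0ℚ
  ... | no  p≢0 = (1/ p) {{≢-nonZero p≢0}}

  *-inv : ∀ {p} → 0ℚ < p → p * inv p ≡ 1ℚ
  *-inv {p} h with p ≟ 0ℚ
  ... | yes e   = ⊥-elim (<-irrefl (sym e) h)
  ... | no  p≢0 = *-inverseʳ p {{≢-nonZero p≢0}}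

  0<inv : ∀ {p} → 0ℚ < p → 0ℚ < inv p
  0<inv {p} h with inv p ≤? 0ℚ
  ... | no ≰ = ≰⇒> ≰
  ... | yes ≤0 = ⊥-elim (<-irrefl refl (<-≤-trans 0<1 (subst (_≤ 0ℚ) (*-inv h)
          (subst (p * inv p ≤_) (*-zeroʳ p) (*-mono-≤ˡ (<⇒≤ h) ≤0)))))

-- Translates the quotients of the definitions into `inv`, which the ring solver can handle. In the
-- unnormalised rationals the claim is a cross-multiplication.
/≡*inv : ∀ m n .{{_ : ℕ.NonZero n}} → (ℤ.+ m) / n ≡ ι m * inv (ι n)
/≡*inv m n@(suc n-1) = trans (sym (*-identityʳ _)) (trans (cong ((ℤ.+ m) / n *_) (sym (*-inv 0<n)))
  (trans (sym (*-assoc ((ℤ.+ m) / n) (ι n) _)) (cong (_* inv (ι n)) eq)))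
  where
  0<n : 0ℚ < ι n
  0<n = 0<ι (s≤s z≤n)
  eq : (ℤ.+ m) / n * ι n ≡ ι m
  eq = subst₂ (λ x y → (ℤ.+ m) / n * x ≡ y) (sym (ζ≡/1 (ℤ.+ n))) (sym (ζ≡/1 (ℤ.+ m))) (toℚᵘ-injective (ℚᵘₚ.≃-trans (toℚᵘ-homo-* ((ℤ.+ m) / n) ((ℤ.+ n) / 1))
    (ℚᵘₚ.≃-trans (ℚᵘₚ.*-cong (toℚᵘ-fromℚᵘ (ℚᵘ.mkℚᵘ (ℤ.+ m) n-1)) (toℚᵘ-fromℚᵘ (ℚᵘ.mkℚᵘ (ℤ.+ n) 0)))
    (ℚᵘₚ.≃-trans (ℚᵘ.*≡* (trans (ℤₚ.*-identityʳ _) (cong (ℤ.+ m ℤ.*_) (cong ℤ.+_ (sym (ℕₚ.*-identityʳ n))))))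
      (ℚᵘₚ.≃-sym (toℚᵘ-fromℚᵘ (ℚᵘ.mkℚᵘ (ℤ.+ m) 0)))))))

inv-unique : ∀ {p q} → 0ℚ < p → p * q ≡ 1ℚ → q ≡ inv p
inv-unique {p} {q} h e = trans (sym (*-identityˡ q)) (trans (cong (_* q) (sym (*-inv h)))
  (trans (eq p (inv p) q) (trans (cong (inv p *_) e) (*-identityʳ (inv p)))))
  where
  eq : ∀ p i q → p * i * q ≡ i * (p * q)
  eq = solve-∀ ring

-- The denominator of ε serves as m, because the numerator is at least 1.
archimedean : ∀ {ε} → 0ℚ < ε → ∃[ m ] (1 ℕ.≤ m × 1ℚ ≤ ε * ι m)
archimedean {ε@(mkℚ (ℤ.+ zero) d-1 _)} h = ⊥-elim (ℤₚ.<-irrefl refl (drop-*<* h))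
archimedean {ε@(mkℚ (ℤ.+ suc n) d-1 c)} h = suc d-1 , s≤s z≤n ,
  subst (1ℚ ≤_) (sym eq) (1≤ι (s≤s z≤n))
  where
  eq : ε * ι (suc d-1) ≡ ι (suc n)
  eq = trans (cong (_* ι (suc d-1)) (trans (sym (↥p/↧p≡p ε)) (/≡*inv (suc n) (suc d-1))))
    (trans (lem (ι (suc n)) (ι (suc d-1)) (inv (ι (suc d-1))))
    (trans (cong (ι (suc n) *_) (*-inv (0<ι (s≤s z≤n)))) (*-identityʳ _)))
    where
    lem : ∀ a b c → a * c * b ≡ a * (b * c)
    lem = solve-∀ ring
archimedean {ε@(mkℚ (ℤ.-[1+ n ]) d-1 _)} (*<* ())

½+½ : ∀ ε → ½ * ε + ½ * ε ≡ ε
½+½ = solve-∀ ring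

0<½* : ∀ {ε} → 0ℚ < ε → 0ℚ < ½ * ε
0<½* = 0<* 0<½

-- Finite sums

Σ : ℕ → (ℕ → ℚ) → ℚ
Σ zero    f = 0ℚ
Σ (suc n) f = f 0 + Σ n (λ i → f (suc i))

Σ-cong : ∀ n {f g} → (∀ i → i ℕ.< n → f i ≡ g i) → Σ n f ≡ Σ n g
Σ-cong zero    h = refl
Σ-cong (suc n) h = cong₂ _+_ (h 0 (s≤s z≤n)) (Σ-cong n (λ i l → h (suc i) (s≤s l)))

Σ-mono : ∀ n {f g} → (∀ i → i ℕ.< n → f i ≤ g i) → Σ n f ≤ Σ n g
Σ-mono zero    h = ≤-refl
Σ-mono (suc n) h = +-mono-≤ (h 0 (s≤s z≤n)) (Σ-mono n (λ i l → h (suc i) (s≤s l)))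

Σ-0 : ∀ n → Σ n (λ _ → 0ℚ) ≡ 0ℚ
Σ-0 zero    = refl
Σ-0 (suc n) = trans (+-identityˡ _) (Σ-0 n)

Σ-nonneg : ∀ n {f} → (∀ i → i ℕ.< n → 0ℚ ≤ f i) → 0ℚ ≤ Σ n f
Σ-nonneg n h = subst (_≤ Σ n _) (Σ-0 n) (Σ-mono n h)

Σ-+ : ∀ n f g → Σ n (λ i → f i + g i) ≡ Σ n f + Σ n g
Σ-+ zero    f g = refl
Σ-+ (suc n) f g = trans (cong ((f 0 + g 0) +_) (Σ-+ n _ _)) (eq (f 0) (g 0) (Σ n (λ i → f (suc i))) (Σ n (λ i → g (suc i))))
  where
  eq : ∀ a b c d → a + b + (c + d) ≡ (a + c) + (b + d)
  eq = solve-∀ ring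

Σ-*ˡ : ∀ n c f → Σ n (λ i → c * f i) ≡ c * Σ n f
Σ-*ˡ zero    c f = sym (*-zeroʳ c)
Σ-*ˡ (suc n) c f = trans (cong (c * f 0 +_) (Σ-*ˡ n c _)) (sym (*-distribˡ-+ c _ _))

Σ-*ʳ : ∀ n c f → Σ n (λ i → f i * c) ≡ Σ n f * c
Σ-*ʳ n c f = trans (Σ-cong n (λ i _ → *-comm (f i) c)) (trans (Σ-*ˡ n c f) (*-comm c _))

Σ-neg : ∀ n f → Σ n (λ i → - f i) ≡ - Σ n f
Σ-neg zero    f = refl
Σ-neg (suc n) f = trans (cong (- f 0 +_) (Σ-neg n _)) (sym (neg-distrib-+ (f 0) _))

Σ-- : ∀ n f g → Σ n (λ i → f i - g i) ≡ Σ n f - Σ n g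
Σ-- n f g = trans (Σ-+ n f (λ i → - g i)) (cong (Σ n f +_) (Σ-neg n g))

Σ-const : ∀ n c → Σ n (λ _ → c) ≡ ι n * c
Σ-const zero    c = sym (trans (cong (_* c) ι0) (*-zeroˡ c))
Σ-const (suc n) c = trans (cong (c +_) (Σ-const n c)) (trans (eq c (ι n)) (cong (_* c) (sym (ι-suc n))))
  where
  eq : ∀ c n → c + n * c ≡ (1ℚ + n) * c
  eq = solve-∀ ring

Σ-abs : ∀ n f → ∣ Σ n f ∣ ≤ Σ n (λ i → ∣ f i ∣)
Σ-abs zero    f = ≤-refl
Σ-abs (suc n) f = ≤-trans (∣p+q∣≤∣p∣+∣q∣ (f 0) _) (+-monoʳ-≤ ∣ f 0 ∣ (Σ-abs n _))

Σ-++ : ∀ m n f → Σ (m ℕ.+ n) f ≡ Σ m f + Σ n (λ i → f (m ℕ.+ i))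
Σ-++ zero    n f = sym (+-identityˡ _)
Σ-++ (suc m) n f = trans (cong (f 0 +_) (Σ-++ m n _)) (sym (+-assoc (f 0) _ _))

Σ-last : ∀ n f → Σ (suc n) f ≡ Σ n f + f n
Σ-last zero    f = trans (+-identityʳ (f 0)) (sym (+-identityˡ (f 0)))
Σ-last (suc n) f = trans (cong (f 0 +_) (Σ-last n _)) (sym (+-assoc (f 0) _ _))

Σ-double : ∀ m n f → Σ (m ℕ.* n) f ≡ Σ m (λ i → Σ n (λ j → f (i ℕ.* n ℕ.+ j)))
Σ-double zero    n f = refl
Σ-double (suc m) n f = trans (Σ-++ n (m ℕ.* n) f) (cong (Σ n f +_)
  (trans (Σ-double m n (λ i → f (n ℕ.+ i)))
    (Σ-cong m (λ i _ → Σ-cong n (λ j _ → cong f (sym (ℕₚ.+-assoc n (i ℕ.* n) j)))))))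

term≤Σ : ∀ n {f} → (∀ i → i ℕ.< n → 0ℚ ≤ f i) → ∀ j → j ℕ.< n → f j ≤ Σ n f
term≤Σ (suc n) {f} h zero    _       =
  by-diff (Σ-nonneg n (λ i l → h (suc i) (s≤s l))) (p+q-p≡q (f 0) _)
term≤Σ (suc n) {f} h (suc j) (s≤s l) =
  ≤-trans (term≤Σ n (λ i l → h (suc i) (s≤s l)) j l) (by-diff (h 0 (s≤s z≤n)) (p+q-q≡p (f 0) _))

-- Geometric decay

pow : ℚ → ℕ → ℚ
pow p zero    = 1ℚ
pow p (suc n) = p * pow p n

pow-+ : ∀ p m n → pow p (m ℕ.+ n) ≡ pow p m * pow p n
pow-+ p zero    n = sym (*-identityˡ _)
pow-+ p (suc m) n = trans (cong (p *_) (pow-+ p m n)) (sym (*-assoc p _ _))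

pow-nonneg : ∀ {p} → 0ℚ ≤ p → ∀ n → 0ℚ ≤ pow p n
pow-nonneg h zero    = 0≤1
pow-nonneg h (suc n) = h ⊠ pow-nonneg h n

pow-pos : ∀ {p} → 0ℚ < p → ∀ n → 0ℚ < pow p n
pow-pos h zero    = 0<1
pow-pos h (suc n) = 0<* h (pow-pos h n)

pow-* : ∀ p q n → pow (p * q) n ≡ pow p n * pow q n
pow-* p q zero    = refl
pow-* p q (suc n) = trans (cong (p * q *_) (pow-* p q n)) (eq p q (pow p n) (pow q n))
  where
  eq : ∀ p q a b → p * q * (a * b) ≡ p * a * (q * b)
  eq = solve-∀ ring

pow-mono : ∀ {p q} → 0ℚ ≤ p → p ≤ q → ∀ n → pow p n ≤ pow q n
pow-mono 0≤p p≤q zero    = ≤-refl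
pow-mono 0≤p p≤q (suc n) = *-mono-≤ 0≤p (pow-nonneg (≤-trans 0≤p p≤q) n) p≤q (pow-mono 0≤p p≤q n)

pow≤1 : ∀ {p} → 0ℚ ≤ p → p ≤ 1ℚ → ∀ n → pow p n ≤ 1ℚ
pow≤1 0≤p p≤1 zero    = ≤-refl
pow≤1 {p} 0≤p p≤1 (suc n) = *-mono-≤ {q = 1ℚ} {s = 1ℚ} 0≤p 0≤1 p≤1 (pow≤1 0≤p p≤1 n)

ι-^ : ∀ k n → ι (k ℕ.^ n) ≡ pow (ι k) n
ι-^ k zero    = ι1
ι-^ k (suc n) = trans (ι-* k (k ℕ.^ n)) (cong (ι k *_) (ι-^ k n))

-- A ratio of the special form 1 - 1/K has a natural-number modulus of decay and geometric sums
-- bounded by K. The module is used with K = 3 for the masses of cells and with K = 1568 k for the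
-- bad cells.
module Decay (K : ℕ) (1≤K : 1 ℕ.≤ K) where
  d : ℚ
  d = 1ℚ - inv (ι K)

  private
    i = inv (ι K)
    Ki≡1 : ι K * i ≡ 1ℚ
    Ki≡1 = *-inv (0<ι 1≤K)
    0≤i : 0ℚ ≤ i
    0≤i = <⇒≤ (0<inv (0<ι 1≤K))

  0≤d : 0ℚ ≤ d
  0≤d = diff (subst (i ≤_) Ki≡1 (subst (_≤ ι K * i) (*-identityˡ i) (*-mono-≤ʳ 0≤i (1≤ι 1≤K))))

  d≤1 : d ≤ 1ℚ
  d≤1 = by-diff 0≤i (eq i)
    where
    eq : ∀ i → 1ℚ - (1ℚ - i) ≡ i
    eq = solve-∀ ring

  -- (K + n) (1 - 1/K)ⁿ is decreasing in n
  bernoulli : ∀ n → (ι K + ι n) * pow d n ≤ ι K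
  bernoulli zero    = ≤-reflexive (trans (*-identityʳ _) (trans (cong (ι K +_) ι0) (+-identityʳ (ι K))))
  bernoulli (suc n) = ≤-trans (≤-reflexive (sym (*-assoc (ι K + ι (suc n)) d (pow d n))))
    (≤-trans (*-mono-≤ʳ (pow-nonneg 0≤d n) step) (bernoulli n))
    where
    step : (ι K + ι (suc n)) * d ≤ ι K + ι n
    step = by-diff (0≤ι (suc n) ⊠ 0≤i)
      (trans (cong (λ x → ι K + ι n - (ι K + x) * (1ℚ - i)) (ι-suc n))
      (trans (eq (ι K) (ι n) i)
      (trans (cong (λ x → (1ℚ + ι n) * i + (x - 1ℚ)) Ki≡1)
      (trans (cong (_+ 0ℚ) (cong (_* i) (sym (ι-suc n)))) (+-identityʳ _)))))
      where
      eq : ∀ a b i → a + b - (a + (1ℚ + b)) * (1ℚ - i) ≡ (1ℚ + b) * i + (a * i - 1ℚ)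
      eq = solve-∀ ring

  -- By `bernoulli`, dⁿ ≤ K/(K + n). With natural numbers c ≥ C and m ≥ 1/ε it is therefore enough
  -- that n ≥ c K m.
  decay : ∀ C → 0ℚ ≤ C → ∀ {ε} → 0ℚ < ε → ∃[ J ] (∀ n → J ℕ.≤ n → C * pow d n ≤ ε)
  decay C 0≤C {ε} 0<ε = J , bound
    where
    fl = floor-bounds C
    e = proj₁ fl
    c = ℤ.∣ e ∣ ℕ.+ 1
    i≤∣i∣ : ∀ i → i ℤ.≤ ℤ.+ ℤ.∣ i ∣
    i≤∣i∣ (ℤ.+ n) = ℤₚ.≤-refl
    i≤∣i∣ ℤ.-[1+ n ] = ℤ.-≤+
    C≤c : C ≤ ι c
    C≤c = ≤-trans (<⇒≤ (proj₂ (proj₂ fl)))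
      (≤-trans (+-monoˡ-≤ 1ℚ (ζ-mono-≤ (i≤∣i∣ e))) (≤-reflexive (sym (trans (ι-+ ℤ.∣ e ∣ 1) (cong (ι ℤ.∣ e ∣ +_) ι1)))))
    m = proj₁ (archimedean 0<ε)
    1≤εm = proj₂ (proj₂ (archimedean 0<ε))
    J = c ℕ.* K ℕ.* m
    bound : ∀ n → J ℕ.≤ n → C * pow d n ≤ ε
    bound n J≤n = *-cancel-≤ 0<s (≤-trans (≤-reflexive (eq₁ s C (pow d n)))
      (≤-trans (*-mono-≤ˡ 0≤C (bernoulli n)) final))
      where
      s = ι K + ι n
      0<s : 0ℚ < s
      0<s = <-≤-trans (0<ι 1≤K) (by-diff (0≤ι n) (p+q-p≡q (ι K) (ι n)))
      eq₁ : ∀ s c p → s * (c * p) ≡ c * (s * p)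
      eq₁ = solve-∀ ring
      -- C K ≤ c K (ε m) ≤ ε n
      final : C * ι K ≤ s * ε
      final = ≤-trans (*-mono-≤ʳ (0≤ι K) C≤c)
        (≤-trans (≤-reflexive (sym (*-identityʳ (ι c * ι K))))
        (≤-trans (*-mono-≤ˡ (0≤ι c ⊠ 0≤ι K) 1≤εm)
        (≤-trans (≤-reflexive (trans (eq₂ (ι c) (ι K) ε (ι m))
            (cong (_* ε) (trans (cong (_* ι m) (sym (ι-* c K))) (sym (ι-* (c ℕ.* K) m))))))
        (≤-trans (*-mono-≤ʳ (<⇒≤ 0<ε) (ι-mono J≤n))
          (*-mono-≤ʳ {p = ι n} {q = s} (<⇒≤ 0<ε) (by-diff (0≤ι K) (p+q-q≡p (ι K) (ι n))))))))
        where
        eq₂ : ∀ c k e m → c * k * (e * m) ≡ c * k * m * e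
        eq₂ = solve-∀ ring

  -- Because 1 - d = 1/K, the partial sum equals K (1 - dᴺ).
  geometric-sum : ∀ N → Σ N (pow d) ≤ ι K
  geometric-sum N = by-diff (0≤ι K ⊠ pow-nonneg 0≤d N) (trans (cong (λ x → ι K - x) (closed N)) (eq (ι K) (pow d N)))
    where
    eq : ∀ a b → a - a * (1ℚ - b) ≡ a * b
    eq = solve-∀ ring
    closed : ∀ N → Σ N (pow d) ≡ ι K * (1ℚ - pow d N)
    closed zero    = sym (*-zeroʳ (ι K))
    closed (suc N) = trans (Σ-last N (pow d)) (trans (cong (_+ pow d N) (closed N))
      (trans (cong (λ x → ι K * (1ℚ - pow d N) + x) (trans (sym (*-identityˡ (pow d N))) (cong (_* pow d N) (sym Ki≡1))))
        (eq′ (ι K) (pow d N) i)))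
      where
      eq′ : ∀ a b i → a * (1ℚ - b) + a * i * b ≡ a * (1ℚ - (1ℚ - i) * b)
      eq′ = solve-∀ ring

-- A quadratic majorant of the square root

2ℚ 3ℚ : ℚ
2ℚ = 1ℚ + 1ℚ
3ℚ = 2ℚ + 1ℚ

-- One strict inequality is enough to improve the whole sum; it is applied to the digit 0, the only
-- one whose gain is bounded away from zero below.
Σ-mono-gap : ∀ n {f g : ℕ → ℚ} e → 1 ℕ.≤ n → (∀ i → i ℕ.< n → f i ≤ g i) → f 0 + e ≤ g 0 → Σ n f + e ≤ Σ n g
Σ-mono-gap (suc n) {f} {g} e _ h h₀ = ≤-trans (≤-reflexive (eq (f 0) (Σ n (λ i → f (suc i))) e))
  (+-mono-≤ h₀ (Σ-mono n (λ i i<n → h (suc i) (s≤s i<n))))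
  where
  eq : ∀ x y e → x + y + e ≡ x + e + y
  eq = solve-∀ ring

1/16 1/784 : ℚ
1/16  = (ℤ.+ 1) / 16
1/784 = (ℤ.+ 1) / 784

-- A quadratic upper bound for √(1 + x) on [-1 , 1].
φ : ℚ → ℚ
φ x = 1ℚ + ½ * x - 1/16 * (x * x)

-- The Taylor coefficient 1/8 would leave the difference - x³/8 + x⁴/64, which is negative for small
-- positive x. With 1/16 the difference is x² times a factor that is positive up to x = 1.
1+x≤φ² : ∀ {x} → x ≤ 1ℚ → 1ℚ + x ≤ φ x * φ x
1+x≤φ² {x} h = by-diff (0≤p² x ⊠ (0≤1/16 ⊞ 0≤1/16 ⊠ diff h ⊞ (0≤1/16 ⊠ 0≤1/16) ⊠ 0≤p² x)) (eq x)
  where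
  0≤1/16 : 0ℚ ≤ 1/16
  0≤1/16 = nonNegative⁻¹ 1/16
  eq : ∀ x → (1ℚ + ½ * x - (ℤ.+ 1 / 16) * (x * x)) * (1ℚ + ½ * x - (ℤ.+ 1 / 16) * (x * x)) - (1ℚ + x) ≡
       x * x * ((ℤ.+ 1 / 16) + (ℤ.+ 1 / 16) * (1ℚ - x) + (ℤ.+ 1 / 16) * (ℤ.+ 1 / 16) * (x * x))
  eq = solve-∀ ring

0≤φ : ∀ {x} → - 1ℚ ≤ x → x ≤ 1ℚ → 0ℚ ≤ φ x
0≤φ {x} l u = by-diff (c₁ ⊠ (diff u ⊠ diff l) ⊞ (c₂ ⊞ <⇒≤ 0<½ ⊠ diff l)) (eq x)
  where
  c₁ : 0ℚ ≤ ℤ.+ 1 / 16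
  c₁ = nonNegative⁻¹ (ℤ.+ 1 / 16)
  c₂ : 0ℚ ≤ ℤ.+ 7 / 16
  c₂ = nonNegative⁻¹ (ℤ.+ 7 / 16)
  eq : ∀ x → 1ℚ + ½ * x - (ℤ.+ 1 / 16) * (x * x) - 0ℚ ≡
       (ℤ.+ 1 / 16) * ((1ℚ - x) * (x - (- 1ℚ))) + ((ℤ.+ 7 / 16) + ½ * (x - (- 1ℚ)))
  eq = solve-∀ ring

φ≤ : ∀ x → φ x ≤ 1ℚ + ½ * x
φ≤ x = by-diff (c ⊠ 0≤p² x) (eq x)
  where
  c : 0ℚ ≤ ℤ.+ 1 / 16
  c = nonNegative⁻¹ (ℤ.+ 1 / 16)
  eq : ∀ x → 1ℚ + ½ * x - (1ℚ + ½ * x - (ℤ.+ 1 / 16) * (x * x)) ≡ (ℤ.+ 1 / 16) * (x * x)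
  eq = solve-∀ ring

-- Here - x ≥ 1/7, so the quadratic term x²/16 is at least 1/(16 · 49) = 1/784.
φ-gap : ∀ x → 1ℚ ≤ (ℤ.+ 7 / 1) * (- x) → φ x + 1/784 ≤ 1ℚ + ½ * x
φ-gap x h = by-diff (c ⊠ (diff h ⊠ (diff h ⊞ (0≤1 ⊞ 0≤1)))) (eq x)
  where
  c : 0ℚ ≤ 1/784
  c = nonNegative⁻¹ 1/784
  eq : ∀ x → 1ℚ + ½ * x - (1ℚ + ½ * x - (ℤ.+ 1 / 16) * (x * x) + (ℤ.+ 1 / 784)) ≡
       (ℤ.+ 1 / 784) * (((ℤ.+ 7 / 1) * (- x) - 1ℚ) * ((ℤ.+ 7 / 1) * (- x) - 1ℚ + (1ℚ + 1ℚ)))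
  eq = solve-∀ ring

-- Integers inside ℚ and residues

*-cancel-<ʳ : ∀ {r p q} → 0ℚ < r → p * r < q * r → p < q
*-cancel-<ʳ {r} h = *-cancelʳ-<-nonNeg r {{nonNegative (<⇒≤ h)}}

*-mono-<ʳ : ∀ {r p q} → 0ℚ < r → p < q → p * r < q * r
*-mono-<ʳ {r} h = *-monoˡ-<-pos r {{Data.Rational.Base.positive h}}

ζ-suc : ∀ e → ζ (ℤ.suc e) ≡ ζ e + 1ℚ
ζ-suc e = trans (ζ-+ (ℤ.+ 1) e) (trans (cong (_+ ζ e) ι1) (+-comm 1ℚ (ζ e)))

ζ-neg : ∀ j → ζ (ℤ.- j) ≡ - ζ j
ζ-neg j = trans (eq (ζ (ℤ.- j)) (ζ j)) (trans (cong (_- ζ j) (trans (sym (ζ-+ (ℤ.- j) j)) (trans (cong ζ (ℤₚ.+-inverseˡ j)) ι0))) (+-identityˡ (- ζ j)))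
  where
  eq : ∀ a b → a ≡ a + b - b
  eq = solve-∀ ring

ζ-cancel-<1 : ∀ {i j} → ζ i < ζ j + 1ℚ → i ℤ.≤ j
ζ-cancel-<1 {i} {j} h = ℤₚ.i<j⇒i≤pred[j] (ζ-cancel-< (subst (ζ i <_) (sym (ζ-suc j)) h)) ⟨≤⟩ ℤₚ.≤-reflexive (ℤₚ.pred-suc j)
  where
  _⟨≤⟩_ = ℤₚ.≤-trans

private
  0≤i<1⇒0 : ∀ {s} → ζ s < 1ℚ → - 1ℚ < ζ s → s ≡ ℤ.+ 0
  0≤i<1⇒0 {s} u l = ℤₚ.≤-antisym
    (ζ-cancel-<1 (subst (ζ s <_) (trans (sym (+-identityˡ 1ℚ)) (cong (_+ 1ℚ) (sym ι0))) u))
    (ζ-cancel-<1 (subst (_< ζ s + 1ℚ) (sym ι0) (by-diff-< (diff-< l) (eq (ζ s)))))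
    where
    eq : ∀ s → s + 1ℚ - 0ℚ ≡ s - (- 1ℚ)
    eq = solve-∀ ring

-- The remainder and c both lie in [0, l), so the difference s of the two quotients is an integer
-- strictly between -1 and 1.
%ℕ-unique : ∀ l .{{_ : NonZero l}} c j → c ℕ.< l → (ℤ.+ c ℤ.+ j ℤ.* ℤ.+ l) ℤ.%ℕ l ≡ c
%ℕ-unique l c j c<l = ℤₚ.+-injective (sym (trans (sym (ℤₚ.+-identityʳ (ℤ.+ c))) (trans (cong (λ z → ℤ.+ c ℤ.+ z) (trans (sym (ℤₚ.*-zeroˡ (ℤ.+ l))) (cong (ℤ._* ℤ.+ l) (sym s≡0)))) split)))
  where
  e = ℤ.+ c ℤ.+ j ℤ.* ℤ.+ l
  r = e ℤ.%ℕ l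
  s = j ℤ.- e ℤ./ℕ l
  split : ℤ.+ c ℤ.+ s ℤ.* ℤ.+ l ≡ ℤ.+ r
  split = trans (eq (ℤ.+ c) j (e ℤ./ℕ l) (ℤ.+ l)) (trans (cong (ℤ._- (e ℤ./ℕ l) ℤ.* ℤ.+ l) (ℤ.a≡a%ℕn+[a/ℕn]*n e l)) (eq′ (ℤ.+ r) ((e ℤ./ℕ l) ℤ.* ℤ.+ l)))
    where
    eq : ∀ c j q l → c ℤ.+ (j ℤ.- q) ℤ.* l ≡ c ℤ.+ j ℤ.* l ℤ.- q ℤ.* l
    eq = ℤ-Solver.solve-∀
    eq′ : ∀ r x → r ℤ.+ x ℤ.- x ≡ r
    eq′ = ℤ-Solver.solve-∀
  splitℚ : ι c + ζ s * ι l ≡ ι r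
  splitℚ = trans (cong (ι c +_) (sym (ζ-* s (ℤ.+ l)))) (trans (sym (ζ-+ (ℤ.+ c) (s ℤ.* ℤ.+ l))) (cong ζ split))
  r<l : r ℕ.< l
  r<l = ℤ.n%ℕd<d e l
  ι< : ∀ {m n} → m ℕ.< n → ι m + 1ℚ ≤ ι n
  ι< {m} {n} h = subst (_≤ ι n) (trans (ι-suc m) (+-comm 1ℚ (ι m))) (ι-mono h)
  0<l : 0ℚ < ι l
  0<l = 0<ι (ℕₚ.≤-trans (s≤s z≤n) c<l)
  s≡0 : s ≡ ℤ.+ 0
  s≡0 = 0≤i<1⇒0
    (*-cancel-<ʳ 0<l (by-diff-< {r = 1ℚ + (ι l - (ι r + 1ℚ) + ι c)} (<-≤-trans 0<1 (by-diff (diff (ι< r<l) ⊞ 0≤ι c) (eq₀ _)))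
      (trans (eq₁ (ι l) (ζ s) (ι c)) (trans (cong (λ z → ι l + ι c - z) splitℚ) (eq₂ (ι l) (ι c) (ι r))))))
    (*-cancel-<ʳ 0<l (by-diff-< {r = 1ℚ + (ι l - (ι c + 1ℚ) + ι r)} (<-≤-trans 0<1 (by-diff (diff (ι< c<l) ⊞ 0≤ι r) (eq₀ _)))
      (trans (eq₃ (ι l) (ζ s) (ι c)) (trans (cong (λ z → ι l - ι c + z) splitℚ) (eq₄ (ι l) (ι c) (ι r))))))
    where
    eq₀ : ∀ x → 1ℚ + x - 1ℚ ≡ x
    eq₀ = solve-∀ ring
    eq₁ : ∀ l s c → 1ℚ * l - s * l ≡ l + c - (c + s * l)
    eq₁ = solve-∀ ring
    eq₂ : ∀ l c r → l + c - r ≡ 1ℚ + (l - (r + 1ℚ) + c)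
    eq₂ = solve-∀ ring
    eq₃ : ∀ l s c → s * l - (- 1ℚ) * l ≡ l - c + (c + s * l)
    eq₃ = solve-∀ ring
    eq₄ : ∀ l c r → l - c + r ≡ 1ℚ + (l - (c + 1ℚ) + r)
    eq₄ = solve-∀ ring

between : ∀ e i → e ℤ.≤ i → i ℤ.≤ e ℤ.+ ℤ.+ 2 → ∃[ t ] (t ℕ.≤ 2 × i ≡ e ℤ.+ ℤ.+ t)
between e i l u = t , ℤₚ.drop‿+≤+ t≤2 , sym (trans (cong (λ z → e ℤ.+ z) t≡) (eq e i))
  where
  t = ℤ.∣ i ℤ.- e ∣
  t≡ : ℤ.+ t ≡ i ℤ.- e
  t≡ = ℤₚ.0≤i⇒+∣i∣≡i (ℤₚ.i≤j⇒0≤j-i l)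
  eq : ∀ e i → e ℤ.+ (i ℤ.- e) ≡ i
  eq = ℤ-Solver.solve-∀
  t≤2 : ℤ.+ t ℤ.≤ ℤ.+ 2
  t≤2 = subst₂ ℤ._≤_ (sym t≡) (eq′ e (ℤ.+ 2)) (ℤₚ.+-monoˡ-≤ (ℤ.- e) u)
    where
    eq′ : ∀ e j → e ℤ.+ j ℤ.- e ≡ j
    eq′ = ℤ-Solver.solve-∀

-- Eventual properties and approximate comparison of reals

Ev : (ℕ → Set) → Set
Ev P = ∃[ N ] (∀ n → N ℕ.≤ n → P n)

Ev-map : ∀ {P Q : ℕ → Set} → (∀ n → P n → Q n) → Ev P → Ev Q
Ev-map f (N , h) = N , λ n l → f n (h n l)

Ev-× : ∀ {P Q : ℕ → Set} → Ev P → Ev Q → Ev (λ n → P n × Q n)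
Ev-× (M , h) (N , h′) = M ℕ.⊔ N , λ n l → h n (ℕₚ.m⊔n≤o⇒m≤o M N l) , h′ n (ℕₚ.m⊔n≤o⇒n≤o M N l)

Ev-zip : ∀ {P Q R : ℕ → Set} → (∀ n → P n → Q n → R n) → Ev P → Ev Q → Ev R
Ev-zip f p q = Ev-map (λ { n (x , y) → f n x y }) (Ev-× p q)

Ev-≥ : ∀ N → Ev (N ℕ.≤_)
Ev-≥ N = N , λ _ l → l

-- Each level has finitely many grid points. A pointwise hypothesis on a test function, whose
-- modulus depends on the point, thus holds at all of them simultaneously from some index on.
Ev-∀< : ∀ l {P : ℕ → ℕ → Set} → (∀ i → i ℕ.< l → Ev (P i)) → Ev (λ n → ∀ i → i ℕ.< l → P i n)
Ev-∀< zero    h = 0 , λ _ _ _ ()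
Ev-∀< (suc l) {P} h = Ev-zip combine (h 0 (s≤s z≤n)) (Ev-∀< l (λ i i<l → h (suc i) (s≤s i<l)))
  where
  combine : ∀ n → P 0 n → (∀ i → i ℕ.< l → P (suc i) n) → ∀ i → i ℕ.< suc l → P i n
  combine n p₀ ps zero    _         = p₀
  combine n p₀ ps (suc i) (s≤s i<l) = ps i i<l

¼ : ℚ → ℚ
¼ ε = ½ * (½ * ε)

0<¼ : ∀ {ε} → 0ℚ < ε → 0ℚ < ¼ ε
0<¼ h = 0<½* (0<½* h)

¼×3≤ : ∀ {ε} → 0ℚ < ε → ¼ ε + ¼ ε + ¼ ε ≤ ε
¼×3≤ {ε} h = by-diff (<⇒≤ (0<¼ h)) (eq ε)
  where
  eq : ∀ ε → ε - (½ * (½ * ε) + ½ * (½ * ε) + ½ * (½ * ε)) ≡ ½ * (½ * ε)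
  eq = solve-∀ ring

-- Quantitative forms: x ≃ y means ∀ ε > 0 → Close ε x y, and x ≤ y means ∀ ε > 0 → Below ε x y.

Close Below : ℚ → ℝ → ℝ → Set
Close ε x y = Ev (λ i → ∣ approx x i - approx y i ∣ ≤ ε)
Below ε x y = Ev (λ i → approx x i ≤ approx y i + ε)

Close-refl : ∀ {ε} x → 0ℚ ≤ ε → Close ε x x
Close-refl {ε} x h = 0 , λ i _ → subst (_≤ ε) (sym (cong ∣_∣ (+-inverseʳ (approx x i)))) h

Close-sym : ∀ {ε} x y → Close ε x y → Close ε y x
Close-sym {ε} x y = Ev-map (λ i → subst (_≤ ε) (∣p-q∣-comm (approx x i) (approx y i)))

Close-trans : ∀ {ε ε′} x y z → Close ε x y → Close ε′ y z → Close (ε + ε′) x z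
Close-trans x y z = Ev-zip (λ i → ∣-∣-triangle (approx x i) (approx y i) (approx z i))

Close-+ : ∀ {ε ε′} x y x′ y′ → Close ε x x′ → Close ε′ y y′ → Close (ε + ε′) (x +ᵣ y) (x′ +ᵣ y′)
Close-+ {ε} {ε′} x y x′ y′ = Ev-zip λ i h h′ → ≤-trans
  (≤-reflexive (cong ∣_∣ (eq (approx x i) (approx y i) (approx x′ i) (approx y′ i))))
  (≤-trans (∣p+q∣≤∣p∣+∣q∣ (approx x i - approx x′ i) _) (+-mono-≤ h h′))
  where
  eq : ∀ a b c d → (a + b) - (c + d) ≡ (a - c) + (b - d)
  eq = solve-∀ ring

Close-*ˡ : ∀ c {ε} → 0ℚ < ε → ∃[ δ ] (0ℚ < δ × (∀ x y → Close δ x y → Close ε (c *ᵣ x) (c *ᵣ y)))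
Close-*ˡ c {ε} 0<ε = with-bound (cauchy⇒bounded (approx c) (cauchy c))
  where
  with-bound : EventuallyBounded (approx c) → ∃[ δ ] (0ℚ < δ × (∀ x y → Close δ x y → Close ε (c *ᵣ x) (c *ᵣ y)))
  with-bound (B , B>0 , bounded) = δ , 0<* (0<inv 0<B) 0<ε , λ x y → Ev-zip (step x y) bounded
    where
    0<B : 0ℚ < B
    0<B = positive⁻¹ B {{B>0}}
    δ = inv B * ε
    step : ∀ x y i → ∣ approx c i ∣ ≤ B → ∣ approx x i - approx y i ∣ ≤ δ →
           ∣ approx c i * approx x i - approx c i * approx y i ∣ ≤ ε
    step x y i hc h = ≤-trans (≤-reflexive (trans (cong ∣_∣ (eq (approx c i) (approx x i) (approx y i)))
        (∣p*q∣≡∣p∣*∣q∣ (approx c i) (approx x i - approx y i))))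
      (≤-trans (*-mono-≤ {∣ approx c i ∣} {B} {∣ approx x i - approx y i ∣} {δ} (0≤∣p∣ (approx c i)) (≤-trans (0≤∣p∣ (approx x i - approx y i)) h) hc h)
        (≤-reflexive (trans (sym (*-assoc B (inv B) ε)) (trans (cong (_* ε) (*-inv 0<B)) (*-identityˡ ε)))))
      where
      eq : ∀ c x y → c * x - c * y ≡ c * (x - y)
      eq = solve-∀ ring

Close⇒≤ᵣ : ∀ {ε} x y → Close ε x y → ∣ x -ᵣ y ∣ᵣ ≤ᵣ fromℚ ε
Close⇒≤ᵣ {ε} x y h ε′ 0<ε′ = Ev-map (λ i l → ≤-trans l (by-diff (<⇒≤ 0<ε′) (p+q-p≡q ε ε′))) h

-- The order of real numbers has its own tolerance built in, which is the reason for the additional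
-- ε′.
≤ᵣ⇒Close : ∀ {ε ε′} x y → 0ℚ < ε′ → ∣ x -ᵣ y ∣ᵣ ≤ᵣ fromℚ ε → Close (ε + ε′) x y
≤ᵣ⇒Close {ε} {ε′} x y 0<ε′ h = h ε′ 0<ε′

Close⇒Below : ∀ {ε} x y → Close ε x y → Below ε x y
Close⇒Below x y = Ev-map (λ i → ∣-∣≤⇒≤ {approx x i} {approx y i})

Below-trans : ∀ {ε ε′} x y z → Below ε x y → Below ε′ y z → Below (ε + ε′) x z
Below-trans {ε} {ε′} x y z = Ev-zip (λ i h h′ → ≤-trans h (≤-trans (+-monoˡ-≤ ε h′) (≤-reflexive (eq (approx z i) ε ε′))))
  where
  eq : ∀ a b c → a + c + b ≡ a + (b + c)
  eq = solve-∀ ring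

Below-≡ : ∀ {ε ε′ x y} → ε ≡ ε′ → Below ε x y → Below ε′ x y
Below-≡ refl h = h

approx-close : ∀ x {ε} → 0ℚ < ε → Ev (λ n → ∀ i → n ℕ.≤ i → ∣ approx x n - approx x i ∣ ≤ ε)
approx-close x {ε} 0<ε = let (N , h) = cauchy x ε 0<ε in
  N , λ n N≤n i n≤i → h n i N≤n (ℕₚ.≤-trans N≤n n≤i)

reciprocal-small : ∀ {ε} → 0ℚ < ε → Ev (λ n → inv (ι (suc n)) ≤ ε)
reciprocal-small {ε} 0<ε = small (archimedean 0<ε)
  where
  small : ∃[ m ] (1 ℕ.≤ m × 1ℚ ≤ ε * ι m) → Ev (λ n → inv (ι (suc n)) ≤ ε)
  small (m , 1≤m , 1≤εm) = m , λ n m≤n → *-cancel-≤ (0<ι {suc n} (s≤s z≤n))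
    (≤-trans (≤-reflexive (*-inv (0<ι (s≤s z≤n)))) (≤-trans 1≤εm
      (≤-trans (*-mono-≤ˡ (<⇒≤ 0<ε) (ι-mono (ℕₚ.m≤n⇒m≤1+n m≤n))) (≤-reflexive (*-comm ε (ι (suc n)))))))

-- Limits of Cauchy sequences of reals

CauchySequence : (ℕ → ℝ) → Set
CauchySequence x = ∀ ε → 0ℚ < ε → ∃[ N ] (∀ m n → N ℕ.≤ m → N ℕ.≤ n → Close ε (x m) (x n))

module Limit (x : ℕ → ℝ) (cx : CauchySequence x) where
  opaque
    modulus : ℕ → ℕ
    modulus n = proj₁ (cauchy (x n) (inv (ι (suc n))) (0<inv (0<ι (s≤s z≤n))))

    modulus-correct : ∀ n i → modulus n ℕ.≤ i → ∣ approx (x n) i - approx (x n) (modulus n) ∣ ≤ inv (ι (suc n))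
    modulus-correct n i l = proj₂ (cauchy (x n) (inv (ι (suc n))) (0<inv (0<ι (s≤s z≤n)))) i _ l ℕₚ.≤-refl

  -- The n-th entry evaluates x n so far along its own modulus that the remaining error is at most
  -- 1/(n + 1).
  diagonal : ℕ → ℚ
  diagonal n = approx (x n) (modulus n)

  private
    near : ∀ {ε} → 0ℚ < ε → Ev (λ n → ∀ i → modulus n ℕ.≤ i → ∣ approx (x n) i - diagonal n ∣ ≤ ε)
    near 0<ε = Ev-map (λ n h i l → ≤-trans (modulus-correct n i l) h) (reciprocal-small 0<ε)

    far : ∀ a b c → (a ℕ.⊔ b ℕ.⊔ c ℕ.≤ a ℕ.⊔ b ℕ.⊔ c) → a ℕ.≤ a ℕ.⊔ b ℕ.⊔ c × b ℕ.≤ a ℕ.⊔ b ℕ.⊔ c × c ℕ.≤ a ℕ.⊔ b ℕ.⊔ c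
    far a b c h = ℕₚ.m⊔n≤o⇒m≤o a b (ℕₚ.m⊔n≤o⇒m≤o (a ℕ.⊔ b) c h) , ℕₚ.m⊔n≤o⇒n≤o a b (ℕₚ.m⊔n≤o⇒m≤o (a ℕ.⊔ b) c h) , ℕₚ.m⊔n≤o⇒n≤o (a ℕ.⊔ b) c h

  opaque
    diagonal-cauchy : IsCauchy diagonal
    diagonal-cauchy ε 0<ε =
      let (N₁ , h₁) = near (0<¼ 0<ε)
          (N₂ , h₂) = cx (¼ ε) (0<¼ 0<ε)
      in N₁ ℕ.⊔ N₂ , λ m n m≥ n≥ →
        let (I , hI) = h₂ m n (ℕₚ.m⊔n≤o⇒n≤o N₁ N₂ m≥) (ℕₚ.m⊔n≤o⇒n≤o N₁ N₂ n≥)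
            -- An auxiliary index at which x m and x n are both accurate and also close to each
            -- other.
            i = I ℕ.⊔ modulus m ℕ.⊔ modulus n
            (I≤i , m≤i , n≤i) = far I (modulus m) (modulus n) ℕₚ.≤-refl
        in ≤-trans (∣-∣-triangle (diagonal m) (approx (x n) i) (diagonal n)
             (∣-∣-triangle (diagonal m) (approx (x m) i) (approx (x n) i)
               (subst (_≤ ¼ ε) (∣p-q∣-comm (approx (x m) i) (diagonal m)) (h₁ m (ℕₚ.m⊔n≤o⇒m≤o N₁ N₂ m≥) i m≤i))
               (hI i I≤i))
             (h₁ n (ℕₚ.m⊔n≤o⇒m≤o N₁ N₂ n≥) i n≤i))
           (¼×3≤ 0<ε)

  limit : ℝ
  limit = mkℝ diagonal diagonal-cauchy

  limit-close : ∀ {ε} → 0ℚ < ε → Ev (λ n → Close ε (x n) limit)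
  limit-close {ε} 0<ε =
    let (N₁ , h₁) = near (0<¼ 0<ε)
        (N₂ , h₂) = cx (¼ ε) (0<¼ 0<ε)
    in N₂ , λ n n≥ →
      let (J , hJ) = cauchy (x n) (¼ ε) (0<¼ 0<ε)
      in J ℕ.⊔ (N₁ ℕ.⊔ N₂) , λ i i≥ →
        let N≤i = ℕₚ.m⊔n≤o⇒n≤o J (N₁ ℕ.⊔ N₂) i≥
            (I , hI) = h₂ n i n≥ (ℕₚ.m⊔n≤o⇒n≤o N₁ N₂ N≤i)
            j = J ℕ.⊔ I ℕ.⊔ modulus i
            (J≤j , I≤j , i≤j) = far J I (modulus i) ℕₚ.≤-refl
        in ≤-trans (∣-∣-triangle (approx (x n) i) (approx (x i) j) (diagonal i)
             (∣-∣-triangle (approx (x n) i) (approx (x n) j) (approx (x i) j)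
               (hJ i j (ℕₚ.m⊔n≤o⇒m≤o J (N₁ ℕ.⊔ N₂) i≥) J≤j)
               (hI j I≤j))
             (h₁ i (ℕₚ.m⊔n≤o⇒m≤o N₁ N₂ N≤i) j i≤j))
           (¼×3≤ 0<ε)

approx-∑ : ∀ n (a : ℕ → ℝ) i → approx (∑[ n ] a) i ≡ Σ n (λ m → approx (a m) i)
approx-∑ zero    a i = refl
approx-∑ (suc n) a i = cong (approx (a 0) i +_) (approx-∑ n (λ m → a (suc m)) i)

split-index : ∀ n {N} → n ℕ.≤ N → ∃[ m ] N ≡ n ℕ.+ m
split-index n {N} n≤N = N ℕ.∸ n , sym (ℕₚ.m+[n∸m]≡n n≤N)

common-bound : ∀ l (u : ℕ → ℕ → ℚ) → (∀ c → EventuallyBounded (u c)) →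
               ∃[ C ] (0ℚ ≤ C × Ev (λ i → ∀ c → c ℕ.< l → ∣ u c i ∣ ≤ C))
common-bound zero    u h = 0ℚ , ≤-refl , 0 , λ _ _ _ ()
common-bound (suc l) u h =
  let (B , B>0 , M , hB) = h 0
      (C , 0≤C , N , hC) = common-bound l (λ c → u (suc c)) (λ c → h (suc c))
      0≤B = <⇒≤ (positive⁻¹ B {{B>0}})
  in B + C , 0≤B ⊞ 0≤C , M ℕ.⊔ N , λ where
    i l≤ zero    _         → ≤-trans (hB i (ℕₚ.m⊔n≤o⇒m≤o M N l≤)) (by-diff 0≤C (p+q-p≡q B C))
    i l≤ (suc c) (s≤s c<l) → ≤-trans (hC i (ℕₚ.m⊔n≤o⇒n≤o M N l≤) c c<l) (by-diff 0≤B (p+q-q≡p B C))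

-- Arcs with rational ends and countable covers

fromℚ-mono : ∀ {p q} → p ≤ q → fromℚ p ≤ᵣ fromℚ q
fromℚ-mono {p} {q} h ε 0<ε = 0 , λ _ _ → by-diff (diff h ⊞ <⇒≤ 0<ε) (eq p q ε)
  where
  eq : ∀ p q ε → q + ε - p ≡ q - p + ε
  eq = solve-∀ ring

arc : (l u : ℚ) → l ≤ u → Arc
arc l u l≤u = record { lower = fromℚ l ; upper = fromℚ u ; lower≤upper = fromℚ-mono l≤u }

∈-intro : ∀ {l u} (l≤u : l ≤ u) x j {ρ} → 0ℚ < ρ →
          Ev (λ i → l + ρ ≤ approx x i + ζ j × approx x i + ζ j + ρ ≤ u) → x ∈ arc l u l≤u
∈-intro {l} {u} l≤u x j {ρ} 0<ρ ev = j ,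
  (ρ , 0<ρ , Ev-map (λ i (lo , _) → subst (λ z → l + ρ ≤ approx x i + z) (ζ≡/1 j) lo) ev) ,
  (ρ , 0<ρ , Ev-map (λ i (_ , up) → subst (λ z → approx x i + z + ρ ≤ u) (ζ≡/1 j) up) ev)

∈-elim : ∀ {l u} (l≤u : l ≤ u) q → fromℚ q ∈ arc l u l≤u → ∃[ j ] (l < q + ζ j × q + ζ j < u)
∈-elim {l} {u} l≤u q (j , (ρ , 0<ρ , N , lo) , (σ , 0<σ , M , up)) = j ,
  <-≤-trans (by-diff-< 0<ρ (p+q-p≡q l ρ)) (subst (λ z → l + ρ ≤ q + z) (sym (ζ≡/1 j)) (lo N ℕₚ.≤-refl)) ,
  <-≤-trans (by-diff-< 0<σ (p+q-p≡q (q + ζ j) σ)) (subst (λ z → q + z + σ ≤ u) (sym (ζ≡/1 j)) (up M ℕₚ.≤-refl))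

∑≤ : ∀ (w : ℕ → ℚ) n {q} → Σ n w ≤ q → ∑[ n ] (λ i → fromℚ (w i)) ≤ᵣ fromℚ q
∑≤ w n {q} h ε 0<ε = 0 , λ i _ → ≤-trans (≤-reflexive (approx-∑ n (λ i → fromℚ (w i)) i))
  (≤-trans h (by-diff (<⇒≤ 0<ε) (p+q-p≡q q ε)))

-- The body of `Null` at a single ε, named so that local definitions can have it as their type.
Covered : (Arc → ℝ → Set) → (ℝ → Set) → ℚ → Set
Covered Measure≤ A ε =
  Σ[ I ∈ (ℕ → Arc) ] Σ[ w ∈ (ℕ → ℝ) ]
    (∀ i → Measure≤ (I i) (w i)) ×
    (∀ n → ∑[ n ] w ≤ᵣ fromℚ ε) ×
    (∀ x → A x → ¬ ¬ (∃[ i ] x ∈ I i))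

cover : ∀ Measure≤ A {ε} (I : ℕ → Arc) (w : ℕ → ℚ) → (∀ i → Measure≤ (I i) (fromℚ (w i))) →
        (∀ n → Σ n w ≤ ε) → (∀ x → A x → ¬ ¬ (∃[ i ] x ∈ I i)) → Covered Measure≤ A ε
cover Measure≤ A I w measures total covers = I , (λ i → fromℚ (w i)) , measures , (λ n → ∑≤ w n (total n)) , covers

-- Trapezoidal test functions on the circle

opaque
  clamp : ℚ → ℚ
  clamp u with u ≤? 0ℚ | 1ℚ ≤? u
  ... | yes _ | _     = 0ℚ
  ... | no  _ | yes _ = 1ℚ
  ... | no  _ | no  _ = u

  0≤clamp : ∀ u → 0ℚ ≤ clamp u
  0≤clamp u with u ≤? 0ℚ | 1ℚ ≤? u
  ... | yes _   | _     = ≤-refl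
  ... | no  _   | yes _ = 0≤1
  ... | no  u≰0 | no  _ = <⇒≤ (≰⇒> u≰0)

  clamp≤1 : ∀ u → clamp u ≤ 1ℚ
  clamp≤1 u with u ≤? 0ℚ | 1ℚ ≤? u
  ... | yes _ | _       = 0≤1
  ... | no  _ | yes _   = ≤-refl
  ... | no  _ | no  1≰u = <⇒≤ (≰⇒> 1≰u)

  clamp-low : ∀ u → clamp u ≤ 0ℚ ⊎ clamp u ≤ u × 0ℚ < u
  clamp-low u with u ≤? 0ℚ | 1ℚ ≤? u
  ... | yes _   | _       = inj₁ ≤-refl
  ... | no  u≰0 | yes 1≤u = inj₂ (1≤u , ≰⇒> u≰0)
  ... | no  u≰0 | no  _   = inj₂ (≤-refl , ≰⇒> u≰0)

  clamp-high : ∀ u → 1ℚ ≤ clamp u ⊎ u ≤ clamp u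
  clamp-high u with u ≤? 0ℚ | 1ℚ ≤? u
  ... | yes u≤0 | _     = inj₂ u≤0
  ... | no  _   | yes _ = inj₁ ≤-refl
  ... | no  _   | no  _ = inj₂ ≤-refl

1≤clamp : ∀ {u} → 1ℚ ≤ u → 1ℚ ≤ clamp u
1≤clamp {u} 1≤u with clamp-high u
... | inj₁ h = h
... | inj₂ h = ≤-trans 1≤u h

clamp-mono : ∀ {u v r} → 0ℚ ≤ r → u ≤ v + r → clamp u ≤ clamp v + r
clamp-mono {u} {v} {r} 0≤r h with clamp-low u | clamp-high v
... | inj₁ l       | _      = ≤-trans l (0≤clamp v ⊞ 0≤r)
... | inj₂ _       | inj₁ k = ≤-trans (clamp≤1 u) (by-diff (diff k ⊞ 0≤r) (eq (clamp v) r))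
  where
  eq : ∀ c r → c + r - 1ℚ ≡ c - 1ℚ + r
  eq = solve-∀ ring
... | inj₂ (l , _) | inj₂ k = ≤-trans l (≤-trans h (+-monoˡ-≤ r k))

clamp-lipschitz : ∀ u v {r} → ∣ u - v ∣ ≤ r → ∣ clamp u - clamp v ∣ ≤ r
clamp-lipschitz u v {r} h = ≤⇒∣-∣≤ (clamp-mono {u} {v} 0≤r (∣-∣≤⇒≤ {u} {v} h)) (clamp-mono {v} {u} 0≤r (∣-∣≤⇒≥ {u} {v} h))
  where
  0≤r : 0ℚ ≤ r
  0≤r = ≤-trans (0≤∣p∣ (u - v)) h

-- Only the floor f and f + 1 compete: an integer up to f is no closer than f, and a larger one is
-- no closer than f + 1.
nearest : ∀ t → ∃[ j ] (∀ i → ∣ t - ζ j ∣ ≤ ∣ t - ζ i ∣)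
nearest t = choose (≤-total (t - ζ f) (ζ f + 1ℚ - t))
  where
  f = proj₁ (floor-bounds t)
  f≤t : ζ f ≤ t
  f≤t = proj₁ (proj₂ (floor-bounds t))
  t<f+1 : t < ζ f + 1ℚ
  t<f+1 = proj₂ (proj₂ (floor-bounds t))
  ∣t-f∣ : ∣ t - ζ f ∣ ≡ t - ζ f
  ∣t-f∣ = 0≤p⇒∣p∣≡p (diff f≤t)
  ∣t-f-1∣ : ∣ t - ζ (ℤ.suc f) ∣ ≡ ζ f + 1ℚ - t
  ∣t-f-1∣ = trans (cong (λ z → ∣ t - z ∣) (ζ-suc f)) (trans (∣p-q∣-comm t (ζ f + 1ℚ)) (0≤p⇒∣p∣≡p (diff (<⇒≤ t<f+1))))
  either : ∀ i → t - ζ f ≤ ∣ t - ζ i ∣ ⊎ ζ f + 1ℚ - t ≤ ∣ t - ζ i ∣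
  either i with ℤₚ.≤-total i f
  ... | inj₁ i≤f = inj₁ (≤-trans (+-monoʳ-≤ t (neg-antimono-≤ (ζ-mono-≤ i≤f))) (p≤∣p∣ (t - ζ i)))
  ... | inj₂ f≤i with i ℤₚ.≟ f
  ...   | yes refl = inj₁ (≤-reflexive (sym ∣t-f∣))
  ...   | no  i≢f  = inj₂ (≤-trans (+-monoˡ-≤ (- t) (subst (_≤ ζ i) (ζ-suc f) (ζ-mono-≤ (ℤₚ.i<j⇒suc[i]≤j (ℤₚ.≤∧≢⇒< f≤i (λ e → i≢f (sym e)))))))
            (≤-trans (p≤∣p∣ (ζ i - t)) (≤-reflexive (∣p-q∣-comm (ζ i) t))))
  choose : t - ζ f ≤ ζ f + 1ℚ - t ⊎ ζ f + 1ℚ - t ≤ t - ζ f → ∃[ j ] (∀ i → ∣ t - ζ j ∣ ≤ ∣ t - ζ i ∣)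
  choose (inj₁ h) = f , λ i → ≤-trans (≤-reflexive ∣t-f∣) (min (either i))
    where
    min : ∀ {s} → t - ζ f ≤ s ⊎ ζ f + 1ℚ - t ≤ s → t - ζ f ≤ s
    min (inj₁ l) = l
    min (inj₂ l) = ≤-trans h l
  choose (inj₂ h) = ℤ.suc f , λ i → ≤-trans (≤-reflexive ∣t-f-1∣) (min (either i))
    where
    min : ∀ {s} → t - ζ f ≤ s ⊎ ζ f + 1ℚ - t ≤ s → ζ f + 1ℚ - t ≤ s
    min (inj₁ l) = ≤-trans h l
    min (inj₂ l) = l

opaque
  -- The distance from t to the nearest integer, that is, the norm of t on the circle.
  dist : ℚ → ℚ
  dist t = ∣ t - ζ (proj₁ (nearest t)) ∣

  dist≤ : ∀ t i → dist t ≤ ∣ t - ζ i ∣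
  dist≤ t = proj₂ (nearest t)

  dist-attained : ∀ t → ∃[ j ] dist t ≡ ∣ t - ζ j ∣
  dist-attained t = proj₁ (nearest t) , refl

dist-mono : ∀ s t {r} → ∣ s - t ∣ ≤ r → dist s ≤ dist t + r
dist-mono s t {r} h = let (j , e) = dist-attained t in
  ≤-trans (dist≤ s j) (≤-trans (∣-∣-triangle s t (ζ j) h ≤-refl) (≤-reflexive (trans (+-comm r _) (cong (_+ r) (sym e)))))

dist-lipschitz : ∀ s t {r} → ∣ s - t ∣ ≤ r → ∣ dist s - dist t ∣ ≤ r
dist-lipschitz s t {r} h = ≤⇒∣-∣≤ (dist-mono s t h) (dist-mono t s (subst (_≤ r) (∣p-q∣-comm s t) h))

dist-shift : ∀ t j → dist (t + ζ j) ≤ dist t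
dist-shift t j = let (i , e) = dist-attained t in
  ≤-trans (dist≤ (t + ζ j) (i ℤ.+ j)) (≤-reflexive (trans (cong ∣_∣ (trans (cong (λ z → t + ζ j - z) (ζ-+ i j)) (eq t (ζ i) (ζ j)))) (sym e)))
  where
  eq : ∀ t i j → t + j - (i + j) ≡ t - i
  eq = solve-∀ ring

dist-periodic : ∀ t → dist (t + 1ℚ) ≡ dist t
dist-periodic t = ≤-antisym (subst (λ z → dist (t + z) ≤ dist t) ι1 (dist-shift t (ℤ.+ 1)))
  (≤-trans (≤-reflexive (cong dist (trans (eq t) (cong (λ z → t + 1ℚ + z) (sym ζ-1))))) (dist-shift (t + 1ℚ) (ℤ.- (ℤ.+ 1))))
  where
  ζ-1 : ζ (ℤ.- (ℤ.+ 1)) ≡ - 1ℚ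
  ζ-1 = ζ≡/1 (ℤ.- (ℤ.+ 1))
  eq : ∀ t → t ≡ t + 1ℚ + - 1ℚ
  eq = solve-∀ ring

-- A periodic function which is 1 on [- ½ δ , q + ½ δ] and vanishes outside (- δ , q + δ) modulo 1.
module Trapezoid (q δ : ℚ) (0<δ : 0ℚ < δ) where
  private
    D : ℚ
    D = inv (½ * δ)

    0<½δ : 0ℚ < ½ * δ
    0<½δ = 0<½* 0<δ

    0<D : 0ℚ < D
    0<D = 0<inv 0<½δ

    D*½δ : D * (½ * δ) ≡ 1ℚ
    D*½δ = trans (*-comm D (½ * δ)) (*-inv 0<½δ)

  -- Measured from the midpoint ½ q of [0, q], the ramp falls from 1 at circle distance ½ q + ½ δ to
  -- 0 at distance ½ q + δ.
  slope : ℚ → ℚ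
  slope t = D * (½ * q + δ - dist (t - ½ * q))

  trapezoid : ℚ → ℚ
  trapezoid t = clamp (slope t)

  0≤trapezoid : ∀ t → 0ℚ ≤ trapezoid t
  0≤trapezoid t = 0≤clamp (slope t)

  trapezoid≤1 : ∀ t → trapezoid t ≤ 1ℚ
  trapezoid≤1 t = clamp≤1 (slope t)

  trapezoid-lipschitz : ∀ s t {r} → ∣ s - t ∣ ≤ r → ∣ trapezoid s - trapezoid t ∣ ≤ D * r
  trapezoid-lipschitz s t {r} h = clamp-lipschitz (slope s) (slope t)
    (≤-trans (≤-reflexive (trans (cong ∣_∣ (eq D (½ * q + δ) (dist (s - ½ * q)) (dist (t - ½ * q))))
        (trans (∣p*q∣≡∣p∣*∣q∣ D (dist (t - ½ * q) - dist (s - ½ * q))) (cong₂ _*_ (0≤p⇒∣p∣≡p (<⇒≤ 0<D)) (∣p-q∣-comm (dist (t - ½ * q)) (dist (s - ½ * q)))))))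
      (*-mono-≤ˡ (<⇒≤ 0<D) (dist-lipschitz (s - ½ * q) (t - ½ * q) (≤-trans (≤-reflexive (cong ∣_∣ (eq′ s t (½ * q)))) h))))
    where
    eq : ∀ D a x y → D * (a - x) - D * (a - y) ≡ D * (y - x)
    eq = solve-∀ ring
    eq′ : ∀ s t c → (s - c) - (t - c) ≡ s - t
    eq′ = solve-∀ ring

  trapezoid-periodic : ∀ t → trapezoid (t + 1ℚ) ≡ trapezoid t
  trapezoid-periodic t = cong (λ z → clamp (D * (½ * q + δ - z))) (trans (cong dist (eq t (½ * q))) (dist-periodic (t - ½ * q)))
    where
    eq : ∀ t c → t + 1ℚ - c ≡ t - c + 1ℚ
    eq = solve-∀ ring

  trapezoid-plateau : ∀ t → - (½ * δ) ≤ t → t ≤ q + ½ * δ → 1ℚ ≤ trapezoid t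
  trapezoid-plateau t lo up = 1≤clamp (≤-trans (≤-reflexive (sym D*½δ)) (*-mono-≤ˡ (<⇒≤ 0<D)
    (by-diff (diff dist≤′) (eq q δ (dist (t - ½ * q))))))
    where
    dist≤′ : dist (t - ½ * q) ≤ ½ * q + ½ * δ
    dist≤′ = ≤-trans (dist≤ (t - ½ * q) (ℤ.+ 0)) (≤-trans (≤-reflexive (cong (λ z → ∣ t - ½ * q - z ∣) ι0)) (∣p∣≤
      (by-diff (diff up) (eq₁ t q δ)) (by-diff (diff lo) (eq₂ t q δ))))
      where
      eq₁ : ∀ t q δ → ½ * q + ½ * δ - (t - ½ * q - 0ℚ) ≡ q + ½ * δ - t
      eq₁ = solve-∀ ring
      eq₂ : ∀ t q δ → ½ * q + ½ * δ - (- (t - ½ * q - 0ℚ)) ≡ t - (- (½ * δ))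
      eq₂ = solve-∀ ring
    eq : ∀ q δ d → ½ * q + δ - d - ½ * δ ≡ ½ * q + ½ * δ - d
    eq = solve-∀ ring

  trapezoid-support : ∀ t → trapezoid t ≤ 0ℚ ⊎ ∃[ j ] (- δ < t - ζ j × t - ζ j < q + δ)
  trapezoid-support t with clamp-low (slope t)
  ... | inj₁ h = inj₁ h
  ... | inj₂ (_ , 0<slope) = inj₂ (near (dist-attained (t - ½ * q)))
    where
    0<gap : 0ℚ < ½ * q + δ - dist (t - ½ * q)
    0<gap = *-cancel-<ʳ 0<D (subst₂ _<_ (sym (*-zeroˡ D)) (*-comm D _) 0<slope)
    near : ∃[ j ] dist (t - ½ * q) ≡ ∣ t - ½ * q - ζ j ∣ → ∃[ j ] (- δ < t - ζ j × t - ζ j < q + δ)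
    near (j , e) = j ,
      by-diff-< {r = ½ * q + δ - a + (a - (- u))} (gap (diff (-p≤∣p∣ u))) (eq₁ t q δ (ζ j) a) ,
      by-diff-< {r = ½ * q + δ - a + (a - u)} (gap (diff (p≤∣p∣ u))) (eq₂ t q δ (ζ j) a)
      where
      u = t - ½ * q - ζ j
      a = ∣ u ∣
      gap : ∀ {s} → 0ℚ ≤ s → 0ℚ < ½ * q + δ - a + s
      gap 0≤s = <-≤-trans (subst (λ z → 0ℚ < ½ * q + δ - z) e 0<gap) (by-diff 0≤s (p+q-p≡q (½ * q + δ - a) _))
      eq₁ : ∀ t q δ j a → t - j - (- δ) ≡ ½ * q + δ - a + (a - (- (t - ½ * q - j)))
      eq₁ = solve-∀ ring
      eq₂ : ∀ t q δ j a → q + δ - (t - j) ≡ ½ * q + δ - a + (a - (t - ½ * q - j))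
      eq₂ = solve-∀ ring

  opaque
    trapezoid-cauchy : ∀ u → IsCauchy u → IsCauchy (λ n → trapezoid (u n))
    trapezoid-cauchy u cu ε 0<ε = let (N , H) = cu (½ * δ * ε) (0<* 0<½δ 0<ε) in
      N , λ m n m≥ n≥ → ≤-trans (trapezoid-lipschitz (u m) (u n) (H m n m≥ n≥))
        (≤-reflexive (trans (sym (*-assoc D (½ * δ) ε)) (trans (cong (_* ε) D*½δ) (*-identityˡ ε))))

    -- The bound is δ′ + δ′ because a real inequality with right-hand side δ′, taken at tolerance
    -- δ′, gives no more than this for the approximations.
    trapezoid-uc : ∀ ε → 0ℚ < ε → ∃[ δ′ ] (0ℚ < δ′ × (∀ s t → ∣ s - t ∣ ≤ δ′ + δ′ → ∣ trapezoid s - trapezoid t ∣ ≤ ε))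
    trapezoid-uc ε 0<ε = ½ * (½ * δ * ε) , 0<½* (0<* 0<½δ 0<ε) , λ s t h →
      ≤-trans (trapezoid-lipschitz s t (≤-trans h (≤-reflexive (½+½ (½ * δ * ε)))))
        (≤-reflexive (trans (sym (*-assoc D (½ * δ) ε)) (trans (cong (_* ε) D*½δ) (*-identityˡ ε))))

  bump : C⟨𝕋⟩
  bump = record
    { apply    = λ x → mkℝ (λ n → trapezoid (approx x n)) (trapezoid-cauchy (approx x) (cauchy x))
    ; periodic = λ x ε 0<ε → 0 , λ n _ → ≤-trans (≤-reflexive (trans (cong (λ z → ∣ z - trapezoid (approx x n) ∣) (trapezoid-periodic (approx x n)))
        (cong ∣_∣ (+-inverseʳ (trapezoid (approx x n)))))) (<⇒≤ 0<ε)
    ; uniformlyContinuous = λ ε 0<ε → let (δ′ , 0<δ′ , H) = trapezoid-uc ε 0<ε in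
        δ′ , 0<δ′ , λ x y h ε′ 0<ε′ → Ev-map (λ n l → ≤-trans (H (approx x n) (approx y n) l) (by-diff (<⇒≤ 0<ε′) (p+q-p≡q ε ε′))) (h δ′ 0<δ′)
    }

-- decode lists the pairs (m , c) with c < l m.
module Lexicographic (l : ℕ → ℕ) (1≤l : ∀ m → 1 ℕ.≤ l m) where
  next′ : ∀ m c → Dec (suc c ℕ.< l m) → ℕ × ℕ
  next′ m c (yes _) = m , suc c
  next′ m c (no _)  = suc m , 0

  next : ℕ × ℕ → ℕ × ℕ
  next (m , c) = next′ m c (suc c ℕₚ.<? l m)

  decode : ℕ → ℕ × ℕ
  decode zero    = 0 , 0
  decode (suc i) = next (decode i)

  next-bound : ∀ p → proj₂ p ℕ.< l (proj₁ p) → proj₂ (next p) ℕ.< l (proj₁ (next p))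
  next-bound (m , c) _ with suc c ℕₚ.<? l m
  ... | yes h = h
  ... | no _  = 1≤l (suc m)

  decode-bound : ∀ i → proj₂ (decode i) ℕ.< l (proj₁ (decode i))
  decode-bound zero    = 1≤l 0
  decode-bound (suc i) = next-bound (decode i) (decode-bound i)

  next-inside : ∀ m c → suc c ℕ.< l m → next (m , c) ≡ (m , suc c)
  next-inside m c h with suc c ℕₚ.<? l m
  ... | yes _ = refl
  ... | no h′ = ⊥-elim (h′ h)

  next-end : ∀ m c → suc c ≡ l m → next (m , c) ≡ (suc m , 0)
  next-end m c h with suc c ℕₚ.<? l m
  ... | yes h′ = ⊥-elim (ℕₚ.<-irrefl h h′)
  ... | no _   = refl

  decode-surjective : ∀ m c → c ℕ.< l m → ∃[ i ] decode i ≡ (m , c)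
  decode-surjective zero    zero    _ = 0 , refl
  decode-surjective (suc m) zero    _ = after (l m) refl (1≤l m)
    where
    after : ∀ lm → lm ≡ l m → 1 ℕ.≤ lm → ∃[ i ] decode i ≡ (suc m , 0)
    after (suc c) e _ = let (i , h) = decode-surjective m c (subst (c ℕ.<_) e ℕₚ.≤-refl) in
      suc i , trans (cong next h) (next-end m c e)
  decode-surjective m       (suc c) h = let (i , h′) = decode-surjective m c (ℕₚ.<-trans (ℕₚ.n<1+n c) h) in
    suc i , trans (cong next h′) (next-inside m c h)

  module _ (w : ℕ → ℕ → ℚ) where
    block : ℕ → ℚ
    block m = Σ (l m) (w m)

    w∘decode : ℕ → ℚ
    w∘decode i = w (proj₁ (decode i)) (proj₂ (decode i))

    partial : ℕ × ℕ → ℚ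
    partial (m , c) = Σ m block + Σ c (w m)

    partial-next : ∀ p → proj₂ p ℕ.< l (proj₁ p) → partial (next p) ≡ partial p + w (proj₁ p) (proj₂ p)
    partial-next (m , c) c<l with suc c ℕₚ.<? l m
    ... | yes _ = trans (cong (Σ m block +_) (Σ-last c (w m))) (sym (+-assoc (Σ m block) _ _))
    ... | no h  = trans (+-identityʳ _) (trans (Σ-last m block) (trans
          (cong (Σ m block +_) (trans (cong (λ z → Σ z (w m)) (ℕₚ.≤-antisym (ℕₚ.≮⇒≥ h) c<l)) (Σ-last c (w m)))) (sym (+-assoc (Σ m block) _ _))))

    Σ-decode : ∀ i → Σ i w∘decode ≡ partial (decode i)
    Σ-decode zero    = sym (+-identityʳ 0ℚ)
    Σ-decode (suc i) = trans (Σ-last i w∘decode) (trans (cong (_+ w∘decode i) (Σ-decode i)) (sym (partial-next (decode i) (decode-bound i))))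

    -- A partial sum along the listing consists of whole blocks and a prefix of the next one;
    -- nonnegativity allows this prefix to be completed.
    Σ-decode≤ : (∀ m c → 0ℚ ≤ w m c) → ∀ {q} → (∀ m → Σ m block ≤ q) → ∀ i → Σ i w∘decode ≤ q
    Σ-decode≤ 0≤w {q} h i = ≤-trans (≤-reflexive (Σ-decode i)) (≤-trans
      (+-monoʳ-≤ (Σ m block) (prefix (l m) c (ℕₚ.<⇒≤ (decode-bound i))))
      (≤-trans (≤-reflexive (sym (Σ-last m block))) (h (suc m))))
      where
      m = proj₁ (decode i)
      c = proj₂ (decode i)
      prefix : ∀ n c → c ℕ.≤ n → Σ c (w m) ≤ Σ n (w m)
      prefix n c c≤n = subst (λ z → Σ c (w m) ≤ Σ z (w m)) (ℕₚ.m+[n∸m]≡n c≤n)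
        (≤-trans (≤-reflexive (sym (+-identityʳ _))) (≤-trans (+-monoʳ-≤ (Σ c (w m)) (Σ-nonneg (n ℕ.∸ c) (λ i _ → 0≤w m (c ℕ.+ i))))
          (≤-reflexive (sym (Σ-++ c (n ℕ.∸ c) (w m))))))

module Ghost (k : ℕ) .{{k≥2 : NonTrivial k}} where

  -- Sums of the Zaremba sequence over the integers with a given leading part

  instance
    k≢0 : NonZero k
    k≢0 = ℕ.nonTrivial⇒nonZero k

  1<k : 1 ℕ.< k
  1<k = ℕ.nonTrivial⇒n>1 k

  1≤k : 1 ℕ.≤ k
  1≤k = ℕₚ.<⇒≤ 1<k

  1≤k^ : ∀ n → 1 ℕ.≤ k ℕ.^ n
  1≤k^ n = ℕₚ.m^n>0 k n

  -- The two entries of the row vector (1 0) B i_s ⋯ B i_0. The list begins with the least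
  -- significant digit, so each recursion step multiplies by the rightmost matrix.
  continuant continuant′ : List ℕ → ℕ
  continuant []        = 1
  continuant (i ∷ ds)  = (i ℕ.+ 1) ℕ.* continuant ds ℕ.+ continuant′ ds
  continuant′ []       = 0
  continuant′ (i ∷ ds) = continuant ds

  foldl-continuant : ∀ ds a b → e₁ · foldl (λ v i → B i ·ᵥ v) (a Vec.∷ b Vec.∷ Vec.[]) ds ≡
                     a ℕ.* continuant ds ℕ.+ b ℕ.* continuant′ ds
  foldl-continuant [] a b = eq a b
    where
    eq : ∀ a b → 1 ℕ.* a ℕ.+ (0 ℕ.* b ℕ.+ 0) ≡ a ℕ.* 1 ℕ.+ b ℕ.* 0
    eq = ℕ-Solver.solve-∀
  foldl-continuant (i ∷ ds) a b =
    trans (foldl-continuant ds _ _) (eq a b i (continuant ds) (continuant′ ds))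
    where
    eq : ∀ a b i p q → ((i ℕ.+ 1) ℕ.* a ℕ.+ (1 ℕ.* b ℕ.+ 0)) ℕ.* p ℕ.+ (1 ℕ.* a ℕ.+ (0 ℕ.* b ℕ.+ 0)) ℕ.* q
         ≡ a ℕ.* ((i ℕ.+ 1) ℕ.* p ℕ.+ q) ℕ.+ b ℕ.* p
    eq = ℕ-Solver.solve-∀

  zaremba≡continuant : ∀ m → zaremba k m ≡ continuant (digits k m)
  zaremba≡continuant m = trans (foldl-continuant (digits k m) 1 0) (eq (continuant (digits k m)) (continuant′ (digits k m)))
    where
    eq : ∀ p q → 1 ℕ.* p ℕ.+ 0 ℕ.* q ≡ p
    eq = ℕ-Solver.solve-∀

  -- Peeling off one digit leaves the quotient with more fuel than `digits` gives it, hence the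
  -- comparison of two sufficient amounts.
  digitsUpTo-fuel : ∀ l l′ m → m ℕ.≤ l → m ℕ.≤ l′ → digitsUpTo l k m ≡ digitsUpTo l′ k m
  digitsUpTo-fuel zero    zero     m       _ _ = refl
  digitsUpTo-fuel zero    (suc l′) zero    _ _ = refl
  digitsUpTo-fuel (suc l) zero     zero    _ _ = refl
  digitsUpTo-fuel (suc l) (suc l′) zero    _ _ = refl
  digitsUpTo-fuel (suc l) (suc l′) m@(suc _) h h′ =
    cong (m ℕ.% k ∷_) (digitsUpTo-fuel l l′ (m ℕ./ k) (bound h) (bound h′))
    where
    bound : ∀ {l} → m ℕ.≤ suc l → m ℕ./ k ℕ.≤ l
    bound h = ℕₚ.≤-pred (ℕₚ.<-≤-trans (ℕ.m/n<m m k 1<k) h)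

  digits-step : ∀ m .{{_ : NonZero m}} → digits k m ≡ m ℕ.% k ∷ digits k (m ℕ./ k)
  digits-step m@(suc l) = cong (m ℕ.% k ∷_)
    (digitsUpTo-fuel l (m ℕ./ k) (m ℕ./ k) (ℕₚ.≤-pred (ℕ.m/n<m m k 1<k)) ℕₚ.≤-refl)

  [c*k+i]%k : ∀ c {i} → i ℕ.< k → (c ℕ.* k ℕ.+ i) ℕ.% k ≡ i
  [c*k+i]%k c {i} i<k = trans (cong (ℕ._% k) (ℕₚ.+-comm (c ℕ.* k) i))
    (trans (ℕ.[m+kn]%n≡m%n i c k) (ℕ.m<n⇒m%n≡m i<k))

  [c*k+i]/k : ∀ c {i} → i ℕ.< k → (c ℕ.* k ℕ.+ i) ℕ./ k ≡ c
  [c*k+i]/k c {i} i<k = trans (ℕ.+-distrib-/-∣ˡ {c ℕ.* k} i {k} (n∣m*n c))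
    (trans (cong₂ ℕ._+_ (ℕ.m*n/n≡m c k) (ℕ.m<n⇒m/n≡0 i<k)) (ℕₚ.+-identityʳ c))

  digits-snoc : ∀ c {i} → 1 ℕ.≤ c → i ℕ.< k → digits k (c ℕ.* k ℕ.+ i) ≡ i ∷ digits k c
  digits-snoc c {i} 1≤c i<k = trans (digits-step (c ℕ.* k ℕ.+ i) {{ℕ.>-nonZero positive′}})
    (cong₂ (λ j m → j ∷ digits k m) ([c*k+i]%k c i<k) ([c*k+i]/k c i<k))
    where
    positive′ : 0 ℕ.< c ℕ.* k ℕ.+ i
    positive′ = ℕₚ.<-≤-trans (ℕₚ.*-mono-≤ 1≤c 1≤k) (ℕₚ.m≤m+n (c ℕ.* k) i)

  -- The matrix B 0 + ⋯ + B (k - 1) has the rows (T , K) and (K , 0).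
  K T : ℚ
  K = ι k
  T = ½ * (K * (K + 1ℚ))

  2≤K : 1ℚ + 1ℚ ≤ K
  2≤K = subst (_≤ K) (trans (ι-suc 1) (cong (1ℚ +_) ι1)) (ι-mono 1<k)

  0≤K : 0ℚ ≤ K
  0≤K = 0≤ι k

  0≤K-2 : 0ℚ ≤ K - (1ℚ + 1ℚ)
  0≤K-2 = diff 2≤K

  0≤T : 0ℚ ≤ T
  0≤T = <⇒≤ 0<½ ⊠ (0≤K ⊠ (0≤K ⊞ 0≤1))

  opaque
    -- For m ≥ 1, `Y m` is the value of the sequence at ⌊m/k⌋.
    Z Y : ℕ → ℚ
    Z m = ι (zaremba k m)
    Y m = ι (continuant′ (digits k m))

    Z≡ : ∀ m → Z m ≡ ι (zaremba k m)
    Z≡ m = refl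

    0≤Y : ∀ c → 0ℚ ≤ Y c
    0≤Y c = 0≤ι (continuant′ (digits k c))

    Z-snoc : ∀ c i → 1 ℕ.≤ c → i ℕ.< k → Z (c ℕ.* k ℕ.+ i) ≡ (ι i + 1ℚ) * Z c + Y c
    Z-snoc c i 1≤c i<k = trans (cong ι (trans (zaremba≡continuant (c ℕ.* k ℕ.+ i)) (cong continuant (digits-snoc c 1≤c i<k))))
      (trans (ι-+ _ (continuant′ (digits k c))) (cong (_+ Y c)
        (trans (ι-* (i ℕ.+ 1) (continuant (digits k c)))
          (cong₂ _*_ (trans (ι-+ i 1) (cong (ι i +_) ι1)) (cong ι (sym (zaremba≡continuant c)))))))

    Y-snoc : ∀ c i → 1 ℕ.≤ c → i ℕ.< k → Y (c ℕ.* k ℕ.+ i) ≡ Z c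
    Y-snoc c i 1≤c i<k = trans (cong (λ ds → ι (continuant′ ds)) (digits-snoc c 1≤c i<k))
      (cong ι (sym (zaremba≡continuant c)))

    1≤Z : ∀ c → 1ℚ ≤ Z c
    1≤Z c = 1≤ι (Defs.0<zaremba k c)

    Y≤Z : ∀ c → 1 ℕ.≤ c → Y c ≤ Z c
    Y≤Z c 1≤c = subst (_≤ Z c) refl (ι-mono (subst₂ ℕ._≤_ (cong continuant′ (sym step))
      (trans (cong continuant (sym step)) (sym (zaremba≡continuant c))) (grow (c ℕ.% k) (digits k (c ℕ./ k)))))
      where
      step : digits k c ≡ c ℕ.% k ∷ digits k (c ℕ./ k)
      step = digits-step c {{ℕ.>-nonZero 1≤c}}
      grow : ∀ i ds → continuant′ (i ∷ ds) ℕ.≤ continuant (i ∷ ds)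
      grow i ds = ℕₚ.≤-trans (ℕₚ.m≤n*m (continuant ds) (i ℕ.+ 1) {{ℕ.>-nonZero (ℕₚ.m≤n+m 1 i)}}) (ℕₚ.m≤m+n _ _)

  0<Z : ∀ c → 0ℚ < Z c
  0<Z c = <-≤-trans 0<1 (1≤Z c)

  0≤Z : ∀ c → 0ℚ ≤ Z c
  0≤Z c = <⇒≤ (0<Z c)

  -- (a m , b m) is the first column of (B 0 + ⋯ + B (k - 1))ᵐ.
  a b : ℕ → ℚ
  a zero    = 1ℚ
  a (suc m) = T * a m + K * b m
  b zero    = 0ℚ
  b (suc m) = K * a m

  0≤b : ∀ m → 0ℚ ≤ b m
  1≤a : ∀ m → 1ℚ ≤ a m
  0≤a : ∀ m → 0ℚ ≤ a m
  0≤a m = ≤-trans 0≤1 (1≤a m)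
  0≤b zero    = ≤-refl
  0≤b (suc m) = 0≤K ⊠ 0≤a m
  K≤T : K ≤ T
  K≤T = by-diff {r = ½ * (K * (K - (1ℚ + 1ℚ)) + K)} (<⇒≤ 0<½ ⊠ (0≤K ⊠ 0≤K-2 ⊞ 0≤K)) (eq K)
    where
    eq : ∀ K → ½ * (K * (K + 1ℚ)) - K ≡ ½ * (K * (K - (1ℚ + 1ℚ)) + K)
    eq = solve-∀ ring
  1≤T : 1ℚ ≤ T
  1≤T = ≤-trans (1≤ι 1≤k) K≤T
  1≤a zero    = ≤-refl
  1≤a (suc m) = ≤-trans (*-mono-≤ {1ℚ} {T} {1ℚ} {a m} 0≤1 (0≤a m) 1≤T (1≤a m))
    (by-diff (0≤K ⊠ 0≤b m) (p+q-p≡q (T * a m) (K * b m)))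

  b≤a : ∀ m → b m ≤ a m
  b≤a zero    = 0≤1
  b≤a (suc m) = by-diff (diff (*-mono-≤ʳ (0≤a m) K≤T) ⊞ 0≤K ⊠ 0≤b m) (eq T K (a m) (b m))
    where
    eq : ∀ T K a b → T * a + K * b - K * a ≡ T * a - K * a + K * b
    eq = solve-∀ ring

  -- The sum of z over the kᵐ integers with leading part c and m further digits.
  S : ℕ → ℕ → ℚ
  S c m = a m * Z c + b m * Y c

  0<S : ∀ c m → 0ℚ < S c m
  0<S c m = <-≤-trans (<-≤-trans 0<1 (*-mono-≤ {1ℚ} {a m} {1ℚ} {Z c} 0≤1 (0≤Z c) (1≤a m) (1≤Z c)))
    (by-diff (0≤b m ⊠ 0≤Y c) (p+q-p≡q (a m * Z c) (b m * Y c)))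

  0≤S : ∀ c m → 0ℚ ≤ S c m
  0≤S c m = <⇒≤ (0<S c m)

  S-snoc : ∀ c i m → 1 ℕ.≤ c → i ℕ.< k → S (c ℕ.* k ℕ.+ i) m ≡ a m * ((ι i + 1ℚ) * Z c + Y c) + b m * Z c
  S-snoc c i m 1≤c i<k = cong₂ (λ z y → a m * z + b m * y) (Z-snoc c i 1≤c i<k) (Y-snoc c i 1≤c i<k)

  Σ-digits : ∀ n → Σ n (λ i → ι i + 1ℚ) ≡ ½ * (ι n * (ι n + 1ℚ))
  Σ-digits zero    = trans (eq 0ℚ) (cong (λ x → ½ * (x * (x + 1ℚ))) (sym ι0))
    where
    eq : ∀ (x : ℚ) → 0ℚ ≡ ½ * (0ℚ * (0ℚ + 1ℚ))
    eq = solve-∀ ring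
  Σ-digits (suc n) = trans (Σ-last n _) (trans (cong (_+ (ι n + 1ℚ)) (Σ-digits n))
    (trans (eq (ι n)) (cong (λ x → ½ * (x * (x + 1ℚ))) (sym (ι-suc n)))))
    where
    eq : ∀ n → ½ * (n * (n + 1ℚ)) + (n + 1ℚ) ≡ ½ * ((1ℚ + n) * (1ℚ + n + 1ℚ))
    eq = solve-∀ ring

  -- Both Z and Y of a child are linear in Z c and Y c, so summing over the digit applies the matrix
  -- with entries T and K once more.
  S-children : ∀ c m → 1 ℕ.≤ c → Σ k (λ i → S (c ℕ.* k ℕ.+ i) m) ≡ S c (suc m)
  S-children c m 1≤c = trans (Σ-cong k step)
    (trans (Σ-+ k (λ i → (ι i + 1ℚ) * (a m * Z c)) (λ _ → a m * Y c + b m * Z c))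
    (trans (cong₂ _+_ (trans (Σ-*ʳ k (a m * Z c) (λ i → ι i + 1ℚ)) (cong (_* (a m * Z c)) (Σ-digits k)))
                      (Σ-const k (a m * Y c + b m * Z c)))
      (eq T K (a m) (b m) (Z c) (Y c))))
    where
    step : ∀ i → i ℕ.< k → S (c ℕ.* k ℕ.+ i) m ≡ (ι i + 1ℚ) * (a m * Z c) + (a m * Y c + b m * Z c)
    step i i<k = trans (S-snoc c i m 1≤c i<k) (eq′ (a m) (b m) (ι i) (Z c) (Y c))
      where
      eq′ : ∀ a b i z y → a * ((i + 1ℚ) * z + y) + b * z ≡ (i + 1ℚ) * (a * z) + (a * y + b * z)
      eq′ = solve-∀ ring
    eq : ∀ T K a b z y → T * (a * z) + K * (a * y + b * z) ≡ (T * a + K * b) * z + K * a * y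
    eq = solve-∀ ring

  1≤c*k+i : ∀ {c} i → 1 ℕ.≤ c → 1 ℕ.≤ c ℕ.* k ℕ.+ i
  1≤c*k+i {c} i 1≤c = ℕₚ.≤-trans (ℕₚ.*-mono-≤ 1≤c 1≤k) (ℕₚ.m≤m+n (c ℕ.* k) i)

  S-leaves : ∀ m c → 1 ℕ.≤ c → Σ (k ℕ.^ m) (λ r → Z (c ℕ.* k ℕ.^ m ℕ.+ r)) ≡ S c m
  S-leaves zero    c 1≤c = trans (+-identityʳ _) (trans (cong Z (trans (ℕₚ.+-identityʳ _) (ℕₚ.*-identityʳ c))) (eq (Z c) (Y c)))
    where
    eq : ∀ z y → z ≡ 1ℚ * z + 0ℚ * y
    eq = solve-∀ ring
  S-leaves (suc m) c 1≤c = trans (Σ-double k (k ℕ.^ m) _)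
    (trans (Σ-cong k (λ i _ → trans (Σ-cong (k ℕ.^ m) (λ r _ → cong Z (eq c k (k ℕ.^ m) i r)))
        (S-leaves m (c ℕ.* k ℕ.+ i) (1≤c*k+i i 1≤c))))
      (S-children c m 1≤c))
    where
    eq : ∀ c k x i r → c ℕ.* (k ℕ.* x) ℕ.+ (i ℕ.* x ℕ.+ r) ≡ (c ℕ.* k ℕ.+ i) ℕ.* x ℕ.+ r
    eq = ℕ-Solver.solve-∀

  -- Level n has L n cells; cell c consists of the integers with leading part word n c.
  L : ℕ → ℕ
  L n = gridSize k n

  word : ℕ → ℕ → ℕ
  word n c = k ℕ.^ n ℕ.+ c

  1≤word : ∀ n c → 1 ℕ.≤ word n c
  1≤word n c = ℕₚ.≤-trans (1≤k^ n) (ℕₚ.m≤m+n (k ℕ.^ n) c)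

  1≤L : ∀ n → 1 ℕ.≤ L n
  1≤L n = ℕₚ.*-mono-≤ (1≤k^ n) (ℕₚ.m<n⇒0<n∸m 1<k)

  L≡blockLength : ∀ n → blockLength k n ≡ L n
  L≡blockLength n = trans (cong (k ℕ.^ suc n ℕ.∸_) (sym (ℕₚ.*-identityˡ (k ℕ.^ n))))
    (trans (sym (ℕₚ.*-distribʳ-∸ (k ℕ.^ n) k 1)) (ℕₚ.*-comm (k ℕ.∸ 1) (k ℕ.^ n)))

  L-+ : ∀ n m → L (n ℕ.+ m) ≡ L n ℕ.* k ℕ.^ m
  L-+ n m = trans (cong (ℕ._* (k ℕ.∸ 1)) (ℕₚ.^-distribˡ-+-* k n m)) (eq (k ℕ.^ n) (k ℕ.^ m) (k ℕ.∸ 1))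
    where
    eq : ∀ x y z → x ℕ.* y ℕ.* z ≡ x ℕ.* z ℕ.* y
    eq = ℕ-Solver.solve-∀

  word-+ : ∀ n m c r → word (n ℕ.+ m) (c ℕ.* k ℕ.^ m ℕ.+ r) ≡ word n c ℕ.* k ℕ.^ m ℕ.+ r
  word-+ n m c r = trans (cong (ℕ._+ (c ℕ.* k ℕ.^ m ℕ.+ r)) (ℕₚ.^-distribˡ-+-* k n m)) (eq (k ℕ.^ n) (k ℕ.^ m) c r)
    where
    eq : ∀ x y c r → x ℕ.* y ℕ.+ (c ℕ.* y ℕ.+ r) ≡ (x ℕ.+ c) ℕ.* y ℕ.+ r
    eq = ℕ-Solver.solve-∀

  word-snoc : ∀ n c i → word (suc n) (c ℕ.* k ℕ.+ i) ≡ word n c ℕ.* k ℕ.+ i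
  word-snoc n c i = eq k (k ℕ.^ n) c i
    where
    eq : ∀ k x c i → k ℕ.* x ℕ.+ (c ℕ.* k ℕ.+ i) ≡ (x ℕ.+ c) ℕ.* k ℕ.+ i
    eq = ℕ-Solver.solve-∀

  L-suc : ∀ n → L (suc n) ≡ L n ℕ.* k
  L-suc n = eq k (k ℕ.^ n) (k ℕ.∸ 1)
    where
    eq : ∀ k x y → k ℕ.* x ℕ.* y ≡ x ℕ.* y ℕ.* k
    eq = ℕ-Solver.solve-∀

  Σ-cells : ∀ n m f → Σ (L (n ℕ.+ m)) f ≡ Σ (L n) (λ c → Σ (k ℕ.^ m) (λ r → f (c ℕ.* k ℕ.^ m ℕ.+ r)))
  Σ-cells n m f = trans (cong (λ l → Σ l f) (L-+ n m)) (Σ-double (L n) (k ℕ.^ m) f)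

  Σ-cells₁ : ∀ n f → Σ (L (suc n)) f ≡ Σ (L n) (λ c → Σ k (λ i → f (c ℕ.* k ℕ.+ i)))
  Σ-cells₁ n f = trans (cong (λ l → Σ l f) (L-suc n)) (Σ-double (L n) k f)

  P Q : ℕ → ℚ
  P n = Σ (L n) (λ c → Z (word n c))
  Q n = Σ (L n) (λ c → Y (word n c))

  P-+ : ∀ n m → P (n ℕ.+ m) ≡ Σ (L n) (λ c → S (word n c) m)
  P-+ n m = trans (Σ-cells n m _) (Σ-cong (L n) (λ c _ →
    trans (Σ-cong (k ℕ.^ m) (λ r _ → cong Z (word-+ n m c r))) (S-leaves m (word n c) (1≤word n c))))

  -- The normalising total has the same shape as `S`, with (P n , Q n) in place of (Z , Y). This
  -- makes the ratio of the two depend only on the direction of (a m , b m).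
  P-+′ : ∀ n m → P (n ℕ.+ m) ≡ a m * P n + b m * Q n
  P-+′ n m = trans (P-+ n m) (trans (Σ-+ (L n) _ _)
    (cong₂ _+_ (Σ-*ˡ (L n) (a m) _) (Σ-*ˡ (L n) (b m) _)))

  0≤P : ∀ n → 0ℚ ≤ P n
  0≤P n = Σ-nonneg (L n) (λ c _ → 0≤Z (word n c))

  0<P : ∀ n → 0ℚ < P n
  0<P n = <-≤-trans (0<Z (word n 0)) (term≤Σ (L n) {λ c → Z (word n c)} (λ c _ → 0≤Z (word n c)) 0 (1≤L n))

  0≤Q : ∀ n → 0ℚ ≤ Q n
  0≤Q n = Σ-nonneg (L n) (λ c _ → 0≤Y (word n c))

  Q≤P : ∀ n → Q n ≤ P n
  Q≤P n = Σ-mono (L n) (λ c _ → Y≤Z (word n c) (1≤word n c))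

  ι-sum : ∀ n (f : ℕ → ℕ) → ι (sum (applyUpTo f n)) ≡ Σ n (λ i → ι (f i))
  ι-sum zero    f = ι0
  ι-sum (suc n) f = trans (ι-+ (f 0) _) (cong (ι (f 0) +_) (ι-sum n (λ i → f (suc i))))

  P≡blockSum : ∀ n → P n ≡ ι (blockSum k (zaremba k) n)
  P≡blockSum n = trans (Σ-cong (L n) (λ c _ → Z≡ (word n c)))
    (trans (cong (λ l → Σ l (λ c → ι (zaremba k (word n c)))) (sym (L≡blockLength n)))
      (sym (ι-sum (blockLength k n) (λ c → zaremba k (word n c)))))

  iP : ℕ → ℚ
  iP n = inv (P n)

  0≤iP : ∀ n → 0ℚ ≤ iP n
  0≤iP n = <⇒≤ (0<inv (0<P n))

  P*iP : ∀ n → P n * iP n ≡ 1ℚ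
  P*iP n = *-inv (0<P n)

  wt : ℕ → ℕ → ℚ
  wt N x = Z (word N x) * iP N

  0≤wt : ∀ N x → 0ℚ ≤ wt N x
  0≤wt N x = 0≤Z (word N x) ⊠ 0≤iP N

  -- The mass which μ_{n+m} gives to cell c of level n.
  mass : ℕ → ℕ → ℕ → ℚ
  mass n m c = S (word n c) m * iP (n ℕ.+ m)

  Σ-wt : ∀ n m c → Σ (k ℕ.^ m) (λ r → wt (n ℕ.+ m) (c ℕ.* k ℕ.^ m ℕ.+ r)) ≡ mass n m c
  Σ-wt n m c = trans (Σ-*ʳ (k ℕ.^ m) (iP (n ℕ.+ m)) _) (cong (_* iP (n ℕ.+ m))
    (trans (Σ-cong (k ℕ.^ m) (λ r _ → cong Z (word-+ n m c r))) (S-leaves m (word n c) (1≤word n c))))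

  Σ-mass : ∀ n m → Σ (L n) (mass n m) ≡ 1ℚ
  Σ-mass n m = trans (Σ-*ʳ (L n) (iP (n ℕ.+ m)) _)
    (trans (cong (_* iP (n ℕ.+ m)) (sym (P-+ n m))) (P*iP (n ℕ.+ m)))

  Σ-wt-total : ∀ N → Σ (L N) (wt N) ≡ 1ℚ
  Σ-wt-total N = trans (Σ-*ʳ (L N) (iP N) _) (P*iP N)

  -- Masses of cells

  -- From b ≤ a and Y ≤ Z one gets S ≤ 2 a Z, whereas P (n + m) ≥ a P n. A bound on a cell at its
  -- own level thus persists at all later levels.
  mass≤2wt : ∀ n m c → mass n m c ≤ 2ℚ * wt n c
  mass≤2wt n m c = *-cancel-≤ (0<P n) (≤-trans (≤-reflexive (eq₁ (P n) (S (word n c) m) i))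
    (≤-trans (*-mono-≤ʳ (0≤iP (n ℕ.+ m)) core)
      (≤-reflexive (trans (eq₂ 2ℚ z (P (n ℕ.+ m)) i)
        (trans (cong (2ℚ * z *_) (trans (P*iP (n ℕ.+ m)) (sym (P*iP n)))) (eq₃ 2ℚ z (P n) (iP n)))))))
    where
    z = Z (word n c)
    y = Y (word n c)
    i = iP (n ℕ.+ m)
    eq₁ : ∀ p s i → p * (s * i) ≡ p * s * i
    eq₁ = solve-∀ ring
    eq₂ : ∀ t z p i → t * z * p * i ≡ t * z * (p * i)
    eq₂ = solve-∀ ring
    eq₃ : ∀ t z p i → t * z * (p * i) ≡ p * (t * (z * i))
    eq₃ = solve-∀ ring
    core : P n * S (word n c) m ≤ 2ℚ * z * P (n ℕ.+ m)
    core = subst (λ x → P n * S (word n c) m ≤ 2ℚ * z * x) (sym (P-+′ n m))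
      (≤-trans (*-mono-≤ˡ (0≤P n) (+-mono-≤ {a m * z} {a m * z} {b m * y} {a m * z} ≤-refl
          (*-mono-≤ {b m} {a m} {y} {z} (0≤b m) (0≤Z (word n c)) (b≤a m) (Y≤Z (word n c) (1≤word n c)))))
        (by-diff {r = 2ℚ * z * (b m * Q n)} (((0≤1 ⊞ 0≤1) ⊠ 0≤Z (word n c)) ⊠ (0≤b m ⊠ 0≤Q n))
          (eq (P n) (a m) z (b m) (Q n))))
      where
      eq : ∀ p a z b q → (1ℚ + 1ℚ) * z * (a * p + b * q) - p * (a * z + a * z) ≡ (1ℚ + 1ℚ) * z * (b * q)
      eq = solve-∀ ring

  -- Geometric decay of the masses

  module Θ = Decay 3 (s≤s z≤n)

  θ : ℚ
  θ = Θ.d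

  3θ≡2 : 3ℚ * θ ≡ 2ℚ
  3θ≡2 = trans (cong (_* θ) (sym ι3)) (trans (eq (ι 3) (inv (ι 3))) (trans (cong (_- ι 3 * inv (ι 3)) ι3)
    (cong (λ x → 3ℚ - x) (*-inv (0<ι {3} (s≤s z≤n))))))
    where
    ι3 : ι 3 ≡ 3ℚ
    ι3 = trans (ι-+ 2 1) (trans (cong₂ _+_ (ι-+ 1 1) ι1) (cong (_+ 1ℚ) (cong₂ _+_ ι1 ι1)))
    eq : ∀ a i → a * (1ℚ - i) ≡ a - a * i
    eq = solve-∀ ring

  0≤3 : 0ℚ ≤ 3ℚ
  0≤3 = 0≤1 ⊞ 0≤1 ⊞ 0≤1

  0<3 : 0ℚ < 3ℚ
  0<3 = positive⁻¹ 3ℚ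

  -- The constant 2/3 comes from k = 2 and the digit 1, where the leading terms are 2 a z for the
  -- child and 3 a z for the parent. In general the deficit is a sum of terms that are nonnegative
  -- by i + 1 ≤ K and 2 ≤ K.
  S-child≤ : ∀ c i m → 1 ℕ.≤ c → i ℕ.< k → S (c ℕ.* k ℕ.+ i) m ≤ θ * S c (suc m)
  S-child≤ c i m 1≤c i<k = *-cancel-≤ 0<3 (≤-trans
    (*-mono-≤ˡ 0≤3 (≤-reflexive (S-snoc c i m 1≤c i<k)))
    (≤-trans (by-diff {r = 3ℚ * (a m * z) * (K - (ι i + 1ℚ)) + (K - 2ℚ) * (K * (a m * z)) + (2ℚ * K - 3ℚ) * (b m * z + a m * y)}
      (((0≤3 ⊠ (0≤a m ⊠ 0≤Z c)) ⊠ diff i+1≤K) ⊞ (0≤K-2 ⊠ (0≤K ⊠ (0≤a m ⊠ 0≤Z c)))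
        ⊞ (0≤2K-3 ⊠ ((0≤b m ⊠ 0≤Z c) ⊞ (0≤a m ⊠ 0≤Y c))))
      (eq (a m) (b m) z y (ι i) K))
     (≤-reflexive (trans (cong (_* S c (suc m)) (sym 3θ≡2)) (*-assoc 3ℚ θ _)))))
    where
    z = Z c
    y = Y c
    i+1≤K : ι i + 1ℚ ≤ K
    i+1≤K = subst (_≤ K) (trans (ι-suc i) (+-comm 1ℚ (ι i))) (ι-mono i<k)
    0≤2K-3 : 0ℚ ≤ 2ℚ * K - 3ℚ
    0≤2K-3 = subst (0ℚ ≤_) (eq′ K) (0≤K-2 ⊞ 0≤K-2 ⊞ 0≤1)
      where
      eq′ : ∀ K → K - (1ℚ + 1ℚ) + (K - (1ℚ + 1ℚ)) + 1ℚ ≡ (1ℚ + 1ℚ) * K - (1ℚ + 1ℚ + 1ℚ)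
      eq′ = solve-∀ ring
    eq : ∀ a b z y i K →
         (1ℚ + 1ℚ) * ((½ * (K * (K + 1ℚ)) * a + K * b) * z + K * a * y) - (1ℚ + 1ℚ + 1ℚ) * (a * ((i + 1ℚ) * z + y) + b * z) ≡
         (1ℚ + 1ℚ + 1ℚ) * (a * z) * (K - (i + 1ℚ)) + (K - (1ℚ + 1ℚ)) * (K * (a * z)) + ((1ℚ + 1ℚ) * K - (1ℚ + 1ℚ + 1ℚ)) * (b * z + a * y)
    eq = solve-∀ ring

  k-split : ∀ c → c ≡ c ℕ./ k ℕ.* k ℕ.+ c ℕ.% k
  k-split c = trans (ℕ.m≡m%n+[m/n]*n c k) (ℕₚ.+-comm (c ℕ.% k) _)

  parent< : ∀ n {c} → c ℕ.< L (suc n) → c ℕ./ k ℕ.< L n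
  parent< n {c} h = ℕ.m<n*o⇒m/o<n (subst (c ℕ.<_) (L-suc n) h)

  -- Passing to the parent costs a factor θ and moves one unit from n to m, so the total P (n + m)
  -- does not change.
  S≤ : ∀ n m c → c ℕ.< L n → S (word n c) m ≤ pow θ n * P (n ℕ.+ m)
  S≤ zero m c c<L = ≤-trans (term≤Σ (L 0) (λ c _ → 0≤S (word 0 c) m) c c<L)
    (≤-reflexive (trans (sym (P-+ 0 m)) (sym (*-identityˡ _))))
  S≤ (suc n) m c c<L = subst (λ x → S x m ≤ pow θ (suc n) * P (suc n ℕ.+ m))
    (sym (trans (cong (word (suc n)) (k-split c)) (word-snoc n (c ℕ./ k) (c ℕ.% k))))
    (≤-trans (S-child≤ (word n (c ℕ./ k)) (c ℕ.% k) m (1≤word n _) (ℕ.m%n<n c k))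
    (≤-trans (*-mono-≤ˡ Θ.0≤d (S≤ n (suc m) (c ℕ./ k) (parent< n c<L)))
      (≤-reflexive (trans (sym (*-assoc θ (pow θ n) _)) (cong (λ x → θ * pow θ n * P x) (ℕₚ.+-suc n m))))))

  mass≤θⁿ : ∀ n m c → c ℕ.< L n → mass n m c ≤ pow θ n
  mass≤θⁿ n m c c<L = ≤-trans (*-mono-≤ʳ (0≤iP (n ℕ.+ m)) (S≤ n m c c<L))
    (≤-reflexive (trans (*-assoc (pow θ n) _ _) (trans (cong (pow θ n *_) (P*iP (n ℕ.+ m))) (*-identityʳ _))))

  -- Contraction of directions and convergence of the masses

  det : ℕ → ℕ → ℚ
  det m m′ = a m * b m′ - a m′ * b m

  -- The factor - K² is the determinant of the matrix that advances both columns.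
  det-suc : ∀ m m′ → det (suc m) (suc m′) ≡ - (K * K * det m m′)
  det-suc m m′ = eq T K (a m) (b m) (a m′) (b m′)
    where
    eq : ∀ T K a b c d → (T * a + K * b) * (K * c) - (T * c + K * d) * (K * a) ≡ - (K * K * (a * d - c * b))
    eq = solve-∀ ring

  T*≤a : ∀ m → T * a m ≤ a (suc m)
  T*≤a m = by-diff (0≤K ⊠ 0≤b m) (p+q-p≡q (T * a m) (K * b m))

  -- The contraction ratio K²/T² = 4/(K + 1)² is at most 4/9, so the rate θ of the mass bound can be
  -- reused.
  3K²≤2T² : 3ℚ * (K * K) ≤ 2ℚ * (T * T)
  3K²≤2T² = by-diff {r = ½ * (K * K * ((K - 2ℚ) * (K + 1ℚ + 3ℚ) + 3ℚ))}
    (<⇒≤ 0<½ ⊠ ((0≤K ⊠ 0≤K) ⊠ (0≤K-2 ⊠ (0≤K ⊞ 0≤1 ⊞ 0≤3) ⊞ 0≤3))) (eq K)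
    where
    eq : ∀ K → (1ℚ + 1ℚ) * (½ * (K * (K + 1ℚ)) * (½ * (K * (K + 1ℚ)))) - (1ℚ + 1ℚ + 1ℚ) * (K * K)
         ≡ ½ * (K * K * ((K - (1ℚ + 1ℚ)) * (K + 1ℚ + (1ℚ + 1ℚ + 1ℚ)) + (1ℚ + 1ℚ + 1ℚ)))
    eq = solve-∀ ring

  -- The matrix B 0 + ⋯ + B (k - 1) contracts the directions of (a m , b m) and (a m′ , b m′).
  det≤ : ∀ j m m′ → ∣ det (j ℕ.+ m) (j ℕ.+ m′) ∣ ≤ pow θ j * (a (j ℕ.+ m) * a (j ℕ.+ m′))
  det≤ zero m m′ = ≤-trans (∣p∣≤
      (by-diff {q = a m * a m′} {r = a m * (a m′ - b m′) + a m′ * b m} (0≤a m ⊠ diff (b≤a m′) ⊞ 0≤a m′ ⊠ 0≤b m) (eq (a m) (b m) (a m′) (b m′)))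
      (by-diff {q = a m * a m′} {r = a m′ * (a m - b m) + a m * b m′} (0≤a m′ ⊠ diff (b≤a m) ⊞ 0≤a m ⊠ 0≤b m′) (eq′ (a m) (b m) (a m′) (b m′))))
    (≤-reflexive (sym (*-identityˡ (a m * a m′))))
    where
    eq : ∀ a b c d → a * c - (a * d - c * b) ≡ a * (c - d) + c * b
    eq = solve-∀ ring
    eq′ : ∀ a b c d → a * c - (- (a * d - c * b)) ≡ c * (a - b) + a * d
    eq′ = solve-∀ ring
  det≤ (suc j) m₀ m₀′ = *-cancel-≤ 0<3 (≤-trans (≤-reflexive
      (cong (3ℚ *_) (trans (cong ∣_∣ (det-suc m m′)) (trans (∣-p∣≡∣p∣ (K * K * det m m′))
        (trans (∣p*q∣≡∣p∣*∣q∣ (K * K) (det m m′)) (cong (_* ∣ det m m′ ∣) (0≤p⇒∣p∣≡p (0≤K ⊠ 0≤K))))))))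
    (≤-trans (*-mono-≤ˡ 0≤3 (*-mono-≤ˡ (0≤K ⊠ 0≤K) (det≤ j m₀ m₀′)))
    (≤-trans (≤-reflexive (eq₁ 3ℚ K (pow θ j) (a m * a m′)))
    (≤-trans (*-mono-≤ʳ (pow-nonneg Θ.0≤d j ⊠ (0≤a m ⊠ 0≤a m′)) 3K²≤2T²)
    (≤-trans (≤-reflexive (eq₂ 2ℚ T (pow θ j) (a m) (a m′)))
    (≤-trans (*-mono-≤ˡ ((0≤1 ⊞ 0≤1) ⊠ pow-nonneg Θ.0≤d j)
        (*-mono-≤ {T * a m} {a (suc m)} {T * a m′} {a (suc m′)} (0≤T ⊠ 0≤a m) (0≤a (suc m′)) (T*≤a m) (T*≤a m′)))
      (≤-reflexive (trans (cong (λ x → x * pow θ j * (a (suc m) * a (suc m′))) (sym 3θ≡2)) (eq₃ 3ℚ θ (pow θ j) _)))))))))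
    where
    m = j ℕ.+ m₀
    m′ = j ℕ.+ m₀′
    eq₁ : ∀ t K p x → t * (K * K * (p * x)) ≡ t * (K * K) * (p * x)
    eq₁ = solve-∀ ring
    eq₂ : ∀ t T p x y → t * (T * T) * (p * (x * y)) ≡ t * p * (T * x * (T * y))
    eq₂ = solve-∀ ring
    eq₃ : ∀ t θ p x → t * θ * p * x ≡ t * (θ * p * x)
    eq₃ = solve-∀ ring

  module _ (n j m₀ m₀′ : ℕ) where
    private
      m = j ℕ.+ m₀
      m′ = j ℕ.+ m₀′
      i = iP (n ℕ.+ m)
      i′ = iP (n ℕ.+ m′)
      p = P n
      q = Q n
      z y : ℕ → ℚ
      z c = Z (word n c)
      y c = Y (word n c)

      D*i : ∀ m → (a m * p + b m * q) * iP (n ℕ.+ m) ≡ 1ℚ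
      D*i m = trans (cong (_* iP (n ℕ.+ m)) (sym (P-+′ n m))) (P*iP (n ℕ.+ m))

      -- Over a common denominator everything cancels except a product of two determinants: one of
      -- the pairs (a , b), which carries all the decay, and one of (Z , Y) against (P , Q).
      mass-diff : ∀ c → mass n m c - mass n m′ c ≡ i * i′ * det m m′ * (z c * q - y c * p)
      mass-diff c = trans (sym (cong₂ _-_ (trans (cong (mass n m c *_) (D*i m′)) (*-identityʳ (mass n m c)))
                                          (trans (cong (mass n m′ c *_) (D*i m)) (*-identityʳ (mass n m′ c)))))
        (eq (a m) (b m) (a m′) (b m′) (z c) (y c) p q i i′)
        where
        eq : ∀ a b a′ b′ z y p q i i′ →
          (a * z + b * y) * i * ((a′ * p + b′ * q) * i′) - (a′ * z + b′ * y) * i′ * ((a * p + b * q) * i)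
          ≡ i * i′ * (a * b′ - a′ * b) * (z * q - y * p)
        eq = solve-∀ ring

      aip≤1 : ∀ m → a m * p * iP (n ℕ.+ m) ≤ 1ℚ
      aip≤1 m = ≤-trans (*-mono-≤ʳ (0≤iP (n ℕ.+ m)) (by-diff {a m * p} {a m * p + b m * q} (0≤b m ⊠ 0≤Q n) (p+q-p≡q (a m * p) (b m * q)))) (≤-reflexive (D*i m))

    -- The number j of levels common to both depths beyond n governs the error. `det≤` supplies θʲ,
    -- the second determinants sum to at most 2 P n Q n, and the factors a P iP left over are at
    -- most 1 by normalisation.
    Σ-mass-diff : ∀ (ψ : ℕ → ℚ) C → 0ℚ ≤ C → (∀ c → c ℕ.< L n → ∣ ψ c ∣ ≤ C) →
      ∣ Σ (L n) (λ c → ψ c * mass n m c) - Σ (L n) (λ c → ψ c * mass n m′ c) ∣ ≤ 2ℚ * C * pow θ j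
    Σ-mass-diff ψ C 0≤C ψ≤C = ≤-trans (≤-reflexive (cong ∣_∣ (trans (sym (Σ-- (L n) (λ c → ψ c * mass n m c) (λ c → ψ c * mass n m′ c)))
        (trans (Σ-cong (L n) (λ c _ → trans (eq₁ (ψ c) (mass n m c) (mass n m′ c)) (trans (cong (ψ c *_) (mass-diff c))
            (eq₂ (ψ c) (i * i′ * det m m′) (z c * q - y c * p)))))
          (Σ-*ˡ (L n) (i * i′ * det m m′) (λ c → ψ c * (z c * q - y c * p)))))))
      (≤-trans (≤-reflexive (∣p*q∣≡∣p∣*∣q∣ (i * i′ * det m m′) _))
      (≤-trans (*-mono-≤ {s = C * (2ℚ * (p * q))} (0≤∣p∣ (i * i′ * det m m′)) (0≤C ⊠ ((0≤1 ⊞ 0≤1) ⊠ (0≤P n ⊠ 0≤Q n)))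
          factor sum-bound)
      (≤-trans (≤-reflexive (eq₃ i i′ (pow θ j) (a m) (a m′) C p q))
      (≤-trans (*-mono-≤ˡ (((0≤1 ⊞ 0≤1) ⊠ 0≤C) ⊠ pow-nonneg Θ.0≤d j) unit)
        (≤-reflexive (*-identityʳ _))))))
      where
      eq₁ : ∀ ψ x y → ψ * x - ψ * y ≡ ψ * (x - y)
      eq₁ = solve-∀ ring
      eq₂ : ∀ ψ x y → ψ * (x * y) ≡ x * (ψ * y)
      eq₂ = solve-∀ ring
      eq₃ : ∀ i i′ t a a′ C p q → i * i′ * (t * (a * a′)) * (C * ((1ℚ + 1ℚ) * (p * q))) ≡
            (1ℚ + 1ℚ) * C * t * (a * p * i * (a′ * q * i′))
      eq₃ = solve-∀ ring
      factor : ∣ i * i′ * det m m′ ∣ ≤ i * i′ * (pow θ j * (a m * a m′))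
      factor = ≤-trans (≤-reflexive (trans (∣p*q∣≡∣p∣*∣q∣ (i * i′) (det m m′))
          (cong (_* ∣ det m m′ ∣) (0≤p⇒∣p∣≡p (0≤iP (n ℕ.+ m) ⊠ 0≤iP (n ℕ.+ m′))))))
        (*-mono-≤ˡ (0≤iP (n ℕ.+ m) ⊠ 0≤iP (n ℕ.+ m′)) (det≤ j m₀ m₀′))
      sum-bound : ∣ Σ (L n) (λ c → ψ c * (z c * q - y c * p)) ∣ ≤ C * (2ℚ * (p * q))
      sum-bound = ≤-trans (Σ-abs (L n) (λ c → ψ c * (z c * q - y c * p))) (≤-trans (Σ-mono (L n) (λ c c<L →
          ≤-trans (≤-reflexive (∣p*q∣≡∣p∣*∣q∣ (ψ c) (z c * q - y c * p)))
            (*-mono-≤ {∣ ψ c ∣} {C} {∣ z c * q - y c * p ∣} {z c * q + y c * p} (0≤∣p∣ (ψ c)) (0≤Z _ ⊠ 0≤Q n ⊞ 0≤Y _ ⊠ 0≤P n) (ψ≤C c c<L)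
              (∣p∣≤ (by-diff {z c * q - y c * p} {z c * q + y c * p} ((0≤Y _ ⊠ 0≤P n) ⊞ (0≤Y _ ⊠ 0≤P n)) (eq₄ (z c * q) (y c * p)))
                    (by-diff {p = - (z c * q - y c * p)} {q = z c * q + y c * p} ((0≤Z _ ⊠ 0≤Q n) ⊞ (0≤Z _ ⊠ 0≤Q n)) (eq₅ (z c * q) (y c * p)))))))
        (≤-reflexive (trans (Σ-*ˡ (L n) C (λ c → z c * q + y c * p)) (cong (C *_) (trans (Σ-+ (L n) (λ c → z c * q) (λ c → y c * p))
          (trans (cong₂ _+_ (Σ-*ʳ (L n) q z) (Σ-*ʳ (L n) p y)) (eq₆ p q)))))))
        where
        eq₄ : ∀ x y → x + y - (x - y) ≡ y + y
        eq₄ = solve-∀ ring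
        eq₅ : ∀ x y → x + y - (- (x - y)) ≡ x + x
        eq₅ = solve-∀ ring
        eq₆ : ∀ p q → p * q + q * p ≡ (1ℚ + 1ℚ) * (p * q)
        eq₆ = solve-∀ ring
      unit : a m * p * i * (a m′ * q * i′) ≤ 1ℚ
      unit = *-mono-≤ {a m * p * i} {1ℚ} {a m′ * q * i′} {1ℚ} ((0≤a m ⊠ 0≤P n) ⊠ 0≤iP (n ℕ.+ m)) 0≤1 (aip≤1 m)
        (≤-trans (*-mono-≤ʳ (0≤iP (n ℕ.+ m′)) (*-mono-≤ˡ (0≤a m′) (Q≤P n))) (aip≤1 m′))

  -- A square root of the density

  -- scale is chosen so that k S (c k + i) m = (1 + gain m c i) S c (m + 1).
  scale : ℕ → ℕ → ℚ
  scale m c = a m * Z c * inv (S c (suc m))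

  gain : ℕ → ℕ → ℕ → ℚ
  gain m c i = (K * (ι i + 1ℚ) - T) * scale m c

  S*inv : ∀ m c → S c (suc m) * inv (S c (suc m)) ≡ 1ℚ
  S*inv m c = *-inv (0<S c (suc m))

  0≤invS : ∀ m c → 0ℚ ≤ inv (S c (suc m))
  0≤invS m c = <⇒≤ (0<inv (0<S c (suc m)))

  0≤scale : ∀ m c → 0ℚ ≤ scale m c
  0≤scale m c = (0≤a m ⊠ 0≤Z c) ⊠ 0≤invS m c

  Tscale≤1 : ∀ m c → T * scale m c ≤ 1ℚ
  Tscale≤1 m c = ≤-trans (≤-reflexive (sym (*-assoc T _ _))) (≤-trans
    (*-mono-≤ʳ (0≤invS m c) (by-diff {T * (a m * Z c)} {S c (suc m)} (0≤K ⊠ 0≤b m ⊠ 0≤Z c ⊞ 0≤K ⊠ 0≤a m ⊠ 0≤Y c)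
      (eq T K (a m) (b m) (Z c) (Y c))))
    (≤-reflexive (S*inv m c)))
    where
    eq : ∀ T K a b z y → (T * a + K * b) * z + K * a * y - T * (a * z) ≡ K * b * z + K * a * y
    eq = solve-∀ ring

  -- By b ≤ a and Y ≤ Z the denominator S c (m + 1) is at most (T + 2K) a Z. This keeps the
  -- fluctuations of the density away from zero, uniformly in the cell and in m.
  1≤[T+2K]scale : ∀ m c → 1 ℕ.≤ c → 1ℚ ≤ (T + 2ℚ * K) * scale m c
  1≤[T+2K]scale m c 1≤c = ≤-trans (≤-reflexive (sym (S*inv m c))) (≤-trans
    (*-mono-≤ʳ (0≤invS m c) (by-diff {S c (suc m)} {(T + 2ℚ * K) * (a m * Z c)}
      (0≤K ⊠ (diff (b≤a m) ⊠ 0≤Z c ⊞ 0≤a m ⊠ diff (Y≤Z c 1≤c)))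
      (eq T K (a m) (b m) (Z c) (Y c))))
    (≤-reflexive (*-assoc (T + 2ℚ * K) _ _)))
    where
    eq : ∀ T K a b z y → (T + (1ℚ + 1ℚ) * K) * (a * z) - ((T * a + K * b) * z + K * a * y) ≡
         K * ((a - b) * z + a * (z - y))
    eq = solve-∀ ring

  K*S-child : ∀ m c i → 1 ℕ.≤ c → i ℕ.< k → K * S (c ℕ.* k ℕ.+ i) m ≡ (1ℚ + gain m c i) * S c (suc m)
  K*S-child m c i 1≤c i<k = trans (cong (K *_) (S-snoc c i m 1≤c i<k)) (sym (trans
    (eq₁ (K * (ι i + 1ℚ) - T) (a m * Z c) (inv (S c (suc m))) (S c (suc m)))
    (trans (cong (λ u → S c (suc m) + (K * (ι i + 1ℚ) - T) * (a m * Z c) * u) (S*inv m c))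
      (eq₂ T K (ι i) (a m) (b m) (Z c) (Y c)))))
    where
    eq₁ : ∀ u v i s → (1ℚ + u * (v * i)) * s ≡ s + u * v * (s * i)
    eq₁ = solve-∀ ring
    eq₂ : ∀ T K i a b z y → (T * a + K * b) * z + K * a * y + (K * (i + 1ℚ) - T) * (a * z) * 1ℚ ≡
          K * (a * ((i + 1ℚ) * z + y) + b * z)
    eq₂ = solve-∀ ring

  gain≤1 : ∀ m c i → i ℕ.< k → gain m c i ≤ 1ℚ
  gain≤1 m c i i<k = ≤-trans (*-mono-≤ʳ {p = K * (ι i + 1ℚ) - T} {T} (0≤scale m c)
      (by-diff (0≤K ⊠ diff i+1≤K ⊞ 0≤K) (eq K (ι i)))) (Tscale≤1 m c)
    where
    i+1≤K : ι i + 1ℚ ≤ K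
    i+1≤K = subst (_≤ K) (trans (ι-suc i) (+-comm 1ℚ (ι i))) (ι-mono i<k)
    eq : ∀ K i → ½ * (K * (K + 1ℚ)) - (K * (i + 1ℚ) - ½ * (K * (K + 1ℚ))) ≡ K * (K - (i + 1ℚ)) + K
    eq = solve-∀ ring

  -1≤gain : ∀ m c i → - 1ℚ ≤ gain m c i
  -1≤gain m c i = by-diff (diff (Tscale≤1 m c) ⊞ 0≤K ⊠ (0≤ι i ⊞ 0≤1) ⊠ 0≤scale m c) (eq K (ι i) T (scale m c))
    where
    eq : ∀ K i T t → (K * (i + 1ℚ) - T) * t - (- 1ℚ) ≡ 1ℚ - T * t + K * (i + 1ℚ) * t
    eq = solve-∀ ring

  -- For the digit 0 the coefficient K - T is - ½ K (K - 1), and 7 · ½ K (K - 1) exceeds T + 2K by 3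
  -- K (K - 2). So 7 is what k = 2 dictates.
  1≤-7gain : ∀ m c → 1 ℕ.≤ c → 1ℚ ≤ (ℤ.+ 7 / 1) * (- gain m c 0)
  1≤-7gain m c 1≤c = ≤-trans (1≤[T+2K]scale m c 1≤c) (by-diff {r = 3ℚ * (K * (K - 2ℚ)) * scale m c}
    (0≤3 ⊠ (0≤K ⊠ 0≤K-2) ⊠ 0≤scale m c)
    (trans (cong (λ z → (ℤ.+ 7 / 1) * (- ((K * (z + 1ℚ) - T) * scale m c)) - (T + 2ℚ * K) * scale m c) ι0) (eq K (scale m c))))
    where
    eq : ∀ K t → (ℤ.+ 7 / 1) * (- ((K * (0ℚ + 1ℚ) - ½ * (K * (K + 1ℚ))) * t)) - (½ * (K * (K + 1ℚ)) + (1ℚ + 1ℚ) * K) * t ≡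
         (1ℚ + 1ℚ + 1ℚ) * (K * (K - (1ℚ + 1ℚ))) * t
    eq = solve-∀ ring

  κ : ℚ
  κ = K - 1/784

  -- The linear terms cancel because T = Σ (i + 1) is K times the mean of i + 1; the digit 0 then
  -- contributes the gap of `φ-gap`.
  Σφ≤κ : ∀ m c → 1 ℕ.≤ c → Σ k (λ i → φ (gain m c i)) ≤ κ
  Σφ≤κ m c 1≤c = by-diff (diff (Σ-mono-gap k 1/784 1≤k (λ i _ → φ≤ (gain m c i)) (φ-gap (gain m c 0) (1≤-7gain m c 1≤c))))
    (trans (eq K (Σ k (λ i → φ (gain m c i))) 1/784) (cong (_- (Σ k (λ i → φ (gain m c i)) + 1/784)) (sym total)))
    where
    eq : ∀ K s c → K - c - s ≡ K - (s + c)
    eq = solve-∀ ring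
    total : Σ k (λ i → 1ℚ + ½ * gain m c i) ≡ K
    total = trans (Σ-cong k (λ i _ → eq₁ K T (ι i) (scale m c)))
      (trans (Σ-+ k (λ i → (ι i + 1ℚ) * (½ * K * scale m c)) (λ _ → 1ℚ - ½ * T * scale m c))
      (trans (cong₂ _+_ (trans (Σ-*ʳ k (½ * K * scale m c) (λ i → ι i + 1ℚ)) (cong (_* (½ * K * scale m c)) (Σ-digits k)))
                        (Σ-const k (1ℚ - ½ * T * scale m c)))
        (eq₂ K T (scale m c))))
      where
      eq₁ : ∀ K T i t → 1ℚ + ½ * ((K * (i + 1ℚ) - T) * t) ≡ (i + 1ℚ) * (½ * K * t) + (1ℚ - ½ * T * t)
      eq₁ = solve-∀ ring
      eq₂ : ∀ K T t → T * (½ * K * t) + K * (1ℚ - ½ * T * t) ≡ K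
      eq₂ = solve-∀ ring

  -- W l m c bounds the square root of the relative density of the mass of the
  -- level-l cell c, seen at level l + m, while its average decays with l.
  W : ℕ → ℕ → ℕ → ℚ
  W zero    m c = 1ℚ
  W (suc l) m c = φ (gain m (c ℕ./ k) (c ℕ.% k)) * W l (suc m) (c ℕ./ k)

  W-snoc : ∀ l m c {i} → i ℕ.< k → W (suc l) m (c ℕ.* k ℕ.+ i) ≡ φ (gain m c i) * W l (suc m) c
  W-snoc l m c i<k = cong₂ (λ c′ i′ → φ (gain m c′ i′) * W l (suc m) c′) ([c*k+i]/k c i<k) ([c*k+i]%k c i<k)

  0≤W : ∀ l m c → 0ℚ ≤ W l m c
  0≤W zero    m c = 0≤1
  0≤W (suc l) m c = 0≤φ (-1≤gain m (c ℕ./ k) (c ℕ.% k)) (gain≤1 m (c ℕ./ k) (c ℕ.% k) (ℕ.m%n<n c k)) ⊠ 0≤W l (suc m) (c ℕ./ k)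

  -- By `K*S-child` each level multiplies Kˡ S by 1 + gain, and φ² dominates this factor. The sum l
  -- + m is constant along the ancestors, so all are compared with the same total; at level 0 the
  -- total itself is a sufficient bound.
  S≤W² : ∀ l m c → c ℕ.< L l → S (word l c) m * pow K l ≤ W l m (word l c) * W l m (word l c) * P (l ℕ.+ m)
  S≤W² zero m c c<L = ≤-trans (≤-reflexive (*-identityʳ _))
    (≤-trans (term≤Σ (L 0) (λ c _ → 0≤S (word 0 c) m) c c<L)
    (≤-reflexive (trans (sym (P-+ 0 m)) (eq (P m)))))
    where
    eq : ∀ p → p ≡ 1ℚ * 1ℚ * p
    eq = solve-∀ ring
  S≤W² (suc l) m c c<L = subst (λ w → S w m * pow K (suc l) ≤ W (suc l) m w * W (suc l) m w * P (suc l ℕ.+ m))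
    (sym (trans (cong (word (suc l)) (k-split c)) (word-snoc l c′ i)))
    (≤-trans (≤-reflexive (trans (eq₁ (S (u ℕ.* k ℕ.+ i) m) K (pow K l)) (trans (cong (_* pow K l) (K*S-child m u i (1≤word l c′) i<k))
        (*-assoc (1ℚ + gain m u i) _ _))))
    (≤-trans (*-mono-≤ {1ℚ + gain m u i} {φ (gain m u i) * φ (gain m u i)} {S u (suc m) * pow K l} {w * w * P (l ℕ.+ suc m)}
        (by-diff (diff (-1≤gain m u i)) (eq₂ (gain m u i))) ((0≤W l (suc m) u ⊠ 0≤W l (suc m) u) ⊠ 0≤P (l ℕ.+ suc m))
        (1+x≤φ² (gain≤1 m u i i<k)) (S≤W² l (suc m) c′ (parent< l c<L)))
      (≤-reflexive (trans (eq₃ (φ (gain m u i)) w (P (l ℕ.+ suc m)))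
        (cong₂ (λ v N → v * v * P N) (sym (W-snoc l m u i<k)) (ℕₚ.+-suc l m))))))
    where
    c′ = c ℕ./ k
    i = c ℕ.% k
    i<k : i ℕ.< k
    i<k = ℕ.m%n<n c k
    u = word l c′
    w = W l (suc m) u
    eq₁ : ∀ s K p → s * (K * p) ≡ K * s * p
    eq₁ = solve-∀ ring
    eq₂ : ∀ x → 1ℚ + x - 0ℚ ≡ x - (- 1ℚ)
    eq₂ = solve-∀ ring
    eq₃ : ∀ f w p → f * f * (w * w * p) ≡ f * w * (f * w) * p
    eq₃ = solve-∀ ring

  -- The number of cells of level 0, one for each nonzero leading digit.
  k₁ : ℚ
  k₁ = ι (k ℕ.∸ 1)

  0≤κ : 0ℚ ≤ κ
  0≤κ = by-diff (0≤K-2 ⊞ nonNegative⁻¹ (ℤ.+ 1567 / 784)) (eq K)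
    where
    eq : ∀ K → K - (ℤ.+ 1 / 784) - 0ℚ ≡ K - (1ℚ + 1ℚ) + (ℤ.+ 1567 / 784)
    eq = solve-∀ ring

  -- Siblings share the factor of their parent, so the average of the product can be taken one level
  -- at a time.
  ΣW≤ : ∀ l m → Σ (L l) (λ c → W l m (word l c)) ≤ pow κ l * k₁
  ΣW≤ zero m = ≤-reflexive (trans (Σ-const (L 0) 1ℚ) (trans (*-identityʳ _)
    (trans (cong ι (ℕₚ.*-identityˡ (k ℕ.∸ 1))) (sym (*-identityˡ k₁)))))
  ΣW≤ (suc l) m = ≤-trans (≤-reflexive (trans (Σ-cells₁ l _) (Σ-cong (L l) (λ c _ →
      trans (Σ-cong k (λ i i<k → trans (cong (W (suc l) m) (word-snoc l c i)) (W-snoc l m (word l c) i<k)))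
            (Σ-*ʳ k (W l (suc m) (word l c)) (λ i → φ (gain m (word l c) i)))))))
    (≤-trans (Σ-mono (L l) (λ c _ → *-mono-≤ʳ (0≤W l (suc m) (word l c)) (Σφ≤κ m (word l c) (1≤word l c))))
    (≤-trans (≤-reflexive (Σ-*ˡ (L l) κ (λ c → W l (suc m) (word l c))))
    (≤-trans (*-mono-≤ˡ 0≤κ (ΣW≤ l (suc m))) (≤-reflexive (sym (*-assoc κ (pow κ l) k₁))))))

  -- Bad and good cells

  N₀ : ℕ
  N₀ = 1568 ℕ.* k

  1≤N₀ : 1 ℕ.≤ N₀
  1≤N₀ = ℕₚ.*-mono-≤ {1} {1568} (s≤s z≤n) 1≤k

  module Δ = Decay N₀ 1≤N₀

  d : ℚ
  d = Δ.d

  -- The choice N₀ = 2 · 784 k gives d² ≥ 1 - 2/N₀ = 1 - 1/(784 k) = κ/K. Thus d is a rational upper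
  -- bound for the square root of the rate of W, and Markov's inequality can divide the decay
  -- evenly.
  κ≤Kd² : κ ≤ K * (d * d)
  κ≤Kd² = by-diff (0≤K ⊠ 0≤p² j) (trans (eq K j (ι 1568) 1/784) (trans
      (cong₂ (λ u v → K * (j * j) + (1/784 - 1/784 * u) - (1ℚ + 1ℚ - 1/784 * v) * (K * j)) one ι1568)
      (eq′ K j)))
    where
    j = inv (ι N₀)
    one : ι 1568 * K * j ≡ 1ℚ
    one = trans (cong (_* j) (sym (ι-* 1568 k))) (*-inv (0<ι 1≤N₀))
    ι1568 : ι 1568 ≡ (ℤ.+ 1568) / 1
    ι1568 = ζ≡/1 (ℤ.+ 1568)
    eq : ∀ K j n c → K * ((1ℚ - j) * (1ℚ - j)) - (K - c) ≡ K * (j * j) + (c - c * (n * K * j)) - (1ℚ + 1ℚ - c * n) * (K * j)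
    eq = solve-∀ ring
    eq′ : ∀ K j → K * (j * j) + ((ℤ.+ 1 / 784) - (ℤ.+ 1 / 784) * 1ℚ) - (1ℚ + 1ℚ - (ℤ.+ 1 / 784) * (ℤ.+ 1568 / 1)) * (K * j) ≡ K * (j * j)
    eq′ = solve-∀ ring

  0<d : 0ℚ < d
  0<d = diff-< (*-cancelˡ-<-nonNeg (ι N₀) {{nonNegative (0≤ι N₀)}} (subst₂ _<_ (sym (*-inv (0<ι 1≤N₀))) (sym (*-identityʳ (ι N₀)))
    (<-≤-trans (subst (1ℚ <_) (sym (trans (ι-suc 1) (cong (1ℚ +_) ι1))) (positive⁻¹-lem)) (ι-mono 2≤N₀))))
    where
    positive⁻¹-lem : 1ℚ < 1ℚ + 1ℚ
    positive⁻¹-lem = by-diff-< 0<1 refl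
    2≤N₀ : 2 ℕ.≤ N₀
    2≤N₀ = ℕₚ.*-mono-≤ {2} {1568} (s≤s (s≤s z≤n)) 1≤k

  dⁿ : ℕ → ℚ
  dⁿ = pow d

  0<dⁿ : ∀ n → 0ℚ < dⁿ n
  0<dⁿ = pow-pos 0<d

  0≤dⁿ : ∀ n → 0ℚ ≤ dⁿ n
  0≤dⁿ n = <⇒≤ (0<dⁿ n)

  κⁿ≤ : ∀ n → pow κ n ≤ pow K n * (dⁿ n * dⁿ n)
  κⁿ≤ n = ≤-trans (pow-mono 0≤κ κ≤Kd² n)
    (≤-reflexive (trans (pow-* K (d * d) n) (cong (pow K n *_) (pow-* d d n))))

  -- The length of the cells of level n.
  h : ℕ → ℚ
  h n = inv (ι (L n))

  0<ιL : ∀ n → 0ℚ < ι (L n)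
  0<ιL n = 0<ι (1≤L n)

  0<h : ∀ n → 0ℚ < h n
  0<h n = 0<inv (0<ιL n)

  0≤h : ∀ n → 0ℚ ≤ h n
  0≤h n = <⇒≤ (0<h n)

  L*h : ∀ n → ι (L n) * h n ≡ 1ℚ
  L*h n = *-inv (0<ιL n)

  ιL : ∀ n → ι (L n) ≡ pow K n * k₁
  ιL n = trans (ι-* (k ℕ.^ n) (k ℕ.∸ 1)) (cong (_* k₁) (ι-^ k n))

  h-+ : ∀ n m → h n ≡ ι (k ℕ.^ m) * h (n ℕ.+ m)
  h-+ n m = sym (inv-unique (0<ιL n) (trans (sym (*-assoc (ι (L n)) (ι (k ℕ.^ m)) (h (n ℕ.+ m))))
    (trans (cong (_* h (n ℕ.+ m)) (trans (sym (ι-* (L n) (k ℕ.^ m))) (cong ι (sym (L-+ n m))))) (L*h (n ℕ.+ m)))))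

  h-suc : ∀ n → h n ≡ K * h (suc n)
  h-suc n = trans (h-+ n 1) (cong₂ (λ x y → ι x * h y) (ℕₚ.^-identityʳ k) (ℕₚ.+-comm n 1))

  Bad : ℕ → ℕ → Set
  Bad n c = dⁿ n < W n 0 (word n c)

  bad? : ∀ n c → Dec (Bad n c)
  bad? n c = dⁿ n <? W n 0 (word n c)

  indicator : ∀ {A : Set} → Dec A → ℚ
  indicator (yes _) = 1ℚ
  indicator (no _)  = 0ℚ

  -- The factor `k₁ * h n` is 1/kⁿ, and the 2 comes from `mass≤2wt`.
  threshold : ℕ → ℚ
  threshold n = 2ℚ * (dⁿ n * dⁿ n) * (k₁ * h n)

  -- Badness is a decidable condition at depth 0. There `S≤W²` bounds the weight by d²ⁿ/kⁿ, and
  -- `mass≤2wt` carries the bound to every m.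
  mass-good : ∀ n m c → c ℕ.< L n → ¬ Bad n c → mass n m c ≤ threshold n
  mass-good n m c c<L good = ≤-trans (mass≤2wt n m c) (≤-trans (*-mono-≤ˡ (0≤1 ⊞ 0≤1) wt≤)
      (≤-reflexive (sym (*-assoc 2ℚ (dⁿ n * dⁿ n) (k₁ * h n)))))
    where
    w = W n 0 (word n c)
    w≤dⁿ : w ≤ dⁿ n
    w≤dⁿ = ≮⇒≥ good
    wt*Kⁿ≤ : wt n c * pow K n ≤ dⁿ n * dⁿ n
    wt*Kⁿ≤ = ≤-trans (≤-reflexive (trans (cong (λ z → z * iP n * pow K n) (sym (eq₁ (Z (word n c)) (Y (word n c)))))
        (eq₂ (S (word n c) 0) (iP n) (pow K n))))
      (≤-trans (*-mono-≤ʳ (0≤iP n) (S≤W² n 0 c c<L))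
      (≤-trans (≤-reflexive (trans (*-assoc (w * w) _ _) (trans (cong (w * w *_) (trans (cong (λ N → P N * iP n) (ℕₚ.+-identityʳ n)) (P*iP n))) (*-identityʳ (w * w)))))
        (*-mono-≤ {w} {dⁿ n} {w} {dⁿ n} (0≤W n 0 _) (0≤dⁿ n) w≤dⁿ w≤dⁿ)))
      where
      eq₁ : ∀ z y → 1ℚ * z + 0ℚ * y ≡ z
      eq₁ = solve-∀ ring
      eq₂ : ∀ s i p → s * i * p ≡ s * p * i
      eq₂ = solve-∀ ring
    0≤k₁h : 0ℚ ≤ k₁ * h n
    0≤k₁h = 0≤ι (k ℕ.∸ 1) ⊠ 0≤h n
    wt≤ : wt n c ≤ dⁿ n * dⁿ n * (k₁ * h n)
    wt≤ = ≤-trans (≤-reflexive (trans (sym (*-identityʳ (wt n c))) (trans (cong (wt n c *_) (sym (trans (cong (_* h n) (sym (ιL n))) (L*h n))))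
        (eq (wt n c) (pow K n) k₁ (h n)))))
      (*-mono-≤ʳ 0≤k₁h wt*Kⁿ≤)
      where
      eq : ∀ w p k h → w * (p * k * h) ≡ w * p * (k * h)
      eq = solve-∀ ring

  -- Markov's inequality at height dⁿ for W, whose mean over the cells is at most (κ/K)ⁿ ≤ d²ⁿ.
  Σ-bad : ∀ n → Σ (L n) (λ c → indicator (bad? n c) * h n) ≤ dⁿ n
  Σ-bad n = *-cancel-≤ (0<* (0<dⁿ n) (0<ιL n)) (≤-trans (≤-reflexive (trans
      (cong (dⁿ n * ι (L n) *_) (Σ-*ʳ (L n) (h n) (λ c → indicator (bad? n c))))
      (trans (eq₁ (dⁿ n) (ι (L n)) (h n) (Σ (L n) (λ c → indicator (bad? n c))))
      (trans (cong (_* (dⁿ n * Σ (L n) (λ c → indicator (bad? n c)))) (L*h n)) (trans (*-identityˡ _) (sym (Σ-*ˡ (L n) (dⁿ n) _)))))))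
    (≤-trans (Σ-mono (L n) (λ c _ → markov n c))
    (≤-trans (ΣW≤ n 0)
    (≤-trans (*-mono-≤ʳ (0≤ι (k ℕ.∸ 1)) (κⁿ≤ n))
      (≤-reflexive (trans (eq₂ (pow K n) (dⁿ n) k₁) (cong (λ l → dⁿ n * l * dⁿ n) (sym (ιL n)))))))))
    where
    markov : ∀ n c → dⁿ n * indicator (bad? n c) ≤ W n 0 (word n c)
    markov n c with bad? n c
    ... | yes bad = ≤-trans (≤-reflexive (*-identityʳ (dⁿ n))) (<⇒≤ bad)
    ... | no  _   = ≤-trans (≤-reflexive (*-zeroʳ (dⁿ n))) (0≤W n 0 (word n c))
    eq₁ : ∀ d l h s → d * l * (s * h) ≡ l * h * (d * s)
    eq₁ = solve-∀ ring
    eq₂ : ∀ p d k → p * (d * d) * k ≡ d * (p * k) * d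
    eq₂ = solve-∀ ring

  -- Cells, arcs and empirical integrals

  L≢0 : ∀ n → NonZero (L n)
  L≢0 = gridSize≢0 k

  pt : ℕ → ℕ → ℚ
  pt N x = ι x * h N

  gridPoint≡pt : ∀ N x → gridPoint k N x ≡ pt N x
  gridPoint≡pt N x = /≡*inv x (L N) {{L≢0 N}}

  module _ (n m c r : ℕ) where
    private
      x = c ℕ.* k ℕ.^ m ℕ.+ r
      pt≡′ : pt (n ℕ.+ m) x ≡ ι c * h n + ι r * h (n ℕ.+ m)
      pt≡′ = trans (cong (_* h (n ℕ.+ m)) (trans (ι-+ (c ℕ.* k ℕ.^ m) r) (cong (_+ ι r) (ι-* c (k ℕ.^ m)))))
        (trans (eq (ι c) (ι (k ℕ.^ m)) (ι r) (h (n ℕ.+ m))) (cong (λ z → ι c * z + ι r * h (n ℕ.+ m)) (sym (h-+ n m))))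
        where
        eq : ∀ c k r h → (c * k + r) * h ≡ c * (k * h) + r * h
        eq = solve-∀ ring

    pt-lower : ι c * h n ≤ pt (n ℕ.+ m) x
    pt-lower = by-diff (0≤ι r ⊠ 0≤h (n ℕ.+ m)) (trans (cong (_- ι c * h n) pt≡′) (p+q-p≡q (ι c * h n) _))

    pt-upper : r ℕ.< k ℕ.^ m → pt (n ℕ.+ m) x < (ι c + 1ℚ) * h n
    pt-upper r<kᵐ = subst₂ _<_ (sym pt≡′) (eq (ι c) (h n)) (+-monoʳ-< (ι c * h n) (subst (ι r * h (n ℕ.+ m) <_) (sym (h-+ n m))
      (*-mono-<ʳ (0<h (n ℕ.+ m)) (<-≤-trans (by-diff-< 0<1 (eq′ (ι r))) (subst (_≤ ι (k ℕ.^ m)) (ι-suc r) (ι-mono r<kᵐ))))))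
      where
      eq : ∀ c h → c * h + h ≡ (c + 1ℚ) * h
      eq = solve-∀ ring
      eq′ : ∀ r → 1ℚ + r - r ≡ 1ℚ
      eq′ = solve-∀ ring

  0≤pt : ∀ N x → 0ℚ ≤ pt N x
  0≤pt N x = 0≤ι x ⊠ 0≤h N

  -- The cell modulo 1 at the integer position e + t of the grid of level n.
  cell : ℕ → ℤ → ℕ → ℕ
  cell n e t = ((e ℤ.+ ℤ.+ t) ℤ.%ℕ L n) {{L≢0 n}}

  cell<L : ∀ n e t → cell n e t ℕ.< L n
  cell<L n e t = ℤ.n%ℕd<d (e ℤ.+ ℤ.+ t) (L n) {{L≢0 n}}

  δ : ℕ → ℕ → ℚ
  δ c j = indicator (c ℕₚ.≟ j)

  0≤δ : ∀ c j → 0ℚ ≤ δ c j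
  0≤δ c j with c ℕₚ.≟ j
  ... | yes _ = 0≤1
  ... | no  _ = ≤-refl

  δ-refl : ∀ c → 1ℚ ≤ δ c c
  δ-refl c with c ℕₚ.≟ c
  ... | yes _   = ≤-refl
  ... | no  c≢c = ⊥-elim (c≢c refl)

  -- A majorant of the indicator of the three-cell window at position e. As a sum of deltas it needs
  -- no case distinction when the level has fewer than three cells and some of them coincide.
  ω : ℕ → ℤ → ℕ → ℚ
  ω n e c = δ c (cell n e 0) + δ c (cell n e 1) + δ c (cell n e 2)

  0≤ω : ∀ n e c → 0ℚ ≤ ω n e c
  0≤ω n e c = 0≤δ c _ ⊞ 0≤δ c _ ⊞ 0≤δ c _

  1≤ω : ∀ n e {c t} → t ℕ.≤ 2 → c ≡ cell n e t → 1ℚ ≤ ω n e c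
  1≤ω n e {c} {0} _ refl = ≤-trans (δ-refl c) (by-diff (0≤δ c _ ⊞ 0≤δ c _) (eq (δ c _) (δ c _) (δ c _)))
    where
    eq : ∀ x y z → x + y + z - x ≡ y + z
    eq = solve-∀ ring
  1≤ω n e {c} {1} _ refl = ≤-trans (δ-refl c) (by-diff (0≤δ c _ ⊞ 0≤δ c _) (eq (δ c _) (δ c _) (δ c _)))
    where
    eq : ∀ x y z → x + y + z - y ≡ x + z
    eq = solve-∀ ring
  1≤ω n e {c} {2} _ refl = ≤-trans (δ-refl c) (by-diff (0≤δ c _ ⊞ 0≤δ c _) (eq (δ c _) (δ c _) (δ c _)))
    where
    eq : ∀ x y z → x + y + z - z ≡ x + y
    eq = solve-∀ ring
  1≤ω n e {c} {suc (suc (suc _))} (s≤s (s≤s ())) _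

  Within : ℕ → ℤ → ℚ → Set
  Within n e y = ζ e * h n < y × y < (ζ e + 3ℚ) * h n

  -- Adding the integer j moves cell c to the grid position i = c + j L n. The bounds force e ≤ i ≤
  -- e + 2, and reduction modulo L n recovers c.
  locate-cell : ∀ n m c r e j → r ℕ.< k ℕ.^ m → c ℕ.< L n →
    Within n e (pt (n ℕ.+ m) (c ℕ.* k ℕ.^ m ℕ.+ r) + ζ j) → ∃[ t ] (t ℕ.≤ 2 × c ≡ cell n e t)
  locate-cell n m c r e j r<kᵐ c<L (lo , up) =
    let (t , t≤2 , eq) = between e i
          (ζ-cancel-<1 (*-cancel-<ʳ (0<h n) (<-trans lo (subst (pt′ + ζ j <_) below (+-monoˡ-< (ζ j) (pt-upper n m c r r<kᵐ))))))
          (ζ-cancel-<1 (*-cancel-<ʳ (0<h n) (≤-<-trans (subst (_≤ pt′ + ζ j) above (+-monoˡ-≤ (ζ j) (pt-lower n m c r))) (subst (λ z → pt′ + ζ j < z * h n) top up))))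
    in t , t≤2 , sym (trans (cong (λ z → (z ℤ.%ℕ L n) {{L≢0 n}}) (sym eq)) (%ℕ-unique (L n) {{L≢0 n}} c j c<L))
    where
    i = ℤ.+ c ℤ.+ j ℤ.* ℤ.+ L n
    pt′ = pt (n ℕ.+ m) (c ℕ.* k ℕ.^ m ℕ.+ r)
    ζi : ζ i ≡ ι c + ζ j * ι (L n)
    ζi = trans (ζ-+ (ℤ.+ c) _) (cong (ι c +_) (ζ-* j (ℤ.+ L n)))
    j≡ : ζ j ≡ ζ j * ι (L n) * h n
    j≡ = trans (sym (*-identityʳ (ζ j))) (trans (cong (ζ j *_) (sym (L*h n))) (sym (*-assoc (ζ j) _ _)))
    below : (ι c + 1ℚ) * h n + ζ j ≡ (ζ i + 1ℚ) * h n
    below = trans (cong ((ι c + 1ℚ) * h n +_) j≡) (trans (eq (ι c) (h n) (ζ j * ι (L n))) (cong (λ z → (z + 1ℚ) * h n) (sym ζi)))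
      where
      eq : ∀ c h u → (c + 1ℚ) * h + u * h ≡ (c + u + 1ℚ) * h
      eq = solve-∀ ring
    above : ι c * h n + ζ j ≡ ζ i * h n
    above = trans (cong (ι c * h n +_) j≡) (trans (sym (*-distribʳ-+ (h n) (ι c) _)) (cong (_* h n) (sym ζi)))
    top : ζ e + 3ℚ ≡ ζ (e ℤ.+ ℤ.+ 2) + 1ℚ
    top = sym (trans (cong (_+ 1ℚ) (trans (ζ-+ e (ℤ.+ 2)) (cong (ζ e +_) (trans (ι-suc 1) (cong (1ℚ +_) ι1))))) (+-assoc (ζ e) 2ℚ 1ℚ))

  hit : ∀ n m c r e j → r ℕ.< k ℕ.^ m → c ℕ.< L n →
    Within n e (pt (n ℕ.+ m) (c ℕ.* k ℕ.^ m ℕ.+ r) + ζ j) → 1ℚ ≤ ω n e c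
  hit n m c r e j r<kᵐ c<L within =
    let (_ , t≤2 , eq) = locate-cell n m c r e j r<kᵐ c<L within in 1≤ω n e t≤2 eq

  δ-≢ : ∀ {c j} → c ≢ j → δ c j ≡ 0ℚ
  δ-≢ {c} {j} c≢j with c ℕₚ.≟ j
  ... | yes c≡j = ⊥-elim (c≢j c≡j)
  ... | no  _   = refl

  δ-≡ : ∀ c → δ c c ≡ 1ℚ
  δ-≡ c with c ℕₚ.≟ c
  ... | yes _   = refl
  ... | no  c≢c = ⊥-elim (c≢c refl)

  Σ-δ : ∀ n (f : ℕ → ℚ) j C → 0ℚ ≤ C → (j ℕ.< n → f j ≤ C) → Σ n (λ c → δ c j * f c) ≤ C
  Σ-δ zero    f j C 0≤C h = 0≤C
  Σ-δ (suc n) f j C 0≤C h = ≤-trans (≤-reflexive (Σ-last n (λ c → δ c j * f c))) (step (n ℕₚ.≟ j))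
    where
    step : Dec (n ≡ j) → Σ n (λ c → δ c j * f c) + δ n j * f n ≤ C
    step (yes refl) = ≤-trans (≤-reflexive (trans
      (cong₂ _+_ (trans (Σ-cong n (λ c c<n → trans (cong (_* f c) (δ-≢ (ℕₚ.<⇒≢ c<n))) (*-zeroˡ (f c)))) (Σ-0 n))
                 (trans (cong (_* f n) (δ-≡ n)) (*-identityˡ (f n))))
      (+-identityˡ (f n)))) (h ℕₚ.≤-refl)
    step (no n≢j) = ≤-trans (≤-reflexive (trans
      (cong (Σ n (λ c → δ c j * f c) +_) (trans (cong (_* f n) (δ-≢ n≢j)) (*-zeroˡ (f n)))) (+-identityʳ _)))
      (Σ-δ n f j C 0≤C (λ j<n → h (ℕₚ.m≤n⇒m≤1+n j<n)))

  Σ-ω : ∀ n e (f : ℕ → ℚ) C → 0ℚ ≤ C → (∀ t → t ℕ.≤ 2 → f (cell n e t) ≤ C) →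
        Σ (L n) (λ c → ω n e c * f c) ≤ 3ℚ * C
  Σ-ω n e f C 0≤C h = ≤-trans (≤-reflexive (trans
      (Σ-cong (L n) (λ c _ → trans (*-distribʳ-+ (f c) (δ c (cell n e 0) + δ c (cell n e 1)) (δ c (cell n e 2)))
        (cong (_+ δ c (cell n e 2) * f c) (*-distribʳ-+ (f c) (δ c (cell n e 0)) (δ c (cell n e 1))))))
      (trans (Σ-+ (L n) _ (λ c → δ c (cell n e 2) * f c)) (cong (_+ Σ (L n) (λ c → δ c (cell n e 2) * f c))
        (Σ-+ (L n) (λ c → δ c (cell n e 0) * f c) (λ c → δ c (cell n e 1) * f c))))))
    (≤-trans (+-mono-≤ (+-mono-≤ (at 0 z≤n) (at 1 (s≤s z≤n))) (at 2 ℕₚ.≤-refl)) (≤-reflexive (eq C)))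
    where
    at : ∀ t → t ℕ.≤ 2 → Σ (L n) (λ c → δ c (cell n e t) * f c) ≤ C
    at t t≤2 = Σ-δ (L n) f (cell n e t) C 0≤C (λ _ → h t t≤2)
    eq : ∀ C → C + C + C ≡ (1ℚ + 1ℚ + 1ℚ) * C
    eq = solve-∀ ring

  -- ∫ φ dμ_N, for a function φ of the index of the grid point.
  E : ℕ → (ℕ → ℚ) → ℚ
  E N φ = Σ (L N) (λ x → wt N x * φ x)

  E-mono : ∀ N {φ ψ} → (∀ x → x ℕ.< L N → φ x ≤ ψ x) → E N φ ≤ E N ψ
  E-mono N h = Σ-mono (L N) (λ x x<L → *-mono-≤ˡ (0≤wt N x) (h x x<L))

  E-+ : ∀ N φ ψ → E N (λ x → φ x + ψ x) ≡ E N φ + E N ψ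
  E-+ N φ ψ = trans (Σ-cong (L N) (λ x _ → *-distribˡ-+ (wt N x) (φ x) (ψ x)))
    (Σ-+ (L N) (λ x → wt N x * φ x) (λ x → wt N x * ψ x))

  E-* : ∀ N q φ → E N (λ x → q * φ x) ≡ q * E N φ
  E-* N q φ = trans (Σ-cong (L N) (λ x _ → eq (wt N x) q (φ x))) (Σ-*ˡ (L N) q (λ x → wt N x * φ x))
    where
    eq : ∀ w q f → w * (q * f) ≡ q * (w * f)
    eq = solve-∀ ring

  E-const : ∀ N q → E N (λ _ → q) ≡ q
  E-const N q = trans (Σ-*ʳ (L N) q (wt N)) (trans (cong (_* q) (Σ-wt-total N)) (*-identityˡ q))

  E-neg : ∀ N φ → E N (λ x → - φ x) ≡ - E N φ
  E-neg N φ = trans (Σ-cong (L N) (λ x _ → sym (neg-distribʳ-* (wt N x) (φ x)))) (Σ-neg (L N) (λ x → wt N x * φ x))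

  E-close : ∀ N φ ψ η → (∀ x → x ℕ.< L N → ∣ φ x - ψ x ∣ ≤ η) → ∣ E N φ - E N ψ ∣ ≤ η
  E-close N φ ψ η h = ≤⇒∣-∣≤
    (≤-trans (E-mono N {φ} {λ x → ψ x + η} (λ x x<L → ∣-∣≤⇒≤ {φ x} {ψ x} (h x x<L)))
      (≤-reflexive (trans (E-+ N ψ (λ _ → η)) (cong (E N ψ +_) (E-const N η)))))
    (≤-trans (E-mono N {ψ} {λ x → φ x + η} (λ x x<L → ∣-∣≤⇒≥ {φ x} {ψ x} (h x x<L)))
      (≤-reflexive (trans (E-+ N φ (λ _ → η)) (cong (E N φ +_) (E-const N η)))))

  E-cells : ∀ n m φ → E (n ℕ.+ m) φ ≡
            Σ (L n) (λ c → Σ (k ℕ.^ m) (λ r → wt (n ℕ.+ m) (c ℕ.* k ℕ.^ m ℕ.+ r) * φ (c ℕ.* k ℕ.^ m ℕ.+ r)))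
  E-cells n m φ = Σ-cells n m _

  E≤cells : ∀ n m (φ ψ : ℕ → ℚ) → (∀ c r → c ℕ.< L n → r ℕ.< k ℕ.^ m → φ (c ℕ.* k ℕ.^ m ℕ.+ r) ≤ ψ c) →
            E (n ℕ.+ m) φ ≤ Σ (L n) (λ c → ψ c * mass n m c)
  E≤cells n m φ ψ h = ≤-trans (≤-reflexive (E-cells n m φ))
    (Σ-mono (L n) (λ c c<L → ≤-trans
      (Σ-mono (k ℕ.^ m) (λ r r<kᵐ → *-mono-≤ˡ (0≤wt (n ℕ.+ m) _) (h c r c<L r<kᵐ)))
      (≤-reflexive (trans (Σ-*ʳ (k ℕ.^ m) (ψ c) (λ r → wt (n ℕ.+ m) (c ℕ.* k ℕ.^ m ℕ.+ r)))
        (trans (cong (_* ψ c) (Σ-wt n m c)) (*-comm _ (ψ c)))))))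

  E-near-cells : ∀ n m (φ ψ ω : ℕ → ℚ) η → (∀ c r → c ℕ.< L n → r ℕ.< k ℕ.^ m → ∣ φ (c ℕ.* k ℕ.^ m ℕ.+ r) - ψ c ∣ ≤ ω c) →
    Σ (L n) (λ c → ω c * mass n m c) ≤ η →
    ∣ E (n ℕ.+ m) φ - Σ (L n) (λ c → ψ c * mass n m c) ∣ ≤ η
  E-near-cells n m φ ψ ω η h ω≤η = ≤⇒∣-∣≤ upper lower
    where
    M = λ c → ψ c * mass n m c
    upper : E (n ℕ.+ m) φ ≤ Σ (L n) M + η
    upper = ≤-trans (E≤cells n m φ (λ c → ψ c + ω c) (λ c r c<L r<kᵐ → ∣-∣≤⇒≤ {φ _} {ψ c} (h c r c<L r<kᵐ)))
      (≤-trans (≤-reflexive (trans (Σ-cong (L n) (λ c _ → *-distribʳ-+ (mass n m c) (ψ c) (ω c))) (Σ-+ (L n) M _)))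
        (+-monoʳ-≤ (Σ (L n) M) ω≤η))
    lower : Σ (L n) M ≤ E (n ℕ.+ m) φ + η
    lower = by-diff (diff (≤-trans (E≤cells n m (λ x → - φ x) (λ c → - ψ c + ω c)
          (λ c r c<L r<kᵐ → by-diff (diff (∣-∣≤⇒≥ {φ _} {ψ c} (h c r c<L r<kᵐ))) (eq (φ (c ℕ.* k ℕ.^ m ℕ.+ r)) (ψ c) (ω c))))
        (≤-reflexive (trans (Σ-cong (L n) (λ c _ → eq′ (ψ c) (ω c) (mass n m c))) (Σ-+ (L n) (λ c → - M c) _))))
        ⊞ diff ω≤η)
      (trans (eq″ (E (n ℕ.+ m) φ) (Σ (L n) M) (Σ (L n) (λ c → ω c * mass n m c)) η)
        (cong₂ (λ u v → u + Σ (L n) (λ c → ω c * mass n m c) - v + (η - Σ (L n) (λ c → ω c * mass n m c)))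
          (sym (Σ-neg (L n) M)) (sym (E-neg (n ℕ.+ m) φ))))
      where
      eq : ∀ f p w → (- p + w) - (- f) ≡ f + w - p
      eq = solve-∀ ring
      eq′ : ∀ p w M → (- p + w) * M ≡ - (p * M) + w * M
      eq′ = solve-∀ ring
      eq″ : ∀ e s o η → e + η - s ≡ - s + o - (- e) + (η - o)
      eq″ = solve-∀ ring

  -- The common source of convergence for the integrals of continuous functions and for the
  -- distribution functions. The two η account for replacing φ and φ′ by the step function ψ, the
  -- middle term for the change of the cell masses.
  E-compare : ∀ n j m₀ m₀′ (φ φ′ ψ ω : ℕ → ℚ) η C → 0ℚ ≤ C →
    let m = j ℕ.+ m₀; m′ = j ℕ.+ m₀′ in
    (∀ c → c ℕ.< L n → ∣ ψ c ∣ ≤ C) →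
    (∀ c r → c ℕ.< L n → r ℕ.< k ℕ.^ m  → ∣ φ  (c ℕ.* k ℕ.^ m  ℕ.+ r) - ψ c ∣ ≤ ω c) →
    (∀ c r → c ℕ.< L n → r ℕ.< k ℕ.^ m′ → ∣ φ′ (c ℕ.* k ℕ.^ m′ ℕ.+ r) - ψ c ∣ ≤ ω c) →
    (∀ m → Σ (L n) (λ c → ω c * mass n m c) ≤ η) →
    ∣ E (n ℕ.+ m) φ - E (n ℕ.+ m′) φ′ ∣ ≤ η + 2ℚ * C * pow θ j + η
  E-compare n j m₀ m₀′ φ φ′ ψ ω η C 0≤C ψ≤C hφ hφ′ ω≤η = ∣-∣-triangle (E (n ℕ.+ m) φ) (Σ (L n) (λ c → ψ c * mass n m′ c)) (E (n ℕ.+ m′) φ′)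
    (∣-∣-triangle (E (n ℕ.+ m) φ) (Σ (L n) (λ c → ψ c * mass n m c)) (Σ (L n) (λ c → ψ c * mass n m′ c))
      (E-near-cells n m φ ψ ω η hφ (ω≤η m)) (Σ-mass-diff n j m₀ m₀′ ψ C 0≤C ψ≤C))
    (≤-trans (≤-reflexive (∣p-q∣-comm (Σ (L n) (λ c → ψ c * mass n m′ c)) (E (n ℕ.+ m′) φ′))) (E-near-cells n m′ φ′ ψ ω η hφ′ (ω≤η m′)))
    where
    m = j ℕ.+ m₀
    m′ = j ℕ.+ m₀′

  -- The ghost measure

  ν : ℕ → C⟨𝕋⟩ → ℝ
  ν N g = empirical∫ k (zaremba k) N {{zaremba-blockSum≢0 k N}} g

  G : C⟨𝕋⟩ → ℕ → ℕ → ℕ → ℚ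
  G g N i x = approx (apply g (fromℚ (pt N x))) i

  -- At a fixed index i an empirical integral is a finite rational average, so estimates between
  -- reals become estimates for `E`.
  approx-ν : ∀ N g i → approx (ν N g) i ≡ E N (G g N i)
  approx-ν N g i = trans (cong₂ _*_ one-over (trans (approx-∑ (blockLength k N) (λ x → fromℕ (zaremba k (word N x)) *ᵣ apply g (fromℚ (gridPoint k N x))) i)
      (trans (cong (λ l → Σ l (λ x → ((ℤ.+ zaremba k (word N x)) / 1) * approx (apply g (fromℚ (gridPoint k N x))) i)) (L≡blockLength N)) (Σ-cong (L N) (λ x _ → cong₂ (λ u y → u * approx (apply g (fromℚ y)) i) (trans (sym (ζ≡/1 (ℤ.+ zaremba k (word N x)))) (sym (Z≡ (word N x)))) (gridPoint≡pt N x))))))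
    (trans (sym (Σ-*ˡ (L N) (iP N) (λ x → Z (word N x) * G g N i x)))
      (Σ-cong (L N) (λ x _ → eq (iP N) (Z (word N x)) (G g N i x))))
    where
    one-over : ((ℤ.+ 1) / blockSum k (zaremba k) N) {{zaremba-blockSum≢0 k N}} ≡ iP N
    one-over = trans (/≡*inv 1 (blockSum k (zaremba k) N) {{zaremba-blockSum≢0 k N}})
      (trans (cong₂ (λ u v → u * inv v) ι1 (sym (P≡blockSum N))) (*-identityˡ (iP N)))
    eq : ∀ p z g → p * (z * g) ≡ z * p * g
    eq = solve-∀ ring

  h≤θⁿ : ∀ n → h n ≤ pow θ n
  h≤θⁿ zero = *-cancel-≤ (0<ιL 0) (≤-trans (≤-reflexive (L*h 0)) (≤-trans (1≤ι (1≤L 0)) (≤-reflexive (sym (*-identityʳ _)))))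
  h≤θⁿ (suc n) = *-cancel-≤ 0<3 (≤-trans (by-diff {3ℚ * h (suc n)} {2ℚ * h n} {r = (K - 2ℚ) * (2ℚ * h (suc n)) + h (suc n)} (0≤K-2 ⊠ ((0≤1 ⊞ 0≤1) ⊠ 0≤h (suc n)) ⊞ 0≤h (suc n))
      (trans (cong (λ z → 2ℚ * z - 3ℚ * h (suc n)) (h-suc n)) (eq K (h (suc n)))))
    (≤-trans (*-mono-≤ˡ (0≤1 ⊞ 0≤1) (h≤θⁿ n)) (≤-reflexive (trans (cong (_* pow θ n) (sym 3θ≡2)) (*-assoc 3ℚ θ (pow θ n))))))
    where
    eq : ∀ K h → (1ℚ + 1ℚ) * (K * h) - (1ℚ + 1ℚ + 1ℚ) * h ≡ (K - (1ℚ + 1ℚ)) * ((1ℚ + 1ℚ) * h) + h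
    eq = solve-∀ ring

  h-small : ∀ {ε} → 0ℚ < ε → Ev (λ n → h n ≤ ε)
  h-small 0<ε = let (N , H) = Θ.decay 1ℚ 0≤1 0<ε in
    N , λ n N≤n → ≤-trans (h≤θⁿ n) (≤-trans (≤-reflexive (sym (*-identityˡ (pow θ n)))) (H n N≤n))

  corner-close : ∀ n m c r → r ℕ.< k ℕ.^ m → ∣ pt (n ℕ.+ m) (c ℕ.* k ℕ.^ m ℕ.+ r) - pt n c ∣ ≤ h n
  corner-close n m c r r<kᵐ = ≤⇒∣-∣≤
    (≤-trans (<⇒≤ (pt-upper n m c r r<kᵐ)) (≤-reflexive (eq (ι c) (h n))))
    (≤-trans (pt-lower n m c r) (by-diff (0≤h n) (p+q-p≡q (pt (n ℕ.+ m) (c ℕ.* k ℕ.^ m ℕ.+ r)) (h n))))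
    where
    eq : ∀ c h → (c + 1ℚ) * h ≡ c * h + h
    eq = solve-∀ ring

  fromℚ-close : ∀ {p q δ} → ∣ p - q ∣ ≤ δ → ∣ fromℚ p -ᵣ fromℚ q ∣ᵣ ≤ᵣ fromℚ δ
  fromℚ-close {p} {q} {δ} h = Close⇒≤ᵣ {δ} (fromℚ p) (fromℚ q) (0 , λ _ _ → h)

  module _ (g : C⟨𝕋⟩) where
    corner : ℕ → ℕ → ℕ → ℚ
    corner n i c = approx (apply g (fromℚ (pt n c))) i

    oscillation : ∀ {ε} → 0ℚ < ε → ∃[ n ] (∀ m → Ev (λ i → ∀ c → c ℕ.< L n → ∀ r → r ℕ.< k ℕ.^ m →
      ∣ G g (n ℕ.+ m) i (c ℕ.* k ℕ.^ m ℕ.+ r) - corner n i c ∣ ≤ ε))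
    oscillation {ε} 0<ε =
      let (δ , 0<δ , uc) = uniformlyContinuous g (½ * ε) (0<½* 0<ε)
          (n , hn) = h-small 0<δ
      in n , λ m → Ev-∀< (L n) (λ c c<L → Ev-∀< (k ℕ.^ m) (λ r r<kᵐ → Ev-map (λ i l → ≤-trans l (≤-reflexive (½+½ ε)))
        (≤ᵣ⇒Close {½ * ε} {½ * ε} (apply g (fromℚ (pt (n ℕ.+ m) (c ℕ.* k ℕ.^ m ℕ.+ r)))) (apply g (fromℚ (pt n c))) (0<½* 0<ε) (uc (fromℚ (pt (n ℕ.+ m) (c ℕ.* k ℕ.^ m ℕ.+ r))) (fromℚ (pt n c))
          (fromℚ-close {pt (n ℕ.+ m) (c ℕ.* k ℕ.^ m ℕ.+ r)} {pt n c} (≤-trans (corner-close n m c r r<kᵐ) (hn n ℕₚ.≤-refl)))))))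

    -- Uniform continuity replaces g by its values at the left ends of the cells of one level n;
    -- after that only the convergence of the masses of these cells matters.
    ν-cauchy : CauchySequence (λ N → ν N g)
    ν-cauchy ε 0<ε = with-n (oscillation (0<¼ 0<ε))
      where
      with-n : ∃[ n ] (∀ m → Ev (λ i → ∀ c → c ℕ.< L n → ∀ r → r ℕ.< k ℕ.^ m →
        ∣ G g (n ℕ.+ m) i (c ℕ.* k ℕ.^ m ℕ.+ r) - corner n i c ∣ ≤ ¼ ε)) → ∃[ N ] (∀ m n → N ℕ.≤ m → N ℕ.≤ n → Close ε (ν m g) (ν n g))
      with-n (n , osc) = with-C (common-bound (L n) (λ c i → corner n i c) (λ c → cauchy⇒bounded (λ i → corner n i c) (cauchy (apply g (fromℚ (pt n c))))))
        where
        with-C : ∃[ C ] (0ℚ ≤ C × Ev (λ i → ∀ c → c ℕ.< L n → ∣ corner n i c ∣ ≤ C)) → ∃[ N ] (∀ m n → N ℕ.≤ m → N ℕ.≤ n → Close ε (ν m g) (ν n g))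
        with-C (C , 0≤C , bounded) = with-j (Θ.decay (2ℚ * C) ((0≤1 ⊞ 0≤1) ⊠ 0≤C) (0<¼ 0<ε))
          where
          with-j : ∃[ j ] (∀ i → j ℕ.≤ i → 2ℚ * C * pow θ i ≤ ¼ ε) → ∃[ N ] (∀ m n → N ℕ.≤ m → N ℕ.≤ n → Close ε (ν m g) (ν n g))
          with-j (j , hj) = n ℕ.+ j , λ N N′ N≥ N′≥ → main (split-index (n ℕ.+ j) N≥) (split-index (n ℕ.+ j) N′≥)
            where
            main : ∀ {N N′} → ∃[ m ] N ≡ n ℕ.+ j ℕ.+ m → ∃[ m ] N′ ≡ n ℕ.+ j ℕ.+ m → Close ε (ν N g) (ν N′ g)
            main (m₀ , refl) (m₀′ , refl) = subst₂ (λ N N′ → Close ε (ν N g) (ν N′ g)) (sym (ℕₚ.+-assoc n j m₀)) (sym (ℕₚ.+-assoc n j m₀′))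
              (Ev-zip (λ i → λ { (b , o) o′ → subst (_≤ ε) (sym (cong₂ (λ u v → ∣ u - v ∣) (approx-ν (n ℕ.+ (j ℕ.+ m₀)) g i) (approx-ν (n ℕ.+ (j ℕ.+ m₀′)) g i)))
                 (≤-trans (E-compare n j m₀ m₀′ (G g (n ℕ.+ (j ℕ.+ m₀)) i) (G g (n ℕ.+ (j ℕ.+ m₀′)) i) (corner n i) (λ _ → ¼ ε) (¼ ε) C 0≤C b
                    (λ c r c<L → o c c<L r) (λ c r c<L → o′ c c<L r) total)
                  (≤-trans (+-monoˡ-≤ (¼ ε) (+-monoʳ-≤ (¼ ε) (hj j ℕₚ.≤-refl))) (¼×3≤ 0<ε))) })
                (Ev-× bounded (osc (j ℕ.+ m₀))) (osc (j ℕ.+ m₀′)))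
              where
              total : ∀ m → Σ (L n) (λ c → ¼ ε * mass n m c) ≤ ¼ ε
              total m = ≤-reflexive (trans (Σ-*ˡ (L n) (¼ ε) (mass n m)) (trans (cong (¼ ε *_) (Σ-mass n m)) (*-identityʳ (¼ ε))))

    open Limit (λ N → ν N g) ν-cauchy public using ()
      renaming (limit to ghost∫; limit-close to ghost∫-close)

  ghost∫-additive : ∀ f g h → (∀ x → apply h x ≃ᵣ apply f x +ᵣ apply g x) → ghost∫ h ≃ᵣ ghost∫ f +ᵣ ghost∫ g
  ghost∫-additive f g h h≃ ε 0<ε = main (Ev-× (ghost∫-close h (0<¼ 0<ε)) (Ev-× (ghost∫-close f (0<¼ 0<ε)) (ghost∫-close g (0<¼ 0<ε))))
    where
    main : Ev (λ N → Close (¼ ε) (ν N h) (ghost∫ h) × Close (¼ ε) (ν N f) (ghost∫ f) × Close (¼ ε) (ν N g) (ghost∫ g)) → Close ε (ghost∫ h) (ghost∫ f +ᵣ ghost∫ g)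
    main (N , H) = let (ch , cf , cg) = H N ℕₚ.≤-refl in
      Ev-map (λ i l → ≤-trans l (≤-reflexive (eq ε))) (Close-trans (ghost∫ h) (ν N f +ᵣ ν N g) (ghost∫ f +ᵣ ghost∫ g)
        (Close-trans (ghost∫ h) (ν N h) (ν N f +ᵣ ν N g) (Close-sym (ν N h) (ghost∫ h) ch) middle)
        (Close-+ (ν N f) (ν N g) (ghost∫ f) (ghost∫ g) cf cg))
      where
      eq : ∀ ε → ½ * (½ * ε) + ½ * (½ * ε) + (½ * (½ * ε) + ½ * (½ * ε)) ≡ ε
      eq = solve-∀ ring
      middle : Close (¼ ε) (ν N h) (ν N f +ᵣ ν N g)
      middle = Ev-map (λ i l → subst (_≤ ¼ ε) (sym (cong₂ (λ u v → ∣ u - v ∣) (approx-ν N h i)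
          (trans (cong₂ _+_ (approx-ν N f i) (approx-ν N g i)) (sym (E-+ N (G f N i) (G g N i))))))
          (E-close N (G h N i) (λ x → G f N i x + G g N i x) (¼ ε) l))
        (Ev-∀< (L N) (λ x _ → h≃ (fromℚ (pt N x)) (¼ ε) (0<¼ 0<ε)))

  ghost∫-homogeneous : ∀ c f h → (∀ x → apply h x ≃ᵣ c *ᵣ apply f x) → ghost∫ h ≃ᵣ c *ᵣ ghost∫ f
  ghost∫-homogeneous c f h h≃ ε 0<ε = main (Close-*ˡ c (0<¼ 0<ε))
    where
    main : ∃[ δ ] (0ℚ < δ × (∀ x y → Close δ x y → Close (¼ ε) (c *ᵣ x) (c *ᵣ y))) → Close ε (ghost∫ h) (c *ᵣ ghost∫ f)
    main (δ , 0<δ , scale) = main′ (Ev-× (ghost∫-close h (0<¼ 0<ε)) (ghost∫-close f 0<δ))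
      where
      main′ : Ev (λ N → Close (¼ ε) (ν N h) (ghost∫ h) × Close δ (ν N f) (ghost∫ f)) → Close ε (ghost∫ h) (c *ᵣ ghost∫ f)
      main′ (N , H) = let (ch , cf) = H N ℕₚ.≤-refl in
        Ev-map (λ i l → ≤-trans l (¼×3≤ 0<ε)) (Close-trans (ghost∫ h) (c *ᵣ ν N f) (c *ᵣ ghost∫ f)
          (Close-trans (ghost∫ h) (ν N h) (c *ᵣ ν N f) (Close-sym (ν N h) (ghost∫ h) ch) middle)
          (scale (ν N f) (ghost∫ f) cf))
        where
        middle : Close (¼ ε) (ν N h) (c *ᵣ ν N f)
        middle = Ev-map (λ i l → subst (_≤ ¼ ε) (sym (cong₂ (λ u v → ∣ u - v ∣) (approx-ν N h i)
            (trans (cong (approx c i *_) (approx-ν N f i)) (sym (E-* N (approx c i) (G f N i))))))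
            (E-close N (G h N i) (λ x → approx c i * G f N i x) (¼ ε) l))
          (Ev-∀< (L N) (λ x _ → h≃ (fromℚ (pt N x)) (¼ ε) (0<¼ 0<ε)))

  ghost∫-≤ : ∀ g y → (∀ {ε} → 0ℚ < ε → Ev (λ N → Below ε (ν N g) y)) → ghost∫ g ≤ᵣ y
  ghost∫-≤ g y h ε 0<ε = main (Ev-× (ghost∫-close g (0<½* 0<ε)) (h (0<½* 0<ε)))
    where
    main : Ev (λ N → Close (½ * ε) (ν N g) (ghost∫ g) × Below (½ * ε) (ν N g) y) → Below ε (ghost∫ g) y
    main (N , H) = let (cg , b) = H N ℕₚ.≤-refl in Below-≡ {x = ghost∫ g} {y} (½+½ ε)
      (Below-trans (ghost∫ g) (ν N g) y (Close⇒Below (ghost∫ g) (ν N g) (Close-sym (ν N g) (ghost∫ g) cg)) b)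

  ghost∫-≥ : ∀ g y → (∀ {ε} → 0ℚ < ε → Ev (λ N → Below ε y (ν N g))) → y ≤ᵣ ghost∫ g
  ghost∫-≥ g y h ε 0<ε = main (Ev-× (ghost∫-close g (0<½* 0<ε)) (h (0<½* 0<ε)))
    where
    main : Ev (λ N → Close (½ * ε) (ν N g) (ghost∫ g) × Below (½ * ε) y (ν N g)) → Below ε y (ghost∫ g)
    main (N , H) = let (cg , b) = H N ℕₚ.≤-refl in Below-≡ {x = y} {ghost∫ g} (½+½ ε)
      (Below-trans y (ν N g) (ghost∫ g) b (Close⇒Below (ν N g) (ghost∫ g) cg))

  ν-below : ∀ g N {ε} (φ : ℕ → ℚ) → (∀ x → x ℕ.< L N → Ev (λ i → G g N i x ≤ φ x + ε)) →
            Below ε (ν N g) (fromℚ (E N φ))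
  ν-below g N {ε} φ H = Ev-map (λ i l → ≤-trans (≤-reflexive (approx-ν N g i)) (≤-trans (E-mono N l)
      (≤-reflexive (trans (E-+ N φ (λ _ → ε)) (cong (E N φ +_) (E-const N ε))))))
    (Ev-∀< (L N) H)

  ν-above : ∀ g N {ε} (φ : ℕ → ℚ) → (∀ x → x ℕ.< L N → Ev (λ i → φ x ≤ G g N i x + ε)) →
            Below ε (fromℚ (E N φ)) (ν N g)
  ν-above g N {ε} φ H = Ev-map (λ i l → ≤-trans (E-mono N l)
      (≤-reflexive (trans (E-+ N (G g N i) (λ _ → ε)) (cong₂ _+_ (sym (approx-ν N g i)) (E-const N ε)))))
    (Ev-∀< (L N) H)

  ghost∫-positive : ∀ f → (∀ x → 0ℝ ≤ᵣ apply f x) → 0ℝ ≤ᵣ ghost∫ f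
  ghost∫-positive f 0≤f = ghost∫-≥ f 0ℝ (λ {ε} 0<ε → 0 , λ N _ →
    Ev-map (λ i l → subst (_≤ approx (ν N f) i + ε) (E-const N 0ℚ) l)
      (ν-above f N (λ _ → 0ℚ) (λ x _ → 0≤f (fromℚ (pt N x)) ε 0<ε)))

  ghost∫-normalised : ∀ f → (∀ x → apply f x ≃ᵣ 1ℝ) → ghost∫ f ≃ᵣ 1ℝ
  ghost∫-normalised f f≃1 ε 0<ε = main (ghost∫-close f (0<½* 0<ε))
    where
    main : Ev (λ N → Close (½ * ε) (ν N f) (ghost∫ f)) → Close ε (ghost∫ f) 1ℝ
    main (N , H) = Ev-map (λ i l → ≤-trans l (≤-reflexive (½+½ ε)))
      (Close-trans (ghost∫ f) (ν N f) 1ℝ (Close-sym (ν N f) (ghost∫ f) (H N ℕₚ.≤-refl))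
        (Ev-map (λ i l → subst (_≤ ½ * ε) (sym (cong₂ (λ u v → ∣ u - v ∣) (approx-ν N f i) (sym (E-const N 1ℚ))))
            (E-close N (G f N i) (λ _ → 1ℚ) (½ * ε) l))
          (Ev-∀< (L N) (λ x _ → f≃1 (fromℚ (pt N x)) (½ * ε) (0<½* 0<ε)))))

  μ : ProbabilityMeasure
  μ = record
    { ∫           = ghost∫
    ; additive    = ghost∫-additive
    ; homogeneous = ghost∫-homogeneous
    ; positive    = ghost∫-positive
    ; normalised  = ghost∫-normalised
    }

  μ-isGhostMeasure : IsGhostMeasure k (zaremba k) (zaremba-blockSum≢0 k) μ
  μ-isGhostMeasure g ε 0<ε = proj₁ (ghost∫-close g 0<ε) , close
    where
    close : ∀ n → proj₁ (ghost∫-close g 0<ε) ℕ.≤ n → ∣ ν n g -ᵣ ghost∫ g ∣ᵣ ≤ᵣ fromℚ ε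
    close n n≥ = Close⇒≤ᵣ {ε} (ν n g) (ghost∫ g) (proj₂ (ghost∫-close g 0<ε) n n≥)

  -- Arcs and atoms

  private
    eh≤[e+3]h : ∀ n e → ζ e * h n ≤ (ζ e + 3ℚ) * h n
    eh≤[e+3]h n e = by-diff (0≤3 ⊠ 0≤h n) (eq (ζ e) (h n))
      where
      eq : ∀ e h → (e + (1ℚ + 1ℚ + 1ℚ)) * h - e * h ≡ (1ℚ + 1ℚ + 1ℚ) * h
      eq = solve-∀ ring

  arcAt : ℕ → ℤ → Arc
  arcAt n e = arc (ζ e * h n) ((ζ e + 3ℚ) * h n) (eh≤[e+3]h n e)

  -- At the grid points g is at most ω + ε: in the window because g ≤ 1, elsewhere because g
  -- vanishes off the arc. Integrating ω costs three cell masses.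
  arc-measure : ∀ n e T → 0ℚ ≤ T → (∀ m t → t ℕ.≤ 2 → mass n m (cell n e t) ≤ T) → ArcMeasure≤ μ (arcAt n e) (fromℚ (3ℚ * T))
  arc-measure n e T 0≤T small g 0≤g g≤1 support = ghost∫-≤ g (fromℚ (3ℚ * T)) λ {ε} 0<ε → n , λ N n≤N → step 0<ε (split-index n n≤N)
    where
    step : ∀ {ε N} → 0ℚ < ε → ∃[ m ] N ≡ n ℕ.+ m → Below ε (ν N g) (fromℚ (3ℚ * T))
    step {ε} 0<ε (m , refl) = Ev-map (λ i H → ≤-trans (≤-reflexive (approx-ν (n ℕ.+ m) g i))
        (≤-trans (E≤cells n m (G g (n ℕ.+ m) i) (λ c → ω n e c + ε) (λ c r c<L r<kᵐ → H c c<L r r<kᵐ))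
        (≤-trans (≤-reflexive (trans (Σ-cong (L n) (λ c _ → *-distribʳ-+ (mass n m c) (ω n e c) ε))
            (trans (Σ-+ (L n) (λ c → ω n e c * mass n m c) (λ c → ε * mass n m c))
              (cong (Σ (L n) (λ c → ω n e c * mass n m c) +_) (trans (Σ-*ˡ (L n) ε (mass n m)) (trans (cong (ε *_) (Σ-mass n m)) (*-identityʳ ε)))))))
          (+-monoˡ-≤ ε (Σ-ω n e (mass n m) T 0≤T (small m))))))
      (Ev-∀< (L n) (λ c c<L → Ev-∀< (k ℕ.^ m) (λ r r<kᵐ → bound c r c<L r<kᵐ (1ℚ ≤? ω n e c))))
      where
      -- The rational test 1 ≤ ω stands in for membership in the arc; when it fails, `hit` shows
      -- that the grid point lies outside.
      bound : ∀ c r → c ℕ.< L n → r ℕ.< k ℕ.^ m → Dec (1ℚ ≤ ω n e c) →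
              Ev (λ i → G g (n ℕ.+ m) i (c ℕ.* k ℕ.^ m ℕ.+ r) ≤ ω n e c + ε)
      bound c r c<L r<kᵐ (yes 1≤ω) = Ev-map (λ i l → ≤-trans l (+-monoˡ-≤ ε 1≤ω)) (g≤1 (fromℚ (pt (n ℕ.+ m) (c ℕ.* k ℕ.^ m ℕ.+ r))) ε 0<ε)
      bound c r c<L r<kᵐ (no 1≰ω) = Ev-map (λ i l → ≤-trans l (+-monoˡ-≤ ε (0≤ω n e c))) (support (fromℚ y) outside ε 0<ε)
        where
        y = pt (n ℕ.+ m) (c ℕ.* k ℕ.^ m ℕ.+ r)
        outside : ¬ (fromℚ y ∈ arcAt n e)
        outside y∈ = let (j , within) = ∈-elim (eh≤[e+3]h n e) y y∈ in 1≰ω (hit n m c r e j r<kᵐ c<L within)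

  emptyArc : Arc
  emptyArc = arc 0ℚ 0ℚ ≤-refl

  emptyArc-measure : ArcMeasure≤ μ emptyArc (fromℚ 0ℚ)
  emptyArc-measure g 0≤g g≤1 support = ghost∫-≤ g (fromℚ 0ℚ) λ {ε} 0<ε → 0 , λ N _ →
    Ev-map (λ i l → ≤-trans l (≤-reflexive (cong (_+ ε) (E-const N 0ℚ)))) (ν-below g N (λ _ → 0ℚ) (λ x _ → support (fromℚ (pt N x)) (outside {pt N x}) ε 0<ε))
    where
    outside : ∀ {q} → ¬ (fromℚ q ∈ emptyArc)
    outside {q} q∈ = let (j , lo , up) = ∈-elim {0ℚ} {0ℚ} ≤-refl q q∈ in <-irrefl refl (<-trans lo up)

  -- The margin ½ h n on both sides absorbs the error of rational approximations to x.
  Located : ℕ → ℤ → ℝ → Set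
  Located n e x = Ev (λ i → (ζ e + ½) * h n ≤ approx x i × approx x i ≤ (ζ e + 2ℚ + ½) * h n)

  locate : ∀ n x → ∃[ e ] Located n e x
  locate n x = go (approx-close x (0<½* (0<h n)))
    where
    go : Ev (λ N → ∀ i → N ℕ.≤ i → ∣ approx x N - approx x i ∣ ≤ ½ * h n) → ∃[ e ] Located n e x
    -- The window begins one cell before the cell of q, so q is at least h n from both ends, and
    -- approximations within ½ h n of q leave the margin ½ h n.
    go (N , H) = ℤ.pred f , N , λ i N≤i → lo i (H N ℕₚ.≤-refl i N≤i) , up i (H N ℕₚ.≤-refl i N≤i)
      where
      q = approx x N
      fl = floor-bounds (q * ι (L n))
      f = proj₁ fl
      pf : ζ f ≡ ζ (ℤ.pred f) + 1ℚ
      pf = trans (cong ζ (sym (ℤₚ.suc-pred f))) (ζ-suc (ℤ.pred f))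
      q≡ : q * ι (L n) * h n ≡ q
      q≡ = trans (*-assoc q _ _) (trans (cong (q *_) (L*h n)) (*-identityʳ q))
      f≤ : (ζ (ℤ.pred f) + 1ℚ) * h n ≤ q
      f≤ = subst₂ (λ u v → u * h n ≤ v) pf q≡ (*-mono-≤ʳ (0≤h n) (proj₁ (proj₂ fl)))
      ≤f : q ≤ (ζ (ℤ.pred f) + 1ℚ + 1ℚ) * h n
      ≤f = subst₂ (λ u v → v ≤ (u + 1ℚ) * h n) pf q≡ (*-mono-≤ʳ (0≤h n) (<⇒≤ (proj₂ (proj₂ fl))))
      lo : ∀ i → ∣ q - approx x i ∣ ≤ ½ * h n → (ζ (ℤ.pred f) + ½) * h n ≤ approx x i
      lo i d = by-diff (diff f≤ ⊞ diff (∣-∣≤⇒≤ {q} {approx x i} d)) (eq (ζ (ℤ.pred f)) (h n) q (approx x i))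
        where
        eq : ∀ e h q x → x - (e + ½) * h ≡ q - (e + 1ℚ) * h + (x + ½ * h - q)
        eq = solve-∀ ring
      up : ∀ i → ∣ q - approx x i ∣ ≤ ½ * h n → approx x i ≤ (ζ (ℤ.pred f) + 2ℚ + ½) * h n
      up i d = by-diff (diff ≤f ⊞ diff (∣-∣≤⇒≥ {q} {approx x i} d)) (eq (ζ (ℤ.pred f)) (h n) q (approx x i))
        where
        eq : ∀ e h q x → (e + (1ℚ + 1ℚ) + ½) * h - x ≡ (e + 1ℚ + 1ℚ) * h - q + (q + ½ * h - x)
        eq = solve-∀ ring

  located-∈ : ∀ n e x y j → Located n e x → Close (¼ (h n)) y (x +ᵣ fromℤ j) → y ∈ arcAt n e
  located-∈ n e x y j loc cl = ∈-intro (eh≤[e+3]h n e) y (ℤ.- j) (0<¼ (0<h n)) (Ev-zip step loc cl)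
    where
    step : ∀ i → (ζ e + ½) * h n ≤ approx x i × approx x i ≤ (ζ e + 2ℚ + ½) * h n → ∣ approx y i - (approx x i + j / 1) ∣ ≤ ¼ (h n) →
      ζ e * h n + ¼ (h n) ≤ approx y i + ζ (ℤ.- j) × approx y i + ζ (ℤ.- j) + ¼ (h n) ≤ (ζ e + 3ℚ) * h n
    step i (lo , up) d = subst (λ z → ζ e * h n + ¼ (h n) ≤ approx y i + z) (sym (ζ-neg j))
        (by-diff (diff lo ⊞ diff (∣-∣≤⇒≥ {approx y i} {approx x i + ζ j} d′)) (eq (ζ e) (h n) (approx x i) (approx y i) (ζ j)))
      , subst (λ z → approx y i + z + ¼ (h n) ≤ (ζ e + 3ℚ) * h n) (sym (ζ-neg j))
        (by-diff (diff up ⊞ diff (∣-∣≤⇒≤ {approx y i} {approx x i + ζ j} d′)) (eq′ (ζ e) (h n) (approx x i) (approx y i) (ζ j)))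
      where
      d′ : ∣ approx y i - (approx x i + ζ j) ∣ ≤ ¼ (h n)
      d′ = subst (λ z → ∣ approx y i - (approx x i + z) ∣ ≤ ¼ (h n)) (sym (ζ≡/1 j)) d
      eq : ∀ e h x y j → y + (- j) - (e * h + ½ * (½ * h)) ≡ x - (e + ½) * h + (y + ½ * (½ * h) - (x + j))
      eq = solve-∀ ring
      eq′ : ∀ e h x y j → (e + (1ℚ + 1ℚ + 1ℚ)) * h - (y + (- j) + ½ * (½ * h)) ≡ (e + (1ℚ + 1ℚ) + ½) * h - x + (x + j + ½ * (½ * h) - y)
      eq′ = solve-∀ ring

  noAtoms : NoAtoms μ
  noAtoms x ε 0<ε = goN (Θ.decay 3ℚ 0≤3 0<ε)
    where
    goN : ∃[ n ] (∀ m → n ℕ.≤ m → 3ℚ * pow θ m ≤ ε) → Covered (ArcMeasure≤ μ) (_≈𝕋 x) ε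
    goN (n , small) = cover (ArcMeasure≤ μ) (_≈𝕋 x) I w measures total (λ y y≈x ¬cover → ¬cover (0 , covered y y≈x))
      where
      e = proj₁ (locate n x)
      w : ℕ → ℚ
      w zero    = 3ℚ * pow θ n
      w (suc _) = 0ℚ
      I : ℕ → Arc
      I zero    = arcAt n e
      -- One arc covers the point; empty arcs extend it to the required infinite sequence.
      I (suc _) = emptyArc
      measures : ∀ i → ArcMeasure≤ μ (I i) (fromℚ (w i))
      measures zero    = arc-measure n e (pow θ n) (pow-nonneg Θ.0≤d n) (λ m t _ → mass≤θⁿ n m (cell n e t) (cell<L n e t))
      measures (suc _) = emptyArc-measure
      total : ∀ N → Σ N w ≤ ε
      total zero    = <⇒≤ 0<ε
      total (suc N) = ≤-trans (≤-reflexive (trans (cong (3ℚ * pow θ n +_) (Σ-0 N)) (+-identityʳ _))) (small n ℕₚ.≤-refl)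
      covered : ∀ y → y ≈𝕋 x → y ∈ arcAt n e
      covered y (j , y≃) = located-∈ n e x y j (proj₂ (locate n x)) (y≃ (¼ (h n)) (0<¼ (0<h n)))

  -- The distribution function

  χ : ℚ → ℕ → ℕ → ℚ
  χ q N x = indicator (pt N x ≤? q)

  0≤indicator : ∀ {A : Set} (a? : Dec A) → 0ℚ ≤ indicator a?
  0≤indicator (yes _) = 0≤1
  0≤indicator (no _)  = ≤-refl

  indicator≤1 : ∀ {A : Set} (a? : Dec A) → indicator a? ≤ 1ℚ
  indicator≤1 (yes _) = ≤-refl
  indicator≤1 (no _)  = 0≤1

  -- μ_N([0 , q])
  cdf : ℕ → ℚ → ℚ
  cdf N q = E N (χ q N)

  cell-hit : ∀ n e c → c ℕ.< L n → ζ e < ι c + 1ℚ → ι c < ζ e + 3ℚ → 1ℚ ≤ ω n e c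
  cell-hit n e c c<L lo up = go (between e (ℤ.+ c) (ζ-cancel-<1 lo) (ζ-cancel-<1 (subst (ι c <_) top up)))
    where
    top : ζ e + 3ℚ ≡ ζ (e ℤ.+ ℤ.+ 2) + 1ℚ
    top = sym (trans (cong (_+ 1ℚ) (trans (ζ-+ e (ℤ.+ 2)) (cong (ζ e +_) (trans (ι-suc 1) (cong (1ℚ +_) ι1))))) (+-assoc (ζ e) 2ℚ 1ℚ))
    go : ∃[ t ] (t ℕ.≤ 2 × ℤ.+ c ≡ e ℤ.+ ℤ.+ t) → 1ℚ ≤ ω n e c
    go (t , t≤2 , eq) = 1≤ω n e t≤2 (sym (trans (cong (λ z → (z ℤ.%ℕ L n) {{L≢0 n}}) (trans (sym eq) eq′)) (%ℕ-unique (L n) {{L≢0 n}} c (ℤ.+ 0) c<L)))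
      where
      eq′ : ℤ.+ c ≡ ℤ.+ c ℤ.+ ℤ.+ 0 ℤ.* ℤ.+ L n
      eq′ = sym (trans (cong (λ z → ℤ.+ c ℤ.+ z) (ℤₚ.*-zeroˡ (ℤ.+ L n))) (ℤₚ.+-identityʳ (ℤ.+ c)))

  beside : ∀ n e c → c ℕ.< L n → 1ℚ ≤ ω n e c ⊎ ι c + 1ℚ ≤ ζ e ⊎ ζ e + 3ℚ ≤ ι c
  beside n e c c<L with ι c + 1ℚ ≤? ζ e | ζ e + 3ℚ ≤? ι c
  ... | yes l | _     = inj₂ (inj₁ l)
  ... | no _  | yes r = inj₂ (inj₂ r)
  ... | no l  | no r  = inj₁ (cell-hit n e c c<L (≰⇒> l) (≰⇒> r))

  step : ℕ → ℤ → ℕ → ℚ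
  step n e c = indicator (ι c + 1ℚ ≤? ζ e)

  module _ (n m c r : ℕ) (c<L : c ℕ.< L n) (r<kᵐ : r ℕ.< k ℕ.^ m) (e : ℤ) (q : ℚ) (within : Within n e q) where
    private
      y = pt (n ℕ.+ m) (c ℕ.* k ℕ.^ m ℕ.+ r)
      eh<q = proj₁ within
      q<[e+3]h = proj₂ within

    left-of : ι c + 1ℚ ≤ ζ e → y < q
    left-of l = <-trans (pt-upper n m c r r<kᵐ) (≤-<-trans (*-mono-≤ʳ (0≤h n) l) eh<q)

    right-of : ζ e + 3ℚ ≤ ι c → q < y
    right-of l = <-≤-trans q<[e+3]h (≤-trans (*-mono-≤ʳ (0≤h n) l) (pt-lower n m c r))

    -- Cells to the left of the window lie entirely in [0, q] and cells to its right entirely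
    -- outside, so the step function can be wrong only in the window, where ω pays for it.
    χ-step : ∣ χ q (n ℕ.+ m) (c ℕ.* k ℕ.^ m ℕ.+ r) - step n e c ∣ ≤ ω n e c
    χ-step = go (beside n e c c<L) (y ≤? q) (ι c + 1ℚ ≤? ζ e)
      where
      go : 1ℚ ≤ ω n e c ⊎ ι c + 1ℚ ≤ ζ e ⊎ ζ e + 3ℚ ≤ ι c → (a? : Dec (y ≤ q)) (b? : Dec (ι c + 1ℚ ≤ ζ e)) →
           ∣ indicator a? - indicator b? ∣ ≤ ω n e c
      go _                (yes _)   (yes _) = 0≤ω n e c
      go _                (no y≰q)  (yes l) = ⊥-elim (y≰q (<⇒≤ (left-of l)))
      go (inj₁ 1≤ω)        (yes _)   (no _) = 1≤ω
      go (inj₂ (inj₁ l))   (yes _)   (no ≰) = ⊥-elim (≰ l)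
      go (inj₂ (inj₂ l))   (yes y≤q) (no _) = ⊥-elim (<-irrefl refl (<-≤-trans (right-of l) y≤q))
      go _                (no _)    (no _) = 0≤ω n e c

  -- The bound T is left open: θⁿ is available everywhere and yields continuity, while `threshold n`
  -- near a good point yields the derivative.
  Small : ℕ → ℤ → ℚ → Set
  Small n e T = ∀ m t → t ℕ.≤ 2 → mass n m (cell n e t) ≤ T

  small-θ : ∀ n e → Small n e (pow θ n)
  small-θ n e m t _ = mass≤θⁿ n m (cell n e t) (cell<L n e t)

  cdf-compare : ∀ n j e T {N N′} q q′ → 0ℚ ≤ T → Small n e T → Within n e q → Within n e q′ →
    n ℕ.+ j ℕ.≤ N → n ℕ.+ j ℕ.≤ N′ → ∣ cdf N q - cdf N′ q′ ∣ ≤ 3ℚ * T + 2ℚ * 1ℚ * pow θ j + 3ℚ * T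
  cdf-compare n j e T {N} {N′} q q′ 0≤T small w w′ N≥ N′≥ = main (split-index (n ℕ.+ j) N≥) (split-index (n ℕ.+ j) N′≥)
    where
    main : ∀ {N N′} → ∃[ m ] N ≡ n ℕ.+ j ℕ.+ m → ∃[ m ] N′ ≡ n ℕ.+ j ℕ.+ m →
           ∣ cdf N q - cdf N′ q′ ∣ ≤ 3ℚ * T + 2ℚ * 1ℚ * pow θ j + 3ℚ * T
    main (m₀ , refl) (m₀′ , refl) = subst₂ (λ N N′ → ∣ cdf N q - cdf N′ q′ ∣ ≤ 3ℚ * T + 2ℚ * 1ℚ * pow θ j + 3ℚ * T)
      (sym (ℕₚ.+-assoc n j m₀)) (sym (ℕₚ.+-assoc n j m₀′))
      (E-compare n j m₀ m₀′ (χ q (n ℕ.+ (j ℕ.+ m₀))) (χ q′ (n ℕ.+ (j ℕ.+ m₀′))) (step n e) (ω n e) (3ℚ * T) 1ℚ 0≤1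
        (λ c _ → ≤-trans (≤-reflexive (0≤p⇒∣p∣≡p (0≤indicator (ι c + 1ℚ ≤? ζ e)))) (indicator≤1 (ι c + 1ℚ ≤? ζ e)))
        (λ c r c<L r<kᵐ → χ-step n (j ℕ.+ m₀) c r c<L r<kᵐ e q w)
        (λ c r c<L r<kᵐ → χ-step n (j ℕ.+ m₀′) c r c<L r<kᵐ e q′ w′)
        (λ m → Σ-ω n e (mass n m) T 0≤T (small m)))

  -- At a common level both sides see identical masses, so the term θʲ of `cdf-compare` disappears.
  -- The derivative needs such an error proportional to T.
  cdf-near : ∀ n e T {N} q q′ → 0ℚ ≤ T → Small n e T → Within n e q → Within n e q′ → n ℕ.≤ N →
    ∣ cdf N q - cdf N q′ ∣ ≤ 3ℚ * T + 3ℚ * T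
  cdf-near n e T {N} q q′ 0≤T small w w′ n≤N = main (split-index n n≤N)
    where
    main : ∃[ m ] N ≡ n ℕ.+ m → ∣ cdf N q - cdf N q′ ∣ ≤ 3ℚ * T + 3ℚ * T
    main (m , refl) = ∣-∣-triangle (cdf (n ℕ.+ m) q) mid (cdf (n ℕ.+ m) q′) (near q w)
      (≤-trans (≤-reflexive (∣p-q∣-comm mid (cdf (n ℕ.+ m) q′))) (near q′ w′))
      where
      mid = Σ (L n) (λ c → step n e c * mass n m c)
      near : ∀ q → Within n e q → ∣ cdf (n ℕ.+ m) q - mid ∣ ≤ 3ℚ * T
      near q w = E-near-cells n m (χ q (n ℕ.+ m)) (step n e) (ω n e) (3ℚ * T)
        (λ c r c<L r<kᵐ → χ-step n m c r c<L r<kᵐ e q w) (Σ-ω n e (mass n m) T 0≤T (small m))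

  EvWithin : ℕ → ℤ → ℝ → Set
  EvWithin n e x = Ev (λ i → Within n e (approx x i))

  -- Of the margin ½ h n, the distance uses ¼ and the tolerance of the real inequality ⅛; the
  -- remaining ⅛ makes the bounds strict.
  within-near : ∀ n e x y → Located n e x → ∣ y -ᵣ x ∣ᵣ ≤ᵣ fromℚ (¼ (h n)) → EvWithin n e y
  within-near n e x y loc close = Ev-zip bounds loc (≤ᵣ⇒Close {¼ (h n)} {½ * ¼ (h n)} y x (0<½* (0<¼ (0<h n))) close)
    where
    0<s : 0ℚ < ½ * ¼ (h n)
    0<s = 0<½* (0<¼ (0<h n))
    bounds : ∀ i → (ζ e + ½) * h n ≤ approx x i × approx x i ≤ (ζ e + 2ℚ + ½) * h n →
             ∣ approx y i - approx x i ∣ ≤ ¼ (h n) + ½ * ¼ (h n) → Within n e (approx y i)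
    bounds i (lo , up) d =
      by-diff-< {r = ½ * ¼ (h n) + (approx x i - (ζ e + ½) * h n + (approx y i + (¼ (h n) + ½ * ¼ (h n)) - approx x i))}
        (slack-pos (diff lo ⊞ diff (∣-∣≤⇒≥ {approx y i} {approx x i} d))) (eq (ζ e) (h n) (approx x i) (approx y i)) ,
      by-diff-< {r = ½ * ¼ (h n) + ((ζ e + 2ℚ + ½) * h n - approx x i + (approx x i + (¼ (h n) + ½ * ¼ (h n)) - approx y i))}
        (slack-pos (diff up ⊞ diff (∣-∣≤⇒≤ {approx y i} {approx x i} d))) (eq′ (ζ e) (h n) (approx x i) (approx y i))
      where
      slack-pos : ∀ {s} → 0ℚ ≤ s → 0ℚ < ½ * ¼ (h n) + s
      slack-pos {s} 0≤s = <-≤-trans 0<s (by-diff 0≤s (p+q-p≡q (½ * ¼ (h n)) s))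
      eq : ∀ e h x y → y - e * h ≡ ½ * (½ * (½ * h)) + (x - (e + ½) * h + (y + (½ * (½ * h) + ½ * (½ * (½ * h))) - x))
      eq = solve-∀ ring
      eq′ : ∀ e h x y → (e + (1ℚ + 1ℚ + 1ℚ)) * h - y ≡ ½ * (½ * (½ * h)) + ((e + (1ℚ + 1ℚ) + ½) * h - x + (x + (½ * (½ * h) + ½ * (½ * (½ * h))) - y))
      eq′ = solve-∀ ring

  within-self : ∀ n e x → Located n e x → EvWithin n e x
  within-self n e x loc = within-near n e x x loc
    (Close⇒≤ᵣ {¼ (h n)} x x (Close-refl x (<⇒≤ (0<¼ (0<h n)))))

  level : ∀ {ε} → 0ℚ < ε → ∃[ n ] 3ℚ * pow θ n ≤ ε
  level 0<ε = let (n , H) = Θ.decay 3ℚ 0≤3 0<ε in n , H n ℕₚ.≤-refl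

  opaque
    cdf-cauchy : ∀ x → IsCauchy (λ N → cdf N (approx x N))
    cdf-cauchy x ε 0<ε = go (level (0<¼ 0<ε)) (Θ.decay (2ℚ * 1ℚ) ((0≤1 ⊞ 0≤1) ⊠ 0≤1) (0<¼ 0<ε))
      where
      go : ∃[ n ] 3ℚ * pow θ n ≤ ¼ ε → ∃[ j ] (∀ i → j ℕ.≤ i → 2ℚ * 1ℚ * pow θ i ≤ ¼ ε) →
           ∃[ N ] (∀ m n → N ℕ.≤ m → N ℕ.≤ n → ∣ cdf m (approx x m) - cdf n (approx x n) ∣ ≤ ε)
      go (n , hn) (j , hj) =
        let (e , loc) = locate n x
            (N₀ , w) = within-self n e x loc
        in (n ℕ.+ j) ℕ.⊔ N₀ , λ N N′ N≥ N′≥ → ≤-trans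
          (cdf-compare n j e (pow θ n) {N} {N′} (approx x N) (approx x N′) (pow-nonneg Θ.0≤d n) (small-θ n e)
            (w N (ℕₚ.m⊔n≤o⇒n≤o (n ℕ.+ j) N₀ N≥)) (w N′ (ℕₚ.m⊔n≤o⇒n≤o (n ℕ.+ j) N₀ N′≥))
            (ℕₚ.m⊔n≤o⇒m≤o (n ℕ.+ j) N₀ N≥) (ℕₚ.m⊔n≤o⇒m≤o (n ℕ.+ j) N₀ N′≥))
          (≤-trans (+-mono-≤ (+-mono-≤ hn (hj j ℕₚ.≤-refl)) hn) (¼×3≤ 0<ε))

  -- Each `cdf N` jumps and cannot be evaluated at a real, so the level and the approximation of x
  -- advance together. The jumps vanish in the limit because windows have small mass.
  F : ℝ → ℝ
  F x = mkℝ (λ N → cdf N (approx x N)) (cdf-cauchy x)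

  F-near : ∀ n e T x y → 0ℚ ≤ T → Small n e T → EvWithin n e x → EvWithin n e y → Close (3ℚ * T + 3ℚ * T) (F x) (F y)
  F-near n e T x y 0≤T small wx wy = Ev-zip (λ i → λ { (w , n≤i) w′ → cdf-near n e T (approx x i) (approx y i) 0≤T small w w′ n≤i })
    (Ev-× wx (Ev-≥ n)) wy

  F-continuous : ContinuousOnUnit F
  F-continuous x _ ε 0<ε = go (level (0<½* 0<ε))
    where
    go : ∃[ n ] 3ℚ * pow θ n ≤ ½ * ε → ∃[ δ ] (0ℚ < δ × (∀ y → InUnit y → ∣ y -ᵣ x ∣ᵣ ≤ᵣ fromℚ δ → ∣ F y -ᵣ F x ∣ᵣ ≤ᵣ fromℚ ε))
    go (n , hn) = ¼ (h n) , 0<¼ (0<h n) , λ y _ y≈x →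
      let (e , loc) = locate n x in Close⇒≤ᵣ {ε} (F y) (F x)
        (Ev-map (λ i l → ≤-trans l (≤-trans (+-mono-≤ hn hn) (≤-reflexive (½+½ ε))))
          (F-near n e (pow θ n) y x (pow-nonneg Θ.0≤d n) (small-θ n e) (within-near n e x y loc y≈x) (within-self n e x loc)))

  E-≤-ω : ∀ n m e T (φ γ : ℕ → ℚ) ε → 0ℚ ≤ T → Small n e T →
    (∀ c r → c ℕ.< L n → r ℕ.< k ℕ.^ m → φ (c ℕ.* k ℕ.^ m ℕ.+ r) ≤ γ (c ℕ.* k ℕ.^ m ℕ.+ r) + (ω n e c + ε)) →
    E (n ℕ.+ m) φ ≤ E (n ℕ.+ m) γ + (3ℚ * T + ε)
  E-≤-ω n m e T φ γ ε 0≤T small H = by-diff (diff bound) (trans (eq (E N φ) (E N γ) (3ℚ * T + ε))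
      (cong (λ z → 3ℚ * T + ε - z) (trans (cong (E N φ +_) (sym (E-neg N γ))) (sym (E-+ N φ (λ x → - γ x))))))
    where
    N = n ℕ.+ m
    eq : ∀ a b s → b + s - a ≡ s - (a + - b)
    eq = solve-∀ ring
    bound : E N (λ x → φ x + - γ x) ≤ 3ℚ * T + ε
    bound = ≤-trans (E≤cells n m (λ x → φ x + - γ x) (λ c → ω n e c + ε)
        (λ c r c<L r<kᵐ → by-diff (diff (H c r c<L r<kᵐ)) (eq′ (φ (c ℕ.* k ℕ.^ m ℕ.+ r)) (γ (c ℕ.* k ℕ.^ m ℕ.+ r)) (ω n e c + ε))))
      (≤-trans (≤-reflexive (trans (Σ-cong (L n) (λ c _ → *-distribʳ-+ (mass n m c) (ω n e c) ε))
          (trans (Σ-+ (L n) (λ c → ω n e c * mass n m c) (λ c → ε * mass n m c))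
            (cong (Σ (L n) (λ c → ω n e c * mass n m c) +_) (trans (Σ-*ˡ (L n) ε (mass n m)) (trans (cong (ε *_) (Σ-mass n m)) (*-identityʳ ε)))))))
        (+-monoˡ-≤ ε (Σ-ω n e (mass n m) T 0≤T (small m))))
      where
      eq′ : ∀ f g s → s - (f + - g) ≡ g + s - f
      eq′ = solve-∀ ring

  F-≤-majorant : ∀ x g → Majorises g x → F x ≤ᵣ ghost∫ g
  F-≤-majorant x g (0≤g , 1≤g) = ghost∫-≥ g (F x) λ {ε} 0<ε → go 0<ε (level (0<¼ 0<ε))
    where
    go : ∀ {ε} → 0ℚ < ε → ∃[ n ] 3ℚ * pow θ n ≤ ¼ ε → Ev (λ N → Below ε (F x) (ν N g))
    go {ε} 0<ε (n , hn) = with-e (locate n x)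
      where
      with-e : ∃[ e ] Located n e x → Ev (λ N → Below ε (F x) (ν N g))
      with-e (e , loc) = Ev-zip (λ N c → λ { (w , n≤N) → at c w (split-index n n≤N) }) (approx-close (F x) (0<¼ 0<ε)) (Ev-× (within-self n e x loc) (Ev-≥ n))
        where
        at : ∀ {N} → (∀ i → N ℕ.≤ i → ∣ approx (F x) N - approx (F x) i ∣ ≤ ¼ ε) → Within n e (approx x N) →
             ∃[ m ] N ≡ n ℕ.+ m → Below ε (F x) (ν N g)
        at {N} close w (m , refl) = Ev-zip
          (λ i H N≤i → ≤-trans (∣-∣≤⇒≥ {approx (F x) N} {approx (F x) i} (close i N≤i))
            (≤-trans (+-monoˡ-≤ (¼ ε) (E-≤-ω n m e (pow θ n) (χ (approx x N) N) (G g N i) (¼ ε) (pow-nonneg Θ.0≤d n) (small-θ n e)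
                (λ c r c<L r<kᵐ → H c c<L r r<kᵐ)))
            (≤-trans (+-monoˡ-≤ (¼ ε) (+-monoʳ-≤ (E N (G g N i)) (+-monoˡ-≤ (¼ ε) hn)))
            (≤-trans (by-diff (<⇒≤ (0<¼ 0<ε)) (eq (E N (G g N i)) ε)) (≤-reflexive (cong (_+ ε) (sym (approx-ν N g i))))))))
          (Ev-∀< (L n) (λ c c<L → Ev-∀< (k ℕ.^ m) (λ r r<kᵐ → pointwise c r c<L r<kᵐ (beside n e c c<L) (pt N (c ℕ.* k ℕ.^ m ℕ.+ r) ≤? approx x N))))
          (Ev-≥ N)
          where
          eq : ∀ a ε → a + ε - (a + (½ * (½ * ε) + ½ * (½ * ε)) + ½ * (½ * ε)) ≡ ½ * (½ * ε)
          eq = solve-∀ ring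
          pointwise : ∀ c r → c ℕ.< L n → r ℕ.< k ℕ.^ m → 1ℚ ≤ ω n e c ⊎ ι c + 1ℚ ≤ ζ e ⊎ ζ e + 3ℚ ≤ ι c →
            (a? : Dec (pt N (c ℕ.* k ℕ.^ m ℕ.+ r) ≤ approx x N)) →
            Ev (λ i → indicator a? ≤ G g N i (c ℕ.* k ℕ.^ m ℕ.+ r) + (ω n e c + ¼ ε))
          pointwise c r c<L r<kᵐ (inj₁ 1≤ω) a? = Ev-map (λ i l → ≤-trans (indicator≤1 a?)
              (by-diff (diff l ⊞ diff 1≤ω) (eq′ (G g N i (c ℕ.* k ℕ.^ m ℕ.+ r)) (ω n e c) (¼ ε)))) (0≤g (fromℚ (pt N (c ℕ.* k ℕ.^ m ℕ.+ r))) (¼ ε) (0<¼ 0<ε))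
            where
            eq′ : ∀ g o s → g + (o + s) - 1ℚ ≡ g + s - 0ℚ + (o - 1ℚ)
            eq′ = solve-∀ ring
          pointwise c r c<L r<kᵐ (inj₂ (inj₁ l)) a? = Ev-map (λ i h → ≤-trans (indicator≤1 a?)
              (by-diff (diff h ⊞ 0≤ω n e c) (eq′ (G g N i (c ℕ.* k ℕ.^ m ℕ.+ r)) (ω n e c) (¼ ε))))
              (1≤g (fromℚ y) (fromℚ-mono (0≤pt N (c ℕ.* k ℕ.^ m ℕ.+ r))) y≤x (¼ ε) (0<¼ 0<ε))
            where
            y = pt N (c ℕ.* k ℕ.^ m ℕ.+ r)
            y≤x : fromℚ y ≤ᵣ x
            y≤x ε′ 0<ε′ = Ev-map (λ i w → ≤-trans (<⇒≤ (left-of n m c r c<L r<kᵐ e (approx x i) w l)) (by-diff (<⇒≤ 0<ε′) (p+q-p≡q (approx x i) ε′))) (within-self n e x loc)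
            eq′ : ∀ g o s → g + (o + s) - 1ℚ ≡ g + s - 1ℚ + o
            eq′ = solve-∀ ring
          pointwise c r c<L r<kᵐ (inj₂ (inj₂ l)) (yes y≤x) = ⊥-elim (<-irrefl refl (<-≤-trans (right-of n m c r c<L r<kᵐ e (approx x N) w l) y≤x))
          pointwise c r c<L r<kᵐ (inj₂ (inj₂ l)) (no _) = Ev-map (λ i h →
              by-diff (diff h ⊞ 0≤ω n e c) (eq′ (G g N i (c ℕ.* k ℕ.^ m ℕ.+ r)) (ω n e c) (¼ ε))) (0≤g (fromℚ (pt N (c ℕ.* k ℕ.^ m ℕ.+ r))) (¼ ε) (0<¼ 0<ε))
            where
            eq′ : ∀ g o s → g + (o + s) - 0ℚ ≡ g + s - 0ℚ + o
            eq′ = solve-∀ ring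

  module _ (x : ℝ) (n : ℕ) (e : ℤ) (loc : Located n e x) where
    private
      -- The upper bound for x given by `Located`; using it in place of x makes the data of the
      -- trapezoid rational.
      q : ℚ
      q = (ζ e + 2ℚ + ½) * h n

    open Trapezoid q (¼ (h n)) (0<¼ (0<h n)) using (trapezoid; 0≤trapezoid; trapezoid≤1; trapezoid-plateau; trapezoid-support)

    opaque
      bump : C⟨𝕋⟩
      bump = Trapezoid.bump q (¼ (h n)) (0<¼ (0<h n))

      apply-bump : ∀ y i → approx (apply bump y) i ≡ trapezoid (approx y i)
      apply-bump y i = refl

    bump-majorises : Majorises bump x
    bump-majorises = (λ y ε 0<ε → 0 , λ i _ → subst (λ z → 0ℚ ≤ z + ε) (sym (apply-bump y i)) (0≤trapezoid (approx y i) ⊞ <⇒≤ 0<ε)) ,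
      λ y 0≤y y≤x ε 0<ε → Ev-zip (λ { i (lo , up) (_ , le) → subst (λ z → 1ℚ ≤ z + ε) (sym (apply-bump y i)) (≤-trans (trapezoid-plateau (approx y i)
            (by-diff (diff lo) (eq₁ (approx y i) (¼ (h n)))) (≤-trans up (+-monoˡ-≤ (½ * ¼ (h n)) le)))
          (by-diff (<⇒≤ 0<ε) (p+q-p≡q (trapezoid (approx y i)) ε))) })
        (Ev-× (0≤y (½ * ¼ (h n)) (0<½* (0<¼ (0<h n)))) (y≤x (½ * ¼ (h n)) (0<½* (0<¼ (0<h n))))) loc
      where
      eq₁ : ∀ y s → y - (- (½ * s)) ≡ y + ½ * s - 0ℚ
      eq₁ = solve-∀ ring

    private
      -1ᶻ : ℤ
      -1ᶻ = ℤ.- (ℤ.+ 1)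
      ζ-1 : ζ -1ᶻ ≡ - 1ℚ
      ζ-1 = ζ≡/1 -1ᶻ
      θⁿ : ℚ
      θⁿ = pow θ n

    -- The trapezoid exceeds the indicator of [0, x] only in the window of x and on its left flank.
    -- That flank wraps around 0 to the end of the circle, hence the second window at position -1.
    trapezoid≤ : ∀ m c r → c ℕ.< L n → r ℕ.< k ℕ.^ m → Within n e (approx x (n ℕ.+ m)) →
      trapezoid (pt (n ℕ.+ m) (c ℕ.* k ℕ.^ m ℕ.+ r)) ≤ χ (approx x (n ℕ.+ m)) (n ℕ.+ m) (c ℕ.* k ℕ.^ m ℕ.+ r) + (ω n e c + ω n -1ᶻ c)
    trapezoid≤ m c r c<L r<kᵐ w = go (trapezoid-support t) (t ≤? approx x (n ℕ.+ m)) (beside n e c c<L)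
      where
      t = pt (n ℕ.+ m) (c ℕ.* k ℕ.^ m ℕ.+ r)
      o = ω n e c
      o′ = ω n -1ᶻ c
      0≤o : 0ℚ ≤ o
      0≤o = 0≤ω n e c
      0≤o′ : 0ℚ ≤ o′
      0≤o′ = 0≤ω n -1ᶻ c
      ≤1 : trapezoid t ≤ 1ℚ
      ≤1 = trapezoid≤1 t
      via-ω : ∀ {i} → 0ℚ ≤ i → 1ℚ ≤ o → trapezoid t ≤ i + (o + o′)
      via-ω {i} 0≤i 1≤o = ≤-trans ≤1 (by-diff (0≤i ⊞ diff 1≤o ⊞ 0≤o′) (eq i o o′))
        where
        eq : ∀ i o o′ → i + (o + o′) - 1ℚ ≡ i + (o - 1ℚ) + o′
        eq = solve-∀ ring
      via-ω′ : ∀ {i} → 0ℚ ≤ i → 1ℚ ≤ o′ → trapezoid t ≤ i + (o + o′)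
      via-ω′ {i} 0≤i 1≤o′ = ≤-trans ≤1 (by-diff (0≤i ⊞ 0≤o ⊞ diff 1≤o′) (eq i o o′))
        where
        eq : ∀ i o o′ → i + (o + o′) - 1ℚ ≡ i + o + (o′ - 1ℚ)
        eq = solve-∀ ring
      t<1 : t < 1ℚ
      t<1 = <-≤-trans (pt-upper n m c r r<kᵐ) (≤-trans (*-mono-≤ʳ (0≤h n) (subst (_≤ ι (L n)) (trans (ι-suc c) (+-comm 1ℚ (ι c))) (ι-mono c<L))) (≤-reflexive (L*h n)))
      -- A shift j ≥ 1 means that t lies just below 1, so t - 1 falls into the window at position
      -- -1.
      wrap : ∀ j → ¬ (j ℤ.≤ ℤ.+ 0) → - ¼ (h n) < t - ζ j → 1ℚ ≤ o′
      wrap j j≰0 lo = hit n m c r -1ᶻ -1ᶻ r<kᵐ c<L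
        ( by-diff-< {r = t - ζ j - (- ¼ (h n)) + ((ζ j - 1ℚ) + (¼ (h n) + ½ * h n))}
            (<-≤-trans (diff-< lo) (by-diff (diff 1≤j ⊞ (<⇒≤ (0<¼ (0<h n)) ⊞ <⇒≤ (0<½* (0<h n)))) (p+q-p≡q (t - ζ j - (- ¼ (h n))) _)))
            (trans (cong (λ z → t + z - z * h n) ζ-1) (eq t (ζ j) (h n)))
        , by-diff-< {r = 1ℚ - t + 2ℚ * h n} (<-≤-trans (diff-< t<1) (by-diff ((0≤1 ⊞ 0≤1) ⊠ 0≤h n) (p+q-p≡q (1ℚ - t) _)))
            (trans (cong (λ z → (z + 3ℚ) * h n - (t + z)) ζ-1) (eq′ t (h n))) )
        where
        1≤j : 1ℚ ≤ ζ j
        1≤j = subst (_≤ ζ j) ι1 (ζ-mono-≤ (ℤₚ.i<j⇒suc[i]≤j (ℤₚ.≰⇒> j≰0)))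
        eq : ∀ t j h → t + - 1ℚ - (- 1ℚ) * h ≡ t - j - (- (½ * (½ * h))) + ((j - 1ℚ) + (½ * (½ * h) + ½ * h))
        eq = solve-∀ ring
        eq′ : ∀ t h → (- 1ℚ + (1ℚ + 1ℚ + 1ℚ)) * h - (t + - 1ℚ) ≡ 1ℚ - t + (1ℚ + 1ℚ) * h
        eq′ = solve-∀ ring
      t<top : ∀ j → j ℤ.≤ ℤ.+ 0 → t - ζ j < q + ¼ (h n) → t < (ζ e + 3ℚ) * h n
      t<top j j≤0 up = by-diff-< {r = q + ¼ (h n) - (t - ζ j) + ((0ℚ - ζ j) + ¼ (h n))}
          (<-≤-trans (diff-< up) (by-diff (diff (subst (ζ j ≤_) ι0 (ζ-mono-≤ j≤0)) ⊞ <⇒≤ (0<¼ (0<h n))) (p+q-p≡q (q + ¼ (h n) - (t - ζ j)) _)))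
          (eq t (ζ j) (ζ e) (h n))
        where
        eq : ∀ t j e h → (e + (1ℚ + 1ℚ + 1ℚ)) * h - t ≡ (e + (1ℚ + 1ℚ) + ½) * h + ½ * (½ * h) - (t - j) + ((0ℚ - j) + ½ * (½ * h))
        eq = solve-∀ ring
      go : trapezoid t ≤ 0ℚ ⊎ ∃[ j ] (- ¼ (h n) < t - ζ j × t - ζ j < q + ¼ (h n)) → (a? : Dec (t ≤ approx x (n ℕ.+ m))) →
           1ℚ ≤ o ⊎ ι c + 1ℚ ≤ ζ e ⊎ ζ e + 3ℚ ≤ ι c → trapezoid t ≤ indicator a? + (o + o′)
      go (inj₁ ≤0) a? _ = ≤-trans ≤0 (0≤indicator a? ⊞ (0≤o ⊞ 0≤o′))
      go (inj₂ _) a? (inj₁ 1≤o) = via-ω (0≤indicator a?) 1≤o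
      go (inj₂ _) (yes _) (inj₂ (inj₁ l)) = ≤-trans ≤1 (by-diff (0≤o ⊞ 0≤o′) (eq o o′))
        where
        eq : ∀ o o′ → 1ℚ + (o + o′) - 1ℚ ≡ o + o′
        eq = solve-∀ ring
      go (inj₂ _) (no t≰x) (inj₂ (inj₁ l)) = ⊥-elim (t≰x (<⇒≤ (left-of n m c r c<L r<kᵐ e (approx x (n ℕ.+ m)) w l)))
      go (inj₂ (j , lo , up)) a? (inj₂ (inj₂ l)) with j ℤₚ.≤? ℤ.+ 0
      ... | yes j≤0 = ⊥-elim (<-irrefl refl (<-≤-trans (t<top j j≤0 up) (≤-trans (*-mono-≤ʳ (0≤h n) l) (pt-lower n m c r))))
      ... | no  j≰0 = via-ω′ (0≤indicator a?) (wrap j j≰0 lo)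

    E-bump : ∀ m → Within n e (approx x (n ℕ.+ m)) → ∀ i →
      E (n ℕ.+ m) (G bump (n ℕ.+ m) i) ≤ cdf (n ℕ.+ m) (approx x (n ℕ.+ m)) + (3ℚ * θⁿ + 3ℚ * θⁿ)
    E-bump m w i = by-diff (diff bound) (trans (eq (E N f) (E N X) (3ℚ * θⁿ + 3ℚ * θⁿ))
        (cong (λ z → 3ℚ * θⁿ + 3ℚ * θⁿ - z) (trans (cong (E N f +_) (sym (E-neg N X))) (sym (E-+ N f (λ y → - X y))))))
      where
      N = n ℕ.+ m
      f = G bump N i
      X = χ (approx x N) N
      eq : ∀ a b s → b + s - a ≡ s - (a + - b)
      eq = solve-∀ ring
      bound : E N (λ y → f y + - X y) ≤ 3ℚ * θⁿ + 3ℚ * θⁿ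
      bound = ≤-trans (E≤cells n m (λ y → f y + - X y) (λ c → ω n e c + ω n -1ᶻ c)
          (λ c r c<L r<kᵐ → by-diff (diff (subst (_≤ X (c ℕ.* k ℕ.^ m ℕ.+ r) + (ω n e c + ω n -1ᶻ c)) (sym (apply-bump (fromℚ (pt N (c ℕ.* k ℕ.^ m ℕ.+ r))) i)) (trapezoid≤ m c r c<L r<kᵐ w))) (eq′ (f (c ℕ.* k ℕ.^ m ℕ.+ r)) (X (c ℕ.* k ℕ.^ m ℕ.+ r)) (ω n e c + ω n -1ᶻ c))))
        (≤-trans (≤-reflexive (trans (Σ-cong (L n) (λ c _ → *-distribʳ-+ (mass n m c) (ω n e c) (ω n -1ᶻ c)))
            (Σ-+ (L n) (λ c → ω n e c * mass n m c) (λ c → ω n -1ᶻ c * mass n m c))))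
          (+-mono-≤ (Σ-ω n e (mass n m) θⁿ (pow-nonneg Θ.0≤d n) (small-θ n e m)) (Σ-ω n -1ᶻ (mass n m) θⁿ (pow-nonneg Θ.0≤d n) (small-θ n -1ᶻ m))))
        where
        eq′ : ∀ f g s → s - (f + - g) ≡ g + s - f
        eq′ = solve-∀ ring

    ghost∫-bump : ∀ {ε} → 0ℚ < ε → 3ℚ * θⁿ ≤ ¼ ε → ghost∫ bump ≤ᵣ F x +ᵣ fromℚ ε
    ghost∫-bump {ε} 0<ε small = ghost∫-≤ bump (F x +ᵣ fromℚ ε) (λ {ε′} 0<ε′ → eventually {ε′} 0<ε′)
      where
      at : ∀ {ε′ N} → 0ℚ < ε′ → (∀ i → N ℕ.≤ i → ∣ approx (F x) N - approx (F x) i ∣ ≤ ¼ ε) → Within n e (approx x N) →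
           ∃[ m ] N ≡ n ℕ.+ m → Below ε′ (ν N bump) (F x +ᵣ fromℚ ε)
      at {ε′} {N} 0<ε′ close w (m , refl) = N , λ i N≤i → ≤-trans (≤-reflexive (approx-ν N bump i))
        (≤-trans (E-bump m w i) (≤-trans (+-mono-≤ (∣-∣≤⇒≤ {approx (F x) N} {approx (F x) i} (close i N≤i)) (+-mono-≤ small small))
          (by-diff (<⇒≤ (0<¼ 0<ε) ⊞ <⇒≤ 0<ε′) (eq (approx (F x) i) ε ε′))))
        where
        eq : ∀ f ε ε′ → f + ε + ε′ - (f + ½ * (½ * ε) + (½ * (½ * ε) + ½ * (½ * ε))) ≡ ½ * (½ * ε) + ε′
        eq = solve-∀ ring

      at′ : ∀ {ε′} → 0ℚ < ε′ → ∀ N → (∀ i → N ℕ.≤ i → ∣ approx (F x) N - approx (F x) i ∣ ≤ ¼ ε) →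
            Within n e (approx x N) × n ℕ.≤ N → Below ε′ (ν N bump) (F x +ᵣ fromℚ ε)
      at′ {ε′} 0<ε′ N c (w , n≤N) = at {ε′} {N} 0<ε′ c w (split-index n n≤N)
      eventually : ∀ {ε′} → 0ℚ < ε′ → Ev (λ N → Below ε′ (ν N bump) (F x +ᵣ fromℚ ε))
      eventually {ε′} 0<ε′ = Ev-zip {λ N → ∀ i → N ℕ.≤ i → ∣ approx (F x) N - approx (F x) i ∣ ≤ ¼ ε}
        {λ N → Within n e (approx x N) × n ℕ.≤ N} {λ N → Below ε′ (ν N bump) (F x +ᵣ fromℚ ε)} (at′ {ε′} 0<ε′)
        (approx-close (F x) (0<¼ 0<ε)) (Ev-× (within-self n e x loc) (Ev-≥ n))

  F-isDistributionFunction : IsDistributionFunction μ F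
  F-isDistributionFunction x _ = F-≤-majorant x , greatest
    where
    greatest : ∀ c → (∀ g → Majorises g x → c ≤ᵣ ghost∫ g) → c ≤ᵣ F x
    greatest c H ε 0<ε = go (level (0<¼ (0<½* 0<ε)))
      where
      go : ∃[ n ] 3ℚ * pow θ n ≤ ¼ (½ * ε) → Below ε c (F x)
      go (n , small) = with-e (locate n x)
        where
        with-e : ∃[ e ] Located n e x → Below ε c (F x)
        with-e (e , loc) = Ev-zip (λ i l l′ → ≤-trans l (≤-trans (+-monoˡ-≤ (¼ ε) l′) (≤-reflexive (eq (approx (F x) i) ε))))
          (H (bump x n e loc) (bump-majorises x n e loc) (¼ ε) (0<¼ 0<ε))
          (ghost∫-bump x n e loc (0<½* 0<ε) small (¼ ε) (0<¼ 0<ε))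
          where
          eq : ∀ f ε → f + ½ * ε + ½ * (½ * ε) + ½ * (½ * ε) ≡ f + ε
          eq = solve-∀ ring

  -- The derivative off the bad cells

  cell-position : ∀ n e t → ∃[ s ] ζ e + ι t ≡ ι (cell n e t) + ζ s * ι (L n)
  cell-position n e t = s , trans (sym (ζ-+ e (ℤ.+ t))) (trans (cong ζ (ℤ.a≡a%ℕn+[a/ℕn]*n (e ℤ.+ ℤ.+ t) (L n) {{L≢0 n}}))
    (trans (ζ-+ (ℤ.+ cell n e t) (s ℤ.* ℤ.+ L n)) (cong (ι (cell n e t) +_) (ζ-* s (ℤ.+ L n)))))
    where
    s = ((e ℤ.+ ℤ.+ t) ℤ./ℕ L n) {{L≢0 n}}

  unit : ∀ n s → ζ s * ι (L n) * h n ≡ ζ s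
  unit n s = trans (*-assoc (ζ s) _ _) (trans (cong (ζ s *_) (L*h n)) (*-identityʳ (ζ s)))

  private
    bad-order : ∀ n c → (ι c - 2ℚ) * h n ≤ (ι c + 3ℚ) * h n
    bad-order n c = *-mono-≤ʳ {p = ι c - 2ℚ} {q = ι c + 3ℚ} (0≤h n) (by-diff (0≤3 ⊞ (0≤1 ⊞ 0≤1)) (eq (ι c)))
      where
      eq : ∀ c → c + (1ℚ + 1ℚ + 1ℚ) - (c - (1ℚ + 1ℚ)) ≡ (1ℚ + 1ℚ + 1ℚ) + (1ℚ + 1ℚ)
      eq = solve-∀ ring

  -- Wide enough to contain every arcAt n e which meets cell c.
  wideArc : ℕ → ℕ → Arc
  wideArc n c = arc ((ι c - 2ℚ) * h n) ((ι c + 3ℚ) * h n) (bad-order n c)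

  located-wide : ∀ n e t x → t ℕ.≤ 2 → Located n e x → x ∈ wideArc n (cell n e t)
  located-wide n e t x t≤2 loc = with-s (cell-position n e t)
    where
    c = cell n e t
    t≤2ℚ : ι t ≤ 2ℚ
    t≤2ℚ = subst (ι t ≤_) (trans (ι-suc 1) (cong (1ℚ +_) ι1)) (ι-mono t≤2)
    with-s : ∃[ s ] ζ e + ι t ≡ ι c + ζ s * ι (L n) → x ∈ wideArc n c
    with-s (s , eq) = ∈-intro (bad-order n c) x (ℤ.- s) (0<½* (0<h n)) (Ev-map shift loc)
      where
      e≡ : ζ e * h n ≡ (ι c - ι t) * h n + ζ s
      e≡ = trans (cong (_* h n) (trans (eq₁ (ζ e) (ι t)) (cong (_- ι t) eq))) (trans (eq₂ (ι c) (ι t) (ζ s * ι (L n)) (h n)) (cong ((ι c - ι t) * h n +_) (unit n s)))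
        where
        eq₁ : ∀ e t → e ≡ e + t - t
        eq₁ = solve-∀ ring
        eq₂ : ∀ c t u h → (c + u - t) * h ≡ (c - t) * h + u * h
        eq₂ = solve-∀ ring
      shift : ∀ i → (ζ e + ½) * h n ≤ approx x i × approx x i ≤ (ζ e + 2ℚ + ½) * h n →
        (ι c - 2ℚ) * h n + ½ * h n ≤ approx x i + ζ (ℤ.- s) × approx x i + ζ (ℤ.- s) + ½ * h n ≤ (ι c + 3ℚ) * h n
      shift i (lo , up) =
        subst (λ z → (ι c - 2ℚ) * h n + ½ * h n ≤ approx x i + z) (sym (ζ-neg s)) (by-diff {(ι c - 2ℚ) * h n + ½ * h n} {approx x i + - ζ s} (diff lo ⊞ diff t≤2ℚ ⊠ 0≤h n)
          (trans (eq₃ (ι c) (ι t) (ζ s) (h n) (approx x i)) (trans (cong (λ z → approx x i - (z + ½ * h n) + (2ℚ - ι t) * h n) (sym e≡)) (eq₄ (ζ e) (ι t) (h n) (approx x i))))) ,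
        subst (λ z → approx x i + z + ½ * h n ≤ (ι c + 3ℚ) * h n) (sym (ζ-neg s)) (by-diff {approx x i + - ζ s + ½ * h n} {(ι c + 3ℚ) * h n} (diff up ⊞ 0≤ι t ⊠ 0≤h n)
          (trans (eq₅ (ι c) (ι t) (ζ s) (h n) (approx x i)) (trans (cong (λ z → z + (2ℚ + ½) * h n - approx x i + ι t * h n) (sym e≡)) (eq₆ (ζ e) (ι t) (h n) (approx x i)))))
        where
        eq₃ : ∀ c t s h x → x + - s - ((c - (1ℚ + 1ℚ)) * h + ½ * h) ≡ x - ((c - t) * h + s + ½ * h) + (1ℚ + 1ℚ - t) * h
        eq₃ = solve-∀ ring
        eq₄ : ∀ e t h x → x - (e * h + ½ * h) + (1ℚ + 1ℚ - t) * h ≡ x - (e + ½) * h + (1ℚ + 1ℚ - t) * h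
        eq₄ = solve-∀ ring
        eq₅ : ∀ c t s h x → (c + (1ℚ + 1ℚ + 1ℚ)) * h - (x + - s + ½ * h) ≡ (c - t) * h + s + (1ℚ + 1ℚ + ½) * h - x + t * h
        eq₅ = solve-∀ ring
        eq₆ : ∀ e t h x → e * h + (1ℚ + 1ℚ + ½) * h - x + t * h ≡ (e + (1ℚ + 1ℚ) + ½) * h - x + t * h
        eq₆ = solve-∀ ring

  BadFrom : ℕ → ℝ → Set
  BadFrom J x = ∃[ n ] ∃[ c ] (J ℕ.≤ n × c ℕ.< L n × Bad n c × x ∈ wideArc n c)

  good-cells : ∀ J x → ¬ BadFrom J x → ∀ n e t → J ℕ.≤ n → t ℕ.≤ 2 → Located n e x → ¬ Bad n (cell n e t)
  good-cells J x good n e t J≤n t≤2 loc bad = good (n , cell n e t , J≤n , cell<L n e t , bad , located-wide n e t x t≤2 loc)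

  small-threshold : ∀ J x → ¬ BadFrom J x → ∀ n e → J ℕ.≤ n → Located n e x → Small n e (threshold n)
  small-threshold J x good n e J≤n loc m t t≤2 = mass-good n m (cell n e t) (cell<L n e t) (good-cells J x good n e t J≤n t≤2 loc)

  0≤threshold : ∀ n → 0ℚ ≤ threshold n
  0≤threshold n = ((0≤1 ⊞ 0≤1) ⊠ (0≤dⁿ n ⊠ 0≤dⁿ n)) ⊠ (0≤ι (k ℕ.∸ 1) ⊠ 0≤h n)

  six : ℚ → ℚ
  six T = 3ℚ * T + 3ℚ * T

  0≤6threshold : ∀ n → 0ℚ ≤ six (threshold n)
  0≤6threshold n = (0≤3 ⊠ 0≤threshold n) ⊞ (0≤3 ⊠ 0≤threshold n)

  0≤k₁ : 0ℚ ≤ k₁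
  0≤k₁ = 0≤ι (k ℕ.∸ 1)

  12ℚ : ℚ
  12ℚ = (ℤ.+ 12) / 1

  0≤12 : 0ℚ ≤ 12ℚ
  0≤12 = nonNegative⁻¹ 12ℚ

  dⁿ≤1 : ∀ n → dⁿ n ≤ 1ℚ
  dⁿ≤1 = pow≤1 Δ.0≤d Δ.d≤1

  h≤1 : ∀ n → h n ≤ 1ℚ
  h≤1 n = ≤-trans (h≤θⁿ n) (pow≤1 Θ.0≤d Θ.d≤1 n)

  dⁿdⁿ≤dⁿ : ∀ n → dⁿ n * dⁿ n ≤ dⁿ n
  dⁿdⁿ≤dⁿ n = ≤-trans (*-mono-≤ˡ (0≤dⁿ n) (dⁿ≤1 n)) (≤-reflexive (*-identityʳ (dⁿ n)))

  6threshold≤ : ∀ n → six (threshold n) ≤ 12ℚ * k₁ * dⁿ n * h n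
  6threshold≤ n = ≤-trans (≤-reflexive (eq (dⁿ n * dⁿ n) k₁ (h n)))
    (*-mono-≤ʳ (0≤h n) (*-mono-≤ˡ (0≤12 ⊠ 0≤k₁) (dⁿdⁿ≤dⁿ n)))
    where
    eq : ∀ d k h → (1ℚ + 1ℚ + 1ℚ) * ((1ℚ + 1ℚ) * d * (k * h)) + (1ℚ + 1ℚ + 1ℚ) * ((1ℚ + 1ℚ) * d * (k * h)) ≡ (ℤ.+ 12 / 1) * k * d * h
    eq = solve-∀ ring

  ⅛ : ℚ → ℚ
  ⅛ ε = ½ * ¼ ε

  module _ (J : ℕ) (x : ℝ) (good : ¬ BadFrom J x) (η : ℚ) (0<η : 0ℚ < η)
           (n₀ : ℕ) (J≤n₀ : J ℕ.≤ n₀) (steep : ∀ n → n₀ ℕ.≤ n → 12ℚ * k₁ * K * dⁿ n ≤ ⅛ η) (y : ℝ) where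
    private
      D : ℕ → ℚ
      D i = ∣ approx y i - approx x i ∣
      ΔF : ℕ → ℚ
      ΔF i = ∣ approx (F y) i - approx (F x) i ∣
      0≤ηD : ∀ i → 0ℚ ≤ η * D i
      0≤ηD i = <⇒≤ 0<η ⊠ 0≤∣p∣ (approx y i - approx x i)

    increment : ∀ n → n₀ ℕ.≤ n → ∣ y -ᵣ x ∣ᵣ ≤ᵣ fromℚ (¼ (h n)) → Ev (λ i → ΔF i ≤ six (threshold n))
    increment n n≥ close = with-e (locate n x)
      where
      with-e : ∃[ e ] Located n e x → Ev (λ i → ΔF i ≤ six (threshold n))
      with-e (e , loc) = F-near n e (threshold n) y x (0≤threshold n) (small-threshold J x good n e (ℕₚ.≤-trans J≤n₀ n≥) loc)
        (within-near n e x y loc close) (within-self n e x loc)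

    -- Either y is so close to x that the next level applies, or ∣ y - x ∣ is comparable to h n.
    descent : ∀ m n → n₀ ℕ.≤ n → ∣ y -ᵣ x ∣ᵣ ≤ᵣ fromℚ (¼ (h n)) → Ev (λ i → ΔF i ≤ η * D i + six (threshold (n ℕ.+ m)))
    descent zero    n n≥ close = Ev-map (λ i l → ≤-trans l (≤-trans (≤-reflexive (cong (λ n → six (threshold n)) (sym (ℕₚ.+-identityʳ n))))
        (by-diff (0≤ηD i) (p+q-q≡p (η * D i) (six (threshold (n ℕ.+ 0))))))) (increment n n≥ close)
    descent (suc m) n n≥ close = with-N (approx-close ∣ y -ᵣ x ∣ᵣ {½ * ⅛ h′} (0<½* (0<½* (0<¼ (0<h (suc n))))))
      where
      h′ = h (suc n)
      Goal : Set
      Goal = Ev (λ i → ΔF i ≤ η * D i + six (threshold (n ℕ.+ suc m)))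
      with-N : Ev (λ N → ∀ i → N ℕ.≤ i → ∣ D N - D i ∣ ≤ ½ * ⅛ h′) → Goal
      with-N (N , H) = decide (D N ≤? ⅛ h′ + ½ * ⅛ h′)
        where
        decide : Dec (D N ≤ ⅛ h′ + ½ * ⅛ h′) → Goal
        -- The tested bound ⅛ + 1/16 and the approximation error 1/16 add up to ¼, the hypothesis of
        -- the next level.
        decide (yes small) = subst (λ l → Ev (λ i → ΔF i ≤ η * D i + six (threshold l))) (sym (ℕₚ.+-suc n m))
          (descent m (suc n) (ℕₚ.m≤n⇒m≤1+n n≥) λ ε 0<ε → N , λ i N≤i →
            by-diff (diff small ⊞ diff (∣-∣≤⇒≥ {D N} {D i} (H N ℕₚ.≤-refl i N≤i)) ⊞ <⇒≤ 0<ε) (eq h′ (D N) (D i) ε))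
          where
          eq : ∀ h a b ε → ½ * (½ * h) + ε - b ≡ ½ * (½ * (½ * h)) + ½ * (½ * (½ * (½ * h))) - a + (a + ½ * (½ * (½ * (½ * h))) - b) + ε
          eq = solve-∀ ring
        -- Now ∣ y - x ∣ is at least ⅛ h (n + 1), whereas the increment of F is at most 12 k₁ dⁿ h n
        -- = 12 k₁ K dⁿ h (n + 1); `steep` bounds their ratio by η.
        decide (no large) = Ev-zip (λ i l N≤i → ≤-trans l (≤-trans (6threshold≤ n)
            (≤-trans (≤-reflexive (trans (cong (12ℚ * k₁ * dⁿ n *_) (h-suc n)) (eq₁ (12ℚ * k₁) (dⁿ n) K h′)))
            (≤-trans (*-mono-≤ʳ (0≤h (suc n)) (steep n n≥))
            (≤-trans (≤-reflexive (eq₂ η h′))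
            (≤-trans (*-mono-≤ˡ (<⇒≤ 0<η) (far i (H N ℕₚ.≤-refl i N≤i)))
              (by-diff (0≤6threshold (n ℕ.+ suc m)) (p+q-p≡q (η * D i) (six (threshold (n ℕ.+ suc m)))))))))))
          (increment n n≥ close) (Ev-≥ N)
          where
          far : ∀ i → ∣ D N - D i ∣ ≤ ½ * ⅛ h′ → ⅛ h′ ≤ D i
          far i d = by-diff (diff (<⇒≤ (≰⇒> large)) ⊞ diff (∣-∣≤⇒≤ {D N} {D i} d)) (eq h′ (D N) (D i))
            where
            eq : ∀ h a b → b - ½ * (½ * (½ * h)) ≡ a - (½ * (½ * (½ * h)) + ½ * (½ * (½ * (½ * h)))) + (b + ½ * (½ * (½ * (½ * h))) - a)
            eq = solve-∀ ring
          eq₁ : ∀ c d K h → c * d * (K * h) ≡ c * K * d * h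
          eq₁ = solve-∀ ring
          eq₂ : ∀ η h → ½ * (½ * (½ * η)) * h ≡ η * (½ * (½ * (½ * h)))
          eq₂ = solve-∀ ring

    -- Since y may coincide with x, the descent need not stop by itself. The tolerance ε of the real
    -- inequality ends it at a level where the remaining bound on the increment is below ε.
    slope-bound : ∣ y -ᵣ x ∣ᵣ ≤ᵣ fromℚ (¼ (h n₀)) → ∣ (F y -ᵣ F x) -ᵣ 0ℝ *ᵣ (y -ᵣ x) ∣ᵣ ≤ᵣ fromℚ η *ᵣ ∣ y -ᵣ x ∣ᵣ
    slope-bound close ε 0<ε = with-m (Δ.decay (12ℚ * k₁) (0≤12 ⊠ 0≤k₁) 0<ε)
      where
      with-m : ∃[ m ] (∀ n → m ℕ.≤ n → 12ℚ * k₁ * dⁿ n ≤ ε) →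
               Ev (λ i → ∣ (approx (F y) i + - approx (F x) i) + - (0ℚ * (approx y i + - approx x i)) ∣ ≤ η * D i + ε)
      with-m (m , hm) = Ev-map (λ i l → ≤-trans (≤-reflexive (cong ∣_∣ (eq (approx (F y) i) (approx (F x) i) (approx y i) (approx x i))))
          (≤-trans l (+-monoʳ-≤ (η * D i) small))) (descent m n₀ ℕₚ.≤-refl close)
        where
        eq : ∀ a b y x → (a + - b) + - (0ℚ * (y + - x)) ≡ a - b
        eq = solve-∀ ring
        small : six (threshold (n₀ ℕ.+ m)) ≤ ε
        small = ≤-trans (6threshold≤ (n₀ ℕ.+ m)) (≤-trans
          (*-mono-≤ˡ ((0≤12 ⊠ 0≤k₁) ⊠ 0≤dⁿ (n₀ ℕ.+ m)) (h≤1 (n₀ ℕ.+ m)))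
          (≤-trans (≤-reflexive (*-identityʳ _)) (hm (n₀ ℕ.+ m) (ℕₚ.m≤n+m m n₀))))

  derivative-zero : ∀ J x → ¬ BadFrom J x → HasDerivative F x 0ℝ
  derivative-zero J x good η 0<η = with-J (Δ.decay (12ℚ * k₁ * K) ((0≤12 ⊠ 0≤k₁) ⊠ 0≤K) (0<½* (0<¼ 0<η)))
    where
    with-J : ∃[ J′ ] (∀ n → J′ ℕ.≤ n → 12ℚ * k₁ * K * dⁿ n ≤ ⅛ η) →
      ∃[ δ ] (0ℚ < δ × (∀ y → InUnit y → ∣ y -ᵣ x ∣ᵣ ≤ᵣ fromℚ δ →
        ∣ (F y -ᵣ F x) -ᵣ 0ℝ *ᵣ (y -ᵣ x) ∣ᵣ ≤ᵣ fromℚ η *ᵣ ∣ y -ᵣ x ∣ᵣ))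
    with-J (J′ , steep) = ¼ (h (J ℕ.⊔ J′)) , 0<¼ (0<h (J ℕ.⊔ J′)) , λ y _ close →
      slope-bound J x good η 0<η (J ℕ.⊔ J′) (ℕₚ.m≤m⊔n J J′) (λ n n≥ → steep n (ℕₚ.m⊔n≤o⇒n≤o J J′ n≥)) y close

  -- Singularity

  module Sequence (J : ℕ) where
    open Lexicographic (λ m → L (J ℕ.+ m)) (λ m → 1≤L (J ℕ.+ m)) public

    list : ∀ {A : Set} → (ℕ → ℕ → A) → ℕ → A
    list f i = f (J ℕ.+ proj₁ (decode i)) (proj₂ (decode i))

    listed : ∀ {A : Set} (f : ℕ → ℕ → A) {n c} → J ℕ.≤ n → c ℕ.< L n → ∃[ i ] list f i ≡ f n c
    listed f {n} {c} J≤n c<L = with-m (split-index J J≤n) c<L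
      where
      with-m : ∀ {n} → ∃[ m ] n ≡ J ℕ.+ m → c ℕ.< L n → ∃[ i ] list f i ≡ f n c
      with-m (m , refl) c<L = let (i , e) = decode-surjective m c c<L in
        i , cong (λ p → f (J ℕ.+ proj₁ p) (proj₂ p)) e

    -- The tail of a geometric series: the levels from J on contribute C dᴶ/(1 - d), and 1/(1 - d) =
    -- N₀.
    Σ-list : ∀ (w : ℕ → ℕ → ℚ) C → 0ℚ ≤ C → (∀ n c → 0ℚ ≤ w n c) → (∀ n → Σ (L n) (w n) ≤ C * dⁿ n) →
             ∀ i → Σ i (list w) ≤ C * ι N₀ * dⁿ J
    Σ-list w C 0≤C 0≤w levels = Σ-decode≤ (λ m → w (J ℕ.+ m)) (λ m → 0≤w (J ℕ.+ m)) λ M →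
      ≤-trans (Σ-mono M (λ m _ → levels (J ℕ.+ m)))
      (≤-trans (≤-reflexive (trans (Σ-cong M (λ m _ → trans (cong (C *_) (pow-+ d J m)) (sym (*-assoc C (dⁿ J) (dⁿ m))))) (Σ-*ˡ M (C * dⁿ J) dⁿ)))
      (≤-trans (*-mono-≤ˡ (0≤C ⊠ 0≤dⁿ J) (Δ.geometric-sum M)) (≤-reflexive (eq C (dⁿ J) (ι N₀)))))
      where
      eq : ∀ c d n → c * d * n ≡ c * n * d
      eq = solve-∀ ring

  -- The first Borel-Cantelli lemma, stated for an arbitrary notion of size so that it serves
  -- Lebesgue measure with the bad cells and the ghost measure with the good windows.
  cover-by-levels : ∀ (Measure≤ : Arc → ℝ → Set) (A : ℝ → Set) (I : ℕ → ℕ → Arc) (w : ℕ → ℕ → ℚ) C → 0ℚ ≤ C →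
    (∀ n c → 0ℚ ≤ w n c) → (∀ n → Σ (L n) (w n) ≤ C * dⁿ n) → (∀ n c → Measure≤ (I n c) (fromℚ (w n c))) →
    (∀ J x → A x → ¬ ¬ (∃[ n ] ∃[ c ] (J ℕ.≤ n × c ℕ.< L n × x ∈ I n c))) →
    Null Measure≤ A
  cover-by-levels Measure≤ A I w C 0≤C 0≤w levels measures covers ε 0<ε = with-J (Δ.decay (C * ι N₀) (0≤C ⊠ 0≤ι N₀) 0<ε)
    where
    with-J : ∃[ J ] (∀ n → J ℕ.≤ n → C * ι N₀ * dⁿ n ≤ ε) → Covered Measure≤ A ε
    with-J (J , small) = cover Measure≤ A (list I) (list w) (λ i → measures (J ℕ.+ proj₁ (decode i)) (proj₂ (decode i)))
      (λ N → ≤-trans (Σ-list w C 0≤C 0≤w levels N) (small J ℕₚ.≤-refl))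
      (λ x x∈A uncovered → covers J x x∈A (λ { (n , c , J≤n , c<L , x∈) →
        let (i , e) = listed I J≤n c<L in uncovered (i , subst (x ∈_) (sym e) x∈) }))
      where
      open Sequence J

  5ℚ : ℚ
  5ℚ = 3ℚ + 2ℚ

  0≤5 : 0ℚ ≤ 5ℚ
  0≤5 = 0≤3 ⊞ (0≤1 ⊞ 0≤1)

  badArc′ : ∀ n c → Dec (Bad n c) → Arc
  badArc′ n c (yes _) = wideArc n c
  badArc′ n c (no _)  = emptyArc

  -- Cells that are not bad contribute an empty arc, so the enumeration can run over all cells.
  badArc : ℕ → ℕ → Arc
  badArc n c = badArc′ n c (bad? n c)

  badArc-length : ∀ n c → Length≤ (badArc n c) (fromℚ (5ℚ * (indicator (bad? n c) * h n)))
  badArc-length n c = go (bad? n c)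
    where
    go : ∀ b? → Length≤ (badArc′ n c b?) (fromℚ (5ℚ * (indicator b? * h n)))
    go (yes _) ε 0<ε = 0 , λ i _ → by-diff (<⇒≤ 0<ε) (eq (ι c) (h n) ε)
      where
      eq : ∀ c h ε → (1ℚ + 1ℚ + 1ℚ + (1ℚ + 1ℚ)) * (1ℚ * h) + ε - ((c + (1ℚ + 1ℚ + 1ℚ)) * h + - ((c - (1ℚ + 1ℚ)) * h)) ≡ ε
      eq = solve-∀ ring
    go (no _) ε 0<ε = 0 , λ i _ → by-diff (<⇒≤ 0<ε) (eq (h n) ε)
      where
      eq : ∀ h ε → (1ℚ + 1ℚ + 1ℚ + (1ℚ + 1ℚ)) * (0ℚ * h) + ε - (0ℚ + - 0ℚ) ≡ ε
      eq = solve-∀ ring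

  ∈-badArc : ∀ n c x → Bad n c → x ∈ wideArc n c → x ∈ badArc n c
  ∈-badArc n c x bad x∈ = go (bad? n c)
    where
    go : ∀ b? → x ∈ badArc′ n c b?
    go (yes _)   = x∈
    go (no ¬bad) = ⊥-elim (¬bad bad)

  bad-null : ∀ A → (∀ J x → A x → ¬ ¬ BadFrom J x) → LebesgueNull A
  bad-null A bad = cover-by-levels Length≤ A badArc (λ n c → 5ℚ * (indicator (bad? n c) * h n)) 5ℚ 0≤5
    (λ n c → 0≤5 ⊠ (0≤indicator (bad? n c) ⊠ 0≤h n))
    (λ n → ≤-trans (≤-reflexive (Σ-*ˡ (L n) 5ℚ (λ c → indicator (bad? n c) * h n))) (*-mono-≤ˡ 0≤5 (Σ-bad n)))
    badArc-length
    (λ J x x∈A none → bad J x x∈A (λ { (n , c , J≤n , c<L , b , x∈) → none (n , c , J≤n , c<L , ∈-badArc n c x b x∈) }))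

  derivative-zero-ae : AlmostEverywhere (λ x → HasDerivative F x 0ℝ)
  derivative-zero-ae = bad-null (λ x → InUnit x × ¬ HasDerivative F x 0ℝ)
    (λ J x → λ { (_ , ¬derivative) good → ¬derivative (derivative-zero J x good) })

  GoodTriple : ℕ → ℕ → Set
  GoodTriple n c = ∀ t → t ℕ.≤ 2 → ¬ Bad n (cell n (ℤ.+ c) t)

  goodTriple? : ∀ n c → Dec (GoodTriple n c)
  goodTriple? n c = go (bad? n (cell n (ℤ.+ c) 0)) (bad? n (cell n (ℤ.+ c) 1)) (bad? n (cell n (ℤ.+ c) 2))
    where
    go : Dec (Bad n (cell n (ℤ.+ c) 0)) → Dec (Bad n (cell n (ℤ.+ c) 1)) → Dec (Bad n (cell n (ℤ.+ c) 2)) → Dec (GoodTriple n c)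
    go (yes b) _ _ = no (λ g → g 0 z≤n b)
    go (no _) (yes b) _ = no (λ g → g 1 (s≤s z≤n) b)
    go (no _) (no _) (yes b) = no (λ g → g 2 ℕₚ.≤-refl b)
    go (no g₀) (no g₁) (no g₂) = yes λ { 0 _ → g₀ ; 1 _ → g₁ ; 2 _ → g₂ ; (suc (suc (suc _))) (s≤s (s≤s ())) }

  goodArc′ : ∀ n c → Dec (GoodTriple n c) → Arc
  goodArc′ n c (yes _) = arcAt n (ℤ.+ c)
  goodArc′ n c (no _)  = emptyArc

  goodArc : ℕ → ℕ → Arc
  goodArc n c = goodArc′ n c (goodTriple? n c)

  goodArc-measure : ∀ n c → ArcMeasure≤ μ (goodArc n c) (fromℚ (3ℚ * threshold n))
  goodArc-measure n c = go (goodTriple? n c)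
    where
    go : ∀ g? → ArcMeasure≤ μ (goodArc′ n c g?) (fromℚ (3ℚ * threshold n))
    go (yes good) = arc-measure n (ℤ.+ c) (threshold n) (0≤threshold n)
      (λ m t t≤2 → mass-good n m (cell n (ℤ.+ c) t) (cell<L n (ℤ.+ c) t) (good t t≤2))
    go (no _) g 0≤g g≤1 support ε 0<ε = Ev-map (λ i l → ≤-trans l (+-monoˡ-≤ ε (0≤3 ⊠ 0≤threshold n)))
      (emptyArc-measure g 0≤g g≤1 support ε 0<ε)

  -- Windows sit at arbitrary integers e, but the cover may list only finitely many per level;
  -- replacing e by its residue keeps the cells of the window.
  cell-shift : ∀ n e t → cell n (ℤ.+ cell n e 0) t ≡ cell n e t
  cell-shift n e t = trans (cong (λ z → (z ℤ.%ℕ L n) {{L≢0 n}}) split)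
    (%ℕ-unique (L n) {{L≢0 n}} (cell n e t) (q′ ℤ.- q) (cell<L n e t))
    where
    l = ℤ.+ L n
    q = ((e ℤ.+ ℤ.+ 0) ℤ./ℕ L n) {{L≢0 n}}
    q′ = ((e ℤ.+ ℤ.+ t) ℤ./ℕ L n) {{L≢0 n}}
    e₀ : e ℤ.+ ℤ.+ 0 ≡ ℤ.+ cell n e 0 ℤ.+ q ℤ.* l
    e₀ = ℤ.a≡a%ℕn+[a/ℕn]*n (e ℤ.+ ℤ.+ 0) (L n) {{L≢0 n}}
    eₜ : e ℤ.+ ℤ.+ t ≡ ℤ.+ cell n e t ℤ.+ q′ ℤ.* l
    eₜ = ℤ.a≡a%ℕn+[a/ℕn]*n (e ℤ.+ ℤ.+ t) (L n) {{L≢0 n}}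
    split : ℤ.+ cell n e 0 ℤ.+ ℤ.+ t ≡ ℤ.+ cell n e t ℤ.+ (q′ ℤ.- q) ℤ.* l
    split = trans (eq₁ (ℤ.+ cell n e 0) (ℤ.+ t) (q ℤ.* l)) (trans (cong (λ z → z ℤ.- q ℤ.* l ℤ.+ ℤ.+ t) (trans (sym e₀) (ℤₚ.+-identityʳ e)))
      (trans (eq₂ e (ℤ.+ t) (q ℤ.* l)) (trans (cong (λ z → z ℤ.- q ℤ.* l) eₜ) (eq₃ (ℤ.+ cell n e t) q′ q l))))
      where
      eq₁ : ∀ c t u → c ℤ.+ t ≡ c ℤ.+ u ℤ.- u ℤ.+ t
      eq₁ = ℤ-Solver.solve-∀
      eq₂ : ∀ e t u → e ℤ.- u ℤ.+ t ≡ e ℤ.+ t ℤ.- u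
      eq₂ = ℤ-Solver.solve-∀
      eq₃ : ∀ c q′ q l → c ℤ.+ q′ ℤ.* l ℤ.- q ℤ.* l ≡ c ℤ.+ (q′ ℤ.- q) ℤ.* l
      eq₃ = ℤ-Solver.solve-∀

  located-arcAt : ∀ n e x → Located n e x → x ∈ arcAt n (ℤ.+ cell n e 0)
  located-arcAt n e x loc = with-s (cell-position n e 0)
    where
    with-s : ∃[ s ] ζ e + ι 0 ≡ ι (cell n e 0) + ζ s * ι (L n) → x ∈ arcAt n (ℤ.+ cell n e 0)
    with-s (s , eq) = located-∈ n (ℤ.+ cell n e 0) (x +ᵣ fromℤ (ℤ.- s)) x s (Ev-map shift loc)
      (0 , λ i _ → ≤-trans (≤-reflexive (cong ∣_∣ (trans (cong₂ (λ u v → approx x i - (approx x i + u + v)) (trans (sym (ζ≡/1 (ℤ.- s))) (ζ-neg s)) (sym (ζ≡/1 s)))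
        (eq₀ (approx x i) (ζ s))))) (<⇒≤ (0<¼ (0<h n))))
      where
      eq₀ : ∀ x s → x - (x + - s + s) ≡ 0ℚ
      eq₀ = solve-∀ ring
      c₀ = ι (cell n e 0)
      e≡ : ζ e * h n ≡ c₀ * h n + ζ s
      e≡ = trans (cong (_* h n) (trans (sym (+-identityʳ (ζ e))) (trans (cong (ζ e +_) (sym ι0)) eq)))
        (trans (*-distribʳ-+ (h n) c₀ (ζ s * ι (L n))) (cong (c₀ * h n +_) (unit n s)))
      shift : ∀ i → (ζ e + ½) * h n ≤ approx x i × approx x i ≤ (ζ e + 2ℚ + ½) * h n →
        (c₀ + ½) * h n ≤ approx x i + (ℤ.- s) / 1 × approx x i + (ℤ.- s) / 1 ≤ (c₀ + 2ℚ + ½) * h n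
      shift i (lo , up) =
        subst (λ z → (c₀ + ½) * h n ≤ approx x i + z) (trans (sym (ζ-neg s)) (ζ≡/1 (ℤ.- s)))
          (by-diff (diff lo) (trans (eq₁ c₀ (ζ s) (h n) (approx x i)) (trans (cong (λ z → approx x i - (z + ½ * h n)) (sym e≡)) (eq₂ (ζ e) (h n) (approx x i))))) ,
        subst (λ z → approx x i + z ≤ (c₀ + 2ℚ + ½) * h n) (trans (sym (ζ-neg s)) (ζ≡/1 (ℤ.- s)))
          (by-diff (diff up) (trans (eq₃ c₀ (ζ s) (h n) (approx x i)) (trans (cong (λ z → z + (2ℚ + ½) * h n - approx x i) (sym e≡)) (eq₄ (ζ e) (h n) (approx x i)))))
        where
        eq₁ : ∀ c s h x → x + - s - (c + ½) * h ≡ x - (c * h + s + ½ * h)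
        eq₁ = solve-∀ ring
        eq₂ : ∀ e h x → x - (e * h + ½ * h) ≡ x - (e + ½) * h
        eq₂ = solve-∀ ring
        eq₃ : ∀ c s h x → (c + (1ℚ + 1ℚ) + ½) * h - (x + - s) ≡ c * h + s + (1ℚ + 1ℚ + ½) * h - x
        eq₃ = solve-∀ ring
        eq₄ : ∀ e h x → e * h + (1ℚ + 1ℚ + ½) * h - x ≡ (e + (1ℚ + 1ℚ) + ½) * h - x
        eq₄ = solve-∀ ring

  ∈-goodArc : ∀ n c x → GoodTriple n c → x ∈ arcAt n (ℤ.+ c) → x ∈ goodArc n c
  ∈-goodArc n c x good x∈ = go (goodTriple? n c)
    where
    go : ∀ g? → x ∈ goodArc′ n c g?
    go (yes _) = x∈
    go (no ¬g) = ⊥-elim (¬g good)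

  -- There are L n windows of measure at most 3 `threshold n` each, and L n h n = 1, so the cell
  -- length cancels and dⁿ remains. The good cells fill almost all of the circle and yet carry
  -- almost no mass.
  goodArc-total : ∀ n → Σ (L n) (λ _ → 3ℚ * threshold n) ≤ 12ℚ * k₁ * dⁿ n
  goodArc-total n = ≤-trans (≤-reflexive (Σ-const (L n) (3ℚ * threshold n))) (≤-trans
    (*-mono-≤ˡ (0≤ι (L n)) (≤-trans (by-diff (0≤3 ⊠ 0≤threshold n) (eq (3ℚ * threshold n))) (6threshold≤ n)))
    (≤-reflexive (trans (eq′ (ι (L n)) (12ℚ * k₁ * dⁿ n) (h n)) (trans (cong (12ℚ * k₁ * dⁿ n *_) (L*h n)) (*-identityʳ _)))))
    where
    eq : ∀ a → a + a - a ≡ a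
    eq = solve-∀ ring
    eq′ : ∀ l c h → l * (c * h) ≡ c * (l * h)
    eq′ = solve-∀ ring

  -- The limit superior of the bad arcs; ¬ ¬ suffices because coverings are double-negated.
  Heavy : ℝ → Set
  Heavy x = ∀ J → ¬ ¬ BadFrom J x

  light-null : NullFor μ (λ x → ¬ Heavy x)
  light-null = cover-by-levels (ArcMeasure≤ μ) (λ x → ¬ Heavy x) goodArc (λ n _ → 3ℚ * threshold n) (12ℚ * k₁) (0≤12 ⊠ 0≤k₁)
    (λ n _ → 0≤3 ⊠ 0≤threshold n) goodArc-total goodArc-measure
    -- The goal is a negation, so a level J′ beyond which x meets no bad cell may be taken from
    -- `light`; the window at level J ⊔ J′ then consists of good cells.
    (λ J x light uncovered → light (λ J′ good → uncovered (found J J′ x good)))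
    where
    found : ∀ J J′ x → ¬ BadFrom J′ x → ∃[ n ] ∃[ c ] (J ℕ.≤ n × c ℕ.< L n × x ∈ goodArc n c)
    found J J′ x good = with-e (locate (J ℕ.⊔ J′) x)
      where
      n = J ℕ.⊔ J′
      with-e : ∃[ e ] Located n e x → ∃[ n ] ∃[ c ] (J ℕ.≤ n × c ℕ.< L n × x ∈ goodArc n c)
      with-e (e , loc) = n , cell n e 0 , ℕₚ.m≤m⊔n J J′ , cell<L n e 0 ,
        ∈-goodArc n (cell n e 0) x
          (λ t t≤2 → subst (λ c → ¬ Bad n c) (sym (cell-shift n e t)) (good-cells J′ x good n e t (ℕₚ.m≤n⊔m J J′) t≤2 loc))
          (located-arcAt n e x loc)

  singular : SingularToLebesgue μ
  singular = Heavy , bad-null Heavy (λ J x heavy → heavy J) , light-null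

theorem7 : (k : ℕ) .{{_ : NonTrivial k}} →
    Σ[ μ ∈ ProbabilityMeasure ]
    (IsGhostMeasure k (zaremba k) (zaremba-blockSum≢0 k) μ ×
    SingularContinuous μ ×
    (Σ[ F ∈ (ℝ → ℝ) ]
    (IsDistributionFunction μ F ×
    ContinuousOnUnit F ×
    AlmostEverywhere (λ x → HasDerivative F x 0ℝ))))
theorem7 k = μ , μ-isGhostMeasure , (noAtoms , singular) , F , F-isDistributionFunction , F-continuous , derivative-zero-ae
  where open Ghost k
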